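{- Let $a$ and $b$ be integers with $a,b\ge 2$ and let $\mathrm{b}(a,b)$ denote the base size of the symmetric group $\mathrm{Sym}(ab)$ in its action on the set of partitions of $\{1,\ldots,ab\}$ into $b$ parts each of cardinality $a$. Then: (1) when $a=2$: $\mathrm{b}(2,2)$ is undefined, $\mathrm{b}(2,3)=4$, and $\mathrm{b}(2,b)=3$ for every $b\ge 4$; (2) when $b=2$: $\mathrm{b}(4,2)=5$ and $\mathrm{b}(a,2)=\lceil\log_2(a+3)\rceil+1$ for every $a\notin\{2,4\}$; (3) when $a\ge 3$ and $b\ge 3$: $\mathrm{b}(a,b)=\lceil\log_b(a+2)\rceil+1$, unless $(a,b)\in\{(3,6),(3,7),(4,7),(7,3)\}$ or $b=a+2$; (4) $\mathrm{b}(3,6)=\mathrm{b}(3,7)=\mathrm{b}(4,7)=3$, $\mathrm{b}(7,3)=4$, and for every $a\ge 3$, $\mathrm{b}(a,a+2)=3$.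
   Context: For a permutation group $G$ on a set $X$, a base is a subset of $X$ whose pointwise stabilizer in $G$ is the identity; the base size is the smallest cardinality of a base (it is undefined if no base exists, i.e. if the action is not faithful). An $(a,b)$-regular partition of a set of size $ab$ is a partition into $b$ parts each of cardinality $a$. $\mathrm{Sym}(ab)$ acts naturally on the set of $(a,b)$-regular partitions of $\{1,\ldots,ab\}$. -}

module Defs where

open import Data.Nat using (ℕ; zero; suc; _+_; _*_; _^_; _≤_; _<_)
open import Data.Fin using (Fin; _≟_)
open import Data.Fin.Permutation using (Permutation′; _⟨$⟩ʳ_)
open import Data.List using (List; length; filter; allFin)
open import Data.List.Relation.Unary.All using (All)
open import Data.Product using (Σ; _×_; _,_)
open import Relation.Binary.PropositionalEquality using (_≡_)
open import Relation.Nullary using (¬_)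

-- A partition of Fin (a * b) into b parts is given by a labelling
-- f : Fin (a * b) → Fin b (x and y lie in the same part iff f x ≡ f y).
-- The labelling is (a,b)-regular iff every label class has exactly a elements
-- (hence exactly b nonempty parts, each of cardinality a).
Labelling : ℕ → ℕ → Set
Labelling a b = Fin (a * b) → Fin b

IsRegular : (a b : ℕ) → Labelling a b → Set
IsRegular a b f = (j : Fin b) → length (filter (λ x → f x ≟ j) (allFin (a * b))) ≡ a

RegularPartition : ℕ → ℕ → Set
RegularPartition a b = Σ (Labelling a b) (IsRegular a b)

Fixes : (a b : ℕ) → Permutation′ (a * b) → RegularPartition a b → Set
Fixes a b σ (f , _) =
  (x y : Fin (a * b)) →
    (f x ≡ f y → f (σ ⟨$⟩ʳ x) ≡ f (σ ⟨$⟩ʳ y)) × (f (σ ⟨$⟩ʳ x) ≡ f (σ ⟨$⟩ʳ y) → f x ≡ f y)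

IsBase : (a b : ℕ) → List (RegularPartition a b) → Set
IsBase a b L = (σ : Permutation′ (a * b)) → All (Fixes a b σ) L → (x : Fin (a * b)) → σ ⟨$⟩ʳ x ≡ x

HasBaseOfSize : ℕ → ℕ → ℕ → Set
HasBaseOfSize a b k = Σ (List (RegularPartition a b)) (λ L → length L ≡ k × IsBase a b L)

BaseSize : ℕ → ℕ → ℕ → Set
BaseSize a b k = HasBaseOfSize a b k × ((m : ℕ) → m < k → ¬ HasBaseOfSize a b m)

BaseSizeUndefined : ℕ → ℕ → Set
BaseSizeUndefined a b = (k : ℕ) → ¬ HasBaseOfSize a b k

IsCeilLog : ℕ → ℕ → ℕ → Set
IsCeilLog b n k = n ≤ b ^ k × ((j : ℕ) → n ≤ b ^ j → k ≤ j)

-- The label vectors of the points turn a base of size m into a set of codes in (Fin b)^m with a codes in every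
-- slice that no nontrivial m-tuple of label permutations preserves, and conversely. The complement of such a
-- set is another one, with a replaced by b^(m-1) - a. Since all symmetries survive when a = 0 or a = 1, it
-- follows that a + 2 ≤ b^(m-1). Equality fails as well when b = 2 or m = 2: by complementation this is the case
-- a = 2, where four points in pairs are always preserved by a Klein four-group, and where two perfect matchings
-- form even cycles, which can be reflected. Four more cases are excluded by exhaustive search up to symmetry:
-- three matchings of six points (which has (7 , 3) as its complement), four bisections of eight points, and the
-- cubic bipartite graphs on 6 + 6 and on 7 + 7 vertices.
--
-- In the other direction, for m ≥ 3 and b ≥ 3 a union of cosets of the diagonal of (ℤ/b)^m is chosen whose only
-- symmetries are the diagonal translations, and these are destroyed by a small change. For m = 2 a few entries
-- of a circulant band matrix are changed, and for b = 2 antipodal pairs are combined with a plane containing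
-- no antipodal pair.
module Submission where

open import Defs
open import Data.Bool.Base using (Bool; true; false; T; _∧_; _∨_; not; if_then_else_)
open import Data.Bool.ListAction using (all)
open import Data.Empty using (⊥; ⊥-elim)
open import Data.Fin.Base using (Fin; zero; suc; toℕ; fromℕ<; cast; combine; remQuot; punchIn; punchOut; finToFun; funToFin)
open import Data.Fin.Permutation using (Permutation′; permutation; transpose; _⟨$⟩ʳ_; _⟨$⟩ˡ_; inverseˡ; inverseʳ)
open import Data.Fin.Properties using (_≟_; any?; all?)
import Data.Fin.Properties as Fin
open import Data.List.Base as List using (List; []; _∷_; length; filter; allFin)
import Data.List.Properties as List
open import Data.List.Membership.Propositional using (_∈_)
import Data.List.Membership.Propositional.Properties as ∈
open import Data.List.Relation.Unary.All as All using (All)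
import Data.List.Relation.Unary.All.Properties as All
import Data.List.Relation.Unary.Any as Any
import Data.List.Relation.Unary.AllPairs as AllPairs
open import Data.List.Relation.Unary.Unique.Propositional using (Unique)
import Data.List.Relation.Unary.Unique.Propositional.Properties as Unique
open import Data.Nat.Base using (ℕ; zero; suc; _+_; _*_; _^_; _∸_; _≤_; _<_; z≤n; s≤s; NonZero; >-nonZero; ≢-nonZero⁻¹; ⌊_/2⌋; ⌈_/2⌉)
import Data.Nat.Properties as ℕ
open import Data.Nat.Logarithm using (⌈log₂_⌉; ⌈log₂⌉-mono-≤; ⌈log₂⌈n/2⌉⌉≡⌈log₂n⌉∸1; ⌈log₂2^n⌉≡n)
open import Data.Product.Base using (Σ; ∃; _×_; _,_; proj₁; proj₂)
open import Data.Sum.Base using (_⊎_; inj₁; inj₂; [_,_]′)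
open import Data.Unit.Base using (⊤; tt)
open import Data.Vec.Base as Vec using (Vec)
open import Function.Base using (id; case_of_)
open import Function.Bundles using (_↔_; Inverse)
open import Function.Definitions using (Injective)
open import Relation.Binary.PropositionalEquality using (_≡_; _≢_; refl; sym; trans; cong; cong₂; subst; module ≡-Reasoning)
open import Relation.Binary.Definitions using (tri<; tri≈; tri>)
open import Relation.Nullary using (¬_; Dec; yes; no; does; contradiction)
open import Relation.Nullary.Decidable using (¬?; _×-dec_; toWitness; _→-dec_; _⊎-dec_)
open import Data.Nat.DivMod using (_%_; _/_; m%n<n; m≡m%n+[m/n]*n; m<n⇒m%n≡m; n%n≡0; [m+n]%n≡m%n)
open import Data.Product.Function.NonDependent.Propositional using (_×-↔_)
open import Data.Sum.Function.Propositional using (_⊎-↔_)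
open import Function.Construct.Composition using (_↔-∘_)
open import Function.Construct.Identity using (↔-id)
open import Function.Construct.Symmetry using (↔-sym)
open import Algebra.Properties.CommutativeSemigroup ℕ.+-commutativeSemigroup using (interchange)
open import Data.Nat.Tactic.RingSolver using (solve-∀; solve)
open import Data.Product.Properties using (,-injectiveˡ; ,-injectiveʳ)
open import Data.Bool.Properties as Bool using (T?; ∧-identityʳ)
open import Data.Vec.Properties using (lookup∘tabulate; lookup∘updateAt; lookup∘updateAt′; lookup-replicate)
open import Data.Maybe.Base using (Maybe; just; nothing)
open import Data.Nat.Induction using (<-rec)

-- Counting decidable subsets of Fin n

-- Since a = 2 and its complement come from matchings, the constructions have to cover 3 ≤ a ≤
-- b^(m-1) - 3. For m ≥ 3 and b ≥ 3 put B = b^(m-2). The coset construction yields remainders 0 and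
-- at least 3 of a modulo B; remainders 1 and 2 become B - 1 and B - 2 in the complement. This fails
-- only for B = 3 and B = 4, whence the explicit tables for (4 , 3) and (6 , 4). For m = 2
-- complementation allows 2a ≤ b. The band matrix is told apart from its images by an adjacency
-- graph of rows, and b ≥ 8 makes one of its paths longer than the other, three-vertex path. Smaller
-- b leave exactly (3 , 6), (3 , 7) and (4 , 7), the exceptional pairs. The exhaustive searches are
-- evaluated during type checking, so they have to be small: triples of matchings are reduced to
-- intersections of Boolean rows, bisections to 15 translations, and cubic graphs to partial
-- matrices up to renaming of rows and columns, each completed matrix being refuted by a symmetry
-- from a list prepared in advance.

lookup-injective : ∀ {A : Set} {xs : List A} → Unique xs → ∀ i j → List.lookup xs i ≡ List.lookup xs j → i ≡ j
lookup-injective {xs = _ ∷ _} (_ AllPairs.∷ _) zero zero _ = refl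
lookup-injective {xs = _ ∷ _} (p AllPairs.∷ _) zero (suc j) eq = contradiction eq (All.lookup p (∈.∈-lookup j))
lookup-injective {xs = _ ∷ _} (p AllPairs.∷ _) (suc i) zero eq = contradiction (sym eq) (All.lookup p (∈.∈-lookup i))
lookup-injective {xs = _ ∷ _} (_ AllPairs.∷ u) (suc i) (suc j) eq = cong suc (lookup-injective u i j eq)

count : ∀ {n} {P : Fin n → Set} → (∀ x → Dec (P x)) → ℕ
count {n} P? = length (filter P? (allFin n))

module _ {n} {P : Fin n → Set} (P? : ∀ x → Dec (P x)) where

  enum : Fin (count P?) → Fin n
  enum = List.lookup (filter P? (allFin n))

  enum-sat : ∀ k → P (enum k)
  enum-sat k = proj₂ (∈.∈-filter⁻ P? {xs = allFin n} (∈.∈-lookup k))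

  enum-injective : ∀ {k k′} → enum k ≡ enum k′ → k ≡ k′
  enum-injective = lookup-injective (Unique.filter⁺ P? (Unique.allFin⁺ n)) _ _

  private
    place : ∀ x → P x → x ∈ filter P? (allFin n)
    place x p = ∈.∈-filter⁺ P? (∈.∈-allFin x) p

  rank : ∀ x → P x → Fin (count P?)
  rank x p = Any.index (place x p)

  enum-rank : ∀ x p → enum (rank x p) ≡ x
  enum-rank x p = sym (Any.lookup-index (place x p))
    where open import Data.List.Relation.Unary.Any.Properties as Any

  rank-injective : ∀ {x y} p q → rank x p ≡ rank y q → x ≡ y
  rank-injective {x} {y} p q eq = trans (sym (enum-rank x p)) (trans (cong enum eq) (enum-rank y q))

count-≤ : ∀ {m n} {P : Fin m → Set} {Q : Fin n → Set} (P? : ∀ x → Dec (P x)) (Q? : ∀ x → Dec (Q x))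
  (g : ∀ x → P x → Fin n) → (∀ x p → Q (g x p)) → (∀ x y p q → g x p ≡ g y q → x ≡ y) → count P? ≤ count Q?
count-≤ P? Q? g gQ g-inj = Fin.injective⇒≤ {f = λ k → rank Q? (g (enum P? k) (enum-sat P? k)) (gQ _ _)}
  λ eq → enum-injective P? (g-inj _ _ _ _ (rank-injective Q? _ _ eq))

count-all : ∀ {n} {P : Fin n → Set} (P? : ∀ x → Dec (P x)) → (∀ x → P x) → count P? ≡ n
count-all {n} P? p = trans (cong length (List.filter-all P? (All.universal p (allFin n)))) (List.length-tabulate id)

count-split : ∀ {n} {P Q : Fin n → Set} (P? : ∀ x → Dec (P x)) (Q? : ∀ x → Dec (Q x)) →
  count (λ x → Q? x ×-dec P? x) + count (λ x → ¬? (Q? x) ×-dec P? x) ≡ count P?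
count-split {n} P? Q? = go (allFin n)
  where
  go : ∀ xs → length (filter (λ x → Q? x ×-dec P? x) xs) + length (filter (λ x → ¬? (Q? x) ×-dec P? x) xs) ≡ length (filter P? xs)
  go [] = refl
  go (x ∷ xs) with Q? x | P? x | go xs
  ... | yes _ | yes _ | ih = cong suc ih
  ... | yes _ | no _  | ih = ih
  ... | no _  | yes _ | ih = trans (ℕ.+-suc _ _) (cong suc ih)
  ... | no _  | no _  | ih = ih

injective⇒surjective : ∀ {n} (f : Fin n → Fin n) → Injective _≡_ _≡_ f → ∀ y → ∃ λ x → f x ≡ y
injective⇒surjective {suc n} f f-inj y with any? (λ x → f x ≟ y)
... | yes p = p
... | no ¬p = contradiction (Fin.injective⇒≤ {f = λ x → punchOut (avoids x)} λ eq → f-inj (Fin.punchOut-injective (avoids _) (avoids _) eq)) ℕ.1+n≰n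
  where
  avoids : ∀ x → y ≢ f x
  avoids x eq = ¬p (x , sym eq)

injective⇒permutation : ∀ {n} (f : Fin n → Fin n) → Injective _≡_ _≡_ f → Permutation′ n
injective⇒permutation f f-inj = permutation f (λ y → proj₁ (sur y)) (λ y → proj₂ (sur y)) (λ x → f-inj (proj₂ (sur (f x))))
  where sur = injective⇒surjective f f-inj

-- An injection between sets of equal size is a bijection, so every fibre of its second component is
-- a copy of `Fin a`. The parametric constructions obtain regularity in this way, without counting
-- any block.
regular-if-injective : ∀ {a b} (f : Labelling a b) (φ : Fin (a * b) → Fin a × Fin b) →
  Injective _≡_ _≡_ φ → (∀ x → proj₂ (φ x) ≡ f x) → IsRegular a b f
regular-if-injective {a} {b} f φ φ-inj φf j = ℕ.≤-antisym
  (subst (count (λ x → f x ≟ j) ≤_) (count-all {a} {λ _ → ⊤} (λ _ → yes tt) _)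
    (count-≤ _ _ (λ x _ → proj₁ (φ x)) _ λ x y p q eq →
      φ-inj (cong₂ _,_ eq (trans (φf x) (trans p (sym (trans (φf y) q)))))))
  (subst (_≤ count (λ x → f x ≟ j)) (count-all {a} {λ _ → ⊤} (λ _ → yes tt) _)
    (count-≤ _ _ (λ c _ → proj₁ (preimage c)) (λ c _ → trans (sym (φf _)) (cong proj₂ (proj₂ (preimage c))))
      λ c d _ _ eq → cong proj₁ (trans (sym (proj₂ (preimage c))) (trans (cong φ eq) (proj₂ (preimage d))))))
  where
  φ′ : Fin (a * b) → Fin (a * b)
  φ′ x = combine (proj₁ (φ x)) (proj₂ (φ x))
  φ′-inj : Injective _≡_ _≡_ φ′
  φ′-inj {x} {y} eq with Fin.combine-injective _ _ _ _ eq
  ... | p , q = φ-inj (cong₂ _,_ p q)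
  preimage : ∀ c → ∃ λ x → φ x ≡ (c , j)
  preimage c with injective⇒surjective φ′ φ′-inj (combine c j)
  ... | x , eq with Fin.combine-injective _ _ _ _ eq
  ... | p , q = x , cong₂ _,_ p q

-- Bases as families of labellings

Family : ℕ → ℕ → ℕ → Set
Family m a b = Fin m → RegularPartition a b

IsBaseFamily : ∀ {m a b} → Family m a b → Set
IsBaseFamily {m} {a} {b} F = (σ : Permutation′ (a * b)) → (∀ l → Fixes a b σ (F l)) → ∀ x → σ ⟨$⟩ʳ x ≡ x

fromFamily : ∀ {m a b} (F : Family m a b) → IsBaseFamily F → HasBaseOfSize a b m
fromFamily F base = List.tabulate F , List.length-tabulate F , λ σ fix → base σ (All.tabulate⁻ fix)

toFamily : ∀ {m a b} → HasBaseOfSize a b m → Σ (Family m a b) IsBaseFamily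
toFamily (L , refl , base) = List.lookup L , λ σ fix → base σ (lookups L fix)
  where
  lookups : ∀ {A : Set} {P : A → Set} (xs : List A) → (∀ i → P (List.lookup xs i)) → All P xs
  lookups [] p = All.[]
  lookups (x ∷ xs) p = p zero All.∷ lookups xs (λ i → p (suc i))

-- Repeating a partition changes nothing; the index `suc m` provides one to repeat.
base-suc : ∀ {m a b} → HasBaseOfSize a b (suc m) → HasBaseOfSize a b (suc (suc m))
base-suc h = let F , base = toFamily h in
  fromFamily (λ { zero → F zero ; (suc l) → F l }) λ σ fix → base σ (λ l → fix (suc l))

base-mono : ∀ {a b m n} → suc m ≤ n → HasBaseOfSize a b (suc m) → HasBaseOfSize a b n
base-mono {a} {b} {m} m<n h = subst (HasBaseOfSize a b) (ℕ.m∸n+n≡m m<n) (go _)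
  where
  go : ∀ d → HasBaseOfSize a b (d + suc m)
  go zero = h
  go (suc zero) = base-suc h
  go (suc (suc d)) = base-suc (go (suc d))

representative : ∀ {a b} → 1 ≤ a → (p : RegularPartition a b) → ∀ j → ∃ λ x → proj₁ p x ≡ j
representative 1≤a (f , reg) j = enum f≟j k , enum-sat f≟j k
  where
  f≟j = λ x → f x ≟ j
  k : Fin (count f≟j)
  k = cast (sym (reg j)) (fromℕ< 1≤a)

module _ {m a b} (F : Family m a b) where

  label : Fin m → Fin (a * b) → Fin b
  label l = proj₁ (F l)

  CodeInjective : Set
  CodeInjective = ∀ {x y} → (∀ l → label l x ≡ label l y) → x ≡ y

  -- If two points had all labels in common, their transposition would preserve every labelling.
  base⇒code-injective : IsBaseFamily F → CodeInjective
  base⇒code-injective base {x} {y} eq = trans (sym (base (transpose x y) fixes x)) swaps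
    where
    swaps : transpose x y ⟨$⟩ʳ x ≡ y
    swaps with x ≟ x
    ... | yes _ = refl
    ... | no x≢x = contradiction refl x≢x
    same : ∀ l z → label l (transpose x y ⟨$⟩ʳ z) ≡ label l z
    same l z with z ≟ x
    ... | yes refl = sym (eq l)
    ... | no _ with z ≟ y
    ...   | yes refl = eq l
    ...   | no _ = refl
    fixes : ∀ l → Fixes a b (transpose x y) (F l)
    fixes l z w = (λ p → trans (same l z) (trans p (sym (same l w)))) , λ p → trans (sym (same l z)) (trans p (same l w))

  -- A permutation fixing every partition amounts to label permutations π l carrying the code set into itself.
  base⇒rigid : 1 ≤ a → IsBaseFamily F → (π : Fin m → Fin b → Fin b) → (∀ l → Injective _≡_ _≡_ (π l)) →
    (s : Fin (a * b) → Fin (a * b)) → (∀ l x → label l (s x) ≡ π l (label l x)) → ∀ l j → π l j ≡ j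
  base⇒rigid 1≤a base π π-inj s sπ l j with representative 1≤a (F l) j
  ... | x , refl = trans (sym (sπ l x)) (cong (label l) (base σ fixes x))
    where
    s-inj : Injective _≡_ _≡_ s
    s-inj {x} {y} eq = base⇒code-injective base λ l → π-inj l (trans (sym (sπ l x)) (trans (cong (label l) eq) (sπ l y)))
    σ = injective⇒permutation s s-inj
    fixes : ∀ l → Fixes a b σ (F l)
    fixes l z w = (λ p → trans (sπ l z) (trans (cong (π l) p) (sym (sπ l w)))) ,
      λ p → π-inj l (trans (sym (sπ l z)) (trans p (sπ l w)))

  -- A permutation `σ` that fixes the partitions permutes the blocks of each of them, and `π l`
  -- reads this action off at representatives. The map `t` comes from the inverse of `σ`: the codes
  -- are mapped onto themselves, not merely into themselves.
  rigid⇒base : 1 ≤ a → CodeInjective →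
    ((π : Fin m → Fin b → Fin b) → (∀ l → Injective _≡_ _≡_ (π l)) → (s t : Fin (a * b) → Fin (a * b)) →
      (∀ l x → label l (s x) ≡ π l (label l x)) → (∀ l x → π l (label l (t x)) ≡ label l x) → ∀ l j → π l j ≡ j) →
    IsBaseFamily F
  rigid⇒base 1≤a code-inj rigid σ fix x = code-inj λ l → trans (σπ l x) (rigid π π-inj (σ ⟨$⟩ʳ_) (σ ⟨$⟩ˡ_) σπ
      (λ l y → trans (sym (σπ l (σ ⟨$⟩ˡ y))) (cong (label l) (inverseʳ σ))) l (label l x))
    where
    rep : ∀ l j → ∃ λ x → label l x ≡ j
    rep l = representative 1≤a (F l)
    π : Fin m → Fin b → Fin b
    π l j = label l (σ ⟨$⟩ʳ proj₁ (rep l j))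
    σπ : ∀ l x → label l (σ ⟨$⟩ʳ x) ≡ π l (label l x)
    σπ l x = proj₁ (fix l _ _) (sym (proj₂ (rep l (label l x))))
    π-inj : ∀ l → Injective _≡_ _≡_ (π l)
    π-inj l {i} {j} eq = trans (sym (proj₂ (rep l i))) (trans (proj₂ (fix l _ _) eq) (proj₂ (rep l j)))

-- Codes: the elements of (Fin b)^m, numbered by Fin (b ^ m)

digit : ∀ m b → Fin (b ^ m) → Fin m → Fin b
digit m b = finToFun {b} {m}

encode : ∀ m b → (Fin m → Fin b) → Fin (b ^ m)
encode m b = funToFin {m} {b}

digit-encode : ∀ m b (f : Fin m → Fin b) l → digit m b (encode m b f) l ≡ f l
digit-encode m b = Fin.finToFun-funToFin {m} {b}

encode-cong : ∀ m b {f g : Fin m → Fin b} → (∀ l → f l ≡ g l) → encode m b f ≡ encode m b g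
encode-cong zero b eq = refl
encode-cong (suc m) b eq = cong₂ combine (eq zero) (encode-cong m b (λ l → eq (suc l)))

digit-injective : ∀ m b {y z : Fin (b ^ m)} → (∀ l → digit m b y l ≡ digit m b z l) → y ≡ z
digit-injective m b {y} {z} eq =
  trans (sym (Fin.funToFin-finToFin {m} {b} y)) (trans (encode-cong m b eq) (Fin.funToFin-finToFin {m} {b} z))

always? : ∀ n → (x : Fin n) → Dec ⊤
always? _ _ = yes tt

module _ (m b : ℕ) (l : Fin (suc m)) (j : Fin b) where

  slice? : (y : Fin (b ^ suc m)) → Dec (digit (suc m) b y l ≡ j)
  slice? y = digit (suc m) b y l ≟ j

  private
    restrict : Fin (b ^ suc m) → Fin (b ^ m)
    restrict y = encode m b (λ i → digit (suc m) b y (punchIn l i))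

    restrict-inj : ∀ y z (p : digit (suc m) b y l ≡ j) (q : digit (suc m) b z l ≡ j) → restrict y ≡ restrict z → y ≡ z
    restrict-inj y z p q eq = digit-injective (suc m) b go
      where
      go : ∀ i → digit (suc m) b y i ≡ digit (suc m) b z i
      go i with l ≟ i
      ... | yes refl = trans p (sym q)
      ... | no l≢i = subst (λ i → digit (suc m) b y i ≡ digit (suc m) b z i) (Fin.punchIn-punchOut l≢i)
        (trans (sym (digit-encode m b (λ i → digit (suc m) b y (punchIn l i)) (punchOut l≢i)))
          (trans (cong (λ u → digit m b u (punchOut l≢i)) eq)
            (digit-encode m b (λ i → digit (suc m) b z (punchIn l i)) (punchOut l≢i))))

    ext : Fin (b ^ m) → Fin (suc m) → Fin b
    ext z i with l ≟ i
    ... | yes _ = j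
    ... | no l≢i = digit m b z (punchOut l≢i)

    ext-l : ∀ z → ext z l ≡ j
    ext-l z with l ≟ l
    ... | yes _ = refl
    ... | no l≢l = contradiction refl l≢l

    ext-punchIn : ∀ z i → ext z (punchIn l i) ≡ digit m b z i
    ext-punchIn z i with l ≟ punchIn l i
    ... | yes eq = contradiction (sym eq) (Fin.punchInᵢ≢i l i)
    ... | no l≢ = cong (digit m b z) (trans (Fin.punchOut-cong l refl) (Fin.punchOut-punchIn l))

    extend : Fin (b ^ m) → Fin (b ^ suc m)
    extend z = encode (suc m) b (ext z)

    extend-inj : ∀ y z (p q : ⊤) → extend y ≡ extend z → y ≡ z
    extend-inj y z _ _ eq = digit-injective m b λ i →
      trans (sym (ext-punchIn y i)) (trans (sym (digit-encode (suc m) b (ext y) (punchIn l i)))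
        (trans (cong (λ u → digit (suc m) b u (punchIn l i)) eq)
          (trans (digit-encode (suc m) b (ext z) (punchIn l i)) (ext-punchIn z i))))

  count-slice : count slice? ≡ b ^ m
  count-slice = ℕ.≤-antisym
    (subst (count slice? ≤_) (count-all (always? (b ^ m)) _) (count-≤ slice? (always? (b ^ m)) (λ y _ → restrict y) _ restrict-inj))
    (subst (_≤ count slice?) (count-all (always? (b ^ m)) _) (count-≤ (always? (b ^ m)) slice? (λ z _ → extend z)
      (λ z _ → trans (digit-encode (suc m) b (ext z) l) (ext-l z)) extend-inj))

module CodeSet {m a b} (F : Family m a b) (code-inj : CodeInjective F) where

  In : Fin (b ^ m) → Set
  In y = ∃ λ x → ∀ l → label F l x ≡ digit m b y l

  In? : ∀ y → Dec (In y)
  In? y = any? λ x → all? λ l → label F l x ≟ digit m b y l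

  codeOf : Fin (a * b) → Fin (b ^ m)
  codeOf x = encode m b (λ l → label F l x)

  digit-codeOf : ∀ x l → digit m b (codeOf x) l ≡ label F l x
  digit-codeOf x = digit-encode m b (λ l → label F l x)

  codeOf-injective : ∀ {x y} → codeOf x ≡ codeOf y → x ≡ y
  codeOf-injective {x} {y} eq = code-inj λ l →
    trans (sym (digit-codeOf x l)) (trans (cong (λ u → digit m b u l) eq) (digit-codeOf y l))

  codeOf-In : ∀ x → In (codeOf x)
  codeOf-In x = x , λ l → sym (digit-codeOf x l)

  In-unique : ∀ {y z} (p : In y) (q : In z) → proj₁ p ≡ proj₁ q → y ≡ z
  In-unique (x , p) (.x , q) refl = digit-injective m b λ l → trans (sym (p l)) (q l)

  count-In : count In? ≡ a * b
  count-In = ℕ.≤-antisym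
    (subst (count In? ≤_) (count-all (always? (a * b)) _) (count-≤ In? (always? (a * b)) (λ _ → proj₁) _ (λ _ _ → In-unique)))
    (subst (_≤ count In?) (count-all (always? (a * b)) _)
      (count-≤ (always? (a * b)) In? (λ x _ → codeOf x) (λ x _ → codeOf-In x) (λ _ _ _ _ → codeOf-injective)))

  In-slice? : ∀ l j y → Dec (In y × digit m b y l ≡ j)
  In-slice? l j y = In? y ×-dec digit m b y l ≟ j

  count-In-slice : ∀ l j → count (In-slice? l j) ≡ a
  count-In-slice l j = trans (ℕ.≤-antisym
    (count-≤ (In-slice? l j) block? (λ _ p → proj₁ (proj₁ p))
      (λ y p → trans (proj₂ (proj₁ p) l) (proj₂ p)) (λ _ _ p q → In-unique (proj₁ p) (proj₁ q)))
    (count-≤ block? (In-slice? l j) (λ x _ → codeOf x)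
      (λ x p → codeOf-In x , trans (digit-codeOf x l) p) (λ _ _ _ _ → codeOf-injective)))
    (proj₂ (F l) j)
    where
    block? : ∀ x → Dec (label F l x ≡ j)
    block? x = label F l x ≟ j

-- The points of one block of the first partition must differ in the remaining `m` labels.
slice-size : ∀ {m a b} → 1 ≤ b → (F : Family (suc m) a b) → CodeInjective F → a ≤ b ^ m
slice-size {m} {a} {b} 1≤b F code-inj = subst (a ≤_) (count-slice m b zero j)
  (subst (_≤ count (slice? m b zero j)) (count-In-slice zero j)
    (count-≤ (In-slice? zero j) (slice? m b zero j) (λ y _ → y) (λ y p → proj₂ p) (λ _ _ _ _ eq → eq)))
  where
  open CodeSet F code-inj
  j = fromℕ< 1≤b

cast-injective : ∀ {m n} (eq : m ≡ n) {x y : Fin m} → cast eq x ≡ cast eq y → x ≡ y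
cast-injective eq {x} {y} p = Fin.toℕ-injective (trans (sym (Fin.toℕ-cast eq x)) (trans (cong toℕ p) (Fin.toℕ-cast eq y)))

-- The codes not used by a base are again the code set of a base.
complement : ∀ {m a a′ b} → 1 ≤ a → 1 ≤ a′ → a + a′ ≡ b ^ m → HasBaseOfSize a b (suc m) → HasBaseOfSize a′ b (suc m)
complement {m} {a} {a′} {b} 1≤a 1≤a′ total h = fromFamily F′ (rigid⇒base F′ 1≤a′ code-inj′ rigid)
  where
  F = proj₁ (toFamily h)
  base = proj₂ (toFamily h)
  code-inj = base⇒code-injective F base
  open CodeSet F code-inj
  N = b ^ suc m
  Out? : (y : Fin N) → Dec (¬ In y × ⊤)
  Out? y = ¬? (In? y) ×-dec yes tt
  In⊤? : (y : Fin N) → Dec (In y × ⊤)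
  In⊤? y = In? y ×-dec yes tt
  count-In⊤ : count In⊤? ≡ a * b
  count-In⊤ = trans (ℕ.≤-antisym (count-≤ In⊤? In? (λ y _ → y) (λ _ → proj₁) (λ _ _ _ _ eq → eq))
      (count-≤ In? In⊤? (λ y _ → y) (λ _ p → p , tt) (λ _ _ _ _ eq → eq))) count-In
  abstract
    split : count In⊤? + count Out? ≡ N
    split = trans (count-split (always? N) In?) (count-all (always? N) (λ _ → tt))
    count-Out : count Out? ≡ a′ * b
    count-Out = ℕ.+-cancelˡ-≡ (a * b) (count Out?) (a′ * b) (trans (cong (_+ count Out?) (sym count-In⊤)) (trans split sizes))
      where
      sizes : b * b ^ m ≡ a * b + a′ * b
      sizes = trans (cong (b *_) (sym total)) (trans (ℕ.*-comm b (a + a′)) (ℕ.*-distribʳ-+ b a a′))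
  code : Fin (a′ * b) → Fin N
  code k = enum Out? (cast (sym count-Out) k)
  code-injective : ∀ {k k′} → code k ≡ code k′ → k ≡ k′
  code-injective eq = cast-injective (sym count-Out) (enum-injective Out? eq)
  code-Out : ∀ k → ¬ In (code k)
  code-Out k = proj₁ (enum-sat Out? (cast (sym count-Out) k))
  decode : ∀ y → ¬ In y → ∃ λ k → code k ≡ y
  decode y out = cast count-Out k , trans (cong (enum Out?) (Fin.toℕ-injective
      (trans (Fin.toℕ-cast (sym count-Out) (cast count-Out k)) (Fin.toℕ-cast count-Out k)))) (enum-rank Out? y (out , tt))
    where k = rank Out? y (out , tt)
  regular : ∀ l → IsRegular a′ b (λ k → digit (suc m) b (code k) l)
  regular l j = ℕ.+-cancelˡ-≡ a _ _ (begin
    a + count block? ≡⟨ cong₂ _+_ (sym (count-In-slice l j)) (ℕ.≤-antisym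
        (count-≤ block? Out-slice? (λ k _ → code k) (λ k p → code-Out k , p) (λ _ _ _ _ → code-injective))
        (count-≤ Out-slice? block? (λ y p → proj₁ (decode y (proj₁ p)))
          (λ y p → trans (cong (λ u → digit (suc m) b u l) (proj₂ (decode y (proj₁ p)))) (proj₂ p))
          (λ y z p q eq → trans (sym (proj₂ (decode y (proj₁ p)))) (trans (cong code eq) (proj₂ (decode z (proj₁ q))))))) ⟩
    count (In-slice? l j) + count Out-slice? ≡⟨ count-split (slice? m b l j) In? ⟩
    count (slice? m b l j) ≡⟨ count-slice m b l j ⟩
    b ^ m ≡⟨ sym total ⟩
    a + a′ ∎)
    where
    open ≡-Reasoning
    block? : ∀ k → Dec (digit (suc m) b (code k) l ≡ j)
    block? k = digit (suc m) b (code k) l ≟ j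
    Out-slice? : ∀ y → Dec (¬ In y × digit (suc m) b y l ≡ j)
    Out-slice? y = ¬? (In? y) ×-dec slice? m b l j y
  F′ : Family (suc m) a′ b
  F′ l = (λ k → digit (suc m) b (code k) l) , regular l
  code-inj′ : CodeInjective F′
  code-inj′ eq = code-injective (digit-injective (suc m) b eq)
  rigid : (π : Fin (suc m) → Fin b → Fin b) → (∀ l → Injective _≡_ _≡_ (π l)) → (s t : Fin (a′ * b) → Fin (a′ * b)) →
    (∀ l x → label F′ l (s x) ≡ π l (label F′ l x)) → (∀ l x → π l (label F′ l (t x)) ≡ label F′ l x) → ∀ l j → π l j ≡ j
  rigid π π-inj s t sπ tπ = base⇒rigid F 1≤a base π π-inj (λ x → proj₁ (image x))
      (λ l x → trans (proj₂ (image x) l) (digit-encode (suc m) b (λ l → π l (label F l x)) l))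
    where
    image : ∀ x → In (encode (suc m) b (λ l → π l (label F l x)))
    image x with In? (encode (suc m) b (λ l → π l (label F l x)))
    ... | yes p = p
    -- A missing image would be the code of a point `k` of `F′`. But `π` takes the code of `t k` to
    -- that of `k`, so by injectivity `t k`, a point of `F′`, has the code of `x`.
    ... | no ¬p with decode (encode (suc m) b (λ l → π l (label F l x))) ¬p
    ... | k , eq = contradiction (x , λ l → π-inj l (begin
        π l (label F l x) ≡⟨ sym (digit-encode (suc m) b (λ l → π l (label F l x)) l) ⟩
        digit (suc m) b (encode (suc m) b (λ l → π l (label F l x))) l ≡⟨ cong (λ u → digit (suc m) b u l) (sym eq) ⟩
        digit (suc m) b (code k) l ≡⟨ sym (tπ l k) ⟩
        π l (digit (suc m) b (code (t k)) l) ∎)) (code-Out (t k))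
      where open ≡-Reasoning

-- Lower bounds

two-labels : ∀ {b} → 2 ≤ b → ∃ λ (i : Fin b) → ∃ λ j → i ≢ j
two-labels (s≤s (s≤s _)) = zero , suc zero , λ ()

transpose-left : ∀ {n} (i j : Fin n) → transpose i j ⟨$⟩ʳ i ≡ j
transpose-left i j with i ≟ i
... | yes _ = refl
... | no i≢i = contradiction refl i≢i

⟨$⟩ʳ-injective : ∀ {n} (σ : Permutation′ n) → Injective _≡_ _≡_ (σ ⟨$⟩ʳ_)
⟨$⟩ʳ-injective σ eq = trans (sym (inverseˡ σ)) (trans (cong (σ ⟨$⟩ˡ_) eq) (inverseˡ σ))

-- With blocks of one point every labelling is injective, so every permutation fixes all partitions;
-- a transposition serves as the witness.
no-base-1 : ∀ {b m} → 2 ≤ b → ¬ HasBaseOfSize 1 b m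
no-base-1 {b} {m} 2≤b h = proj₂ (proj₂ (two-labels 2≤b)) (proj₂ (Fin.combine-injective {1} zero i zero j x≡y))
  where
  F = proj₁ (toFamily h)
  base = proj₂ (toFamily h)
  label-inj : ∀ l {x y} → label F l x ≡ label F l y → x ≡ y
  label-inj l {x} {y} eq = rank-injective (λ z → label F l z ≟ label F l y) eq refl
      (all-equal (proj₂ (F l) (label F l y)) _ _)
    where
    all-equal : ∀ {n} → n ≡ 1 → (i j : Fin n) → i ≡ j
    all-equal refl zero zero = refl
  i = proj₁ (two-labels 2≤b)
  j = proj₁ (proj₂ (two-labels 2≤b))
  x y : Fin (1 * b)
  x = combine {1} zero i
  y = combine {1} zero j
  σ = transpose x y
  fixes : ∀ l → Fixes 1 b σ (F l)
  fixes l z w = (λ eq → cong (λ z → label F l (σ ⟨$⟩ʳ z)) (label-inj l eq)) ,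
    λ eq → cong (label F l) (⟨$⟩ʳ-injective σ (label-inj l eq))
  x≡y : x ≡ y
  x≡y = trans (sym (base σ fixes x)) (transpose-left x y)

-- The complement of a = 0, treated directly because `complement` requires nonempty blocks: every
-- code occurs, so exchanging two labels in the first coordinate alone is a symmetry.
no-base-full : ∀ {m b} → 2 ≤ b → ¬ HasBaseOfSize (b ^ m) b (suc m)
no-base-full {m} {b} 2≤b h = proj₂ (proj₂ (two-labels 2≤b)) (trans (sym (base⇒rigid F 1≤ base π π-inj s sπ zero i)) (transpose-left i j))
  where
  i = proj₁ (two-labels 2≤b)
  j = proj₁ (proj₂ (two-labels 2≤b))
  1≤ : 1 ≤ b ^ m
  1≤ = ℕ.m^n>0 b {{>-nonZero (ℕ.<⇒≤ 2≤b)}} m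
  F = proj₁ (toFamily h)
  base = proj₂ (toFamily h)
  open CodeSet F (base⇒code-injective F base)
  π : Fin (suc m) → Fin b → Fin b
  π zero = transpose i j ⟨$⟩ʳ_
  π (suc l) = id
  π-inj : ∀ l → Injective _≡_ _≡_ (π l)
  π-inj zero = ⟨$⟩ʳ-injective (transpose i j)
  π-inj (suc l) eq = eq
  target : Fin (b ^ m * b) → Fin (b ^ suc m)
  target x = encode (suc m) b (λ l → π l (label F l x))
  size : b ^ suc m ≡ b ^ m * b
  size = ℕ.*-comm b (b ^ m)
  preimage : ∀ x → ∃ λ z → cast size (codeOf z) ≡ cast size (target x)
  preimage x = injective⇒surjective (λ z → cast size (codeOf z)) (λ eq → codeOf-injective (cast-injective size eq)) (cast size (target x))
  s : Fin (b ^ m * b) → Fin (b ^ m * b)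
  s x = proj₁ (preimage x)
  sπ : ∀ l x → label F l (s x) ≡ π l (label F l x)
  sπ l x = trans (sym (digit-codeOf (s x) l)) (trans (cong (λ u → digit (suc m) b u l) (cast-injective size (proj₂ (preimage x))))
    (digit-encode (suc m) b (λ l → π l (label F l x)) l))

no-base-0 : ∀ {a b} → 1 ≤ a → 2 ≤ b → ¬ HasBaseOfSize a b 0
no-base-0 {a} {b} 1≤a 2≤b h = proj₂ (proj₂ (two-labels 2≤b)) (proj₂ (Fin.combine-injective c i c j
    (trans (sym (proj₂ (toFamily h) (transpose (combine c i) (combine c j)) (λ ()) (combine c i))) (transpose-left (combine c i) (combine c j)))))
  where
  i = proj₁ (two-labels 2≤b)
  j = proj₁ (proj₂ (two-labels 2≤b))
  c : Fin a
  c = fromℕ< 1≤a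

lower-bound : ∀ {a b m} → 1 ≤ a → 2 ≤ b → HasBaseOfSize a b m → ∃ λ m′ → m ≡ suc m′ × a + 2 ≤ b ^ m′
lower-bound {m = zero} 1≤a 2≤b h = contradiction h (no-base-0 1≤a 2≤b)
lower-bound {a} {b} {suc m} 1≤a 2≤b h = m , refl , go (b ^ m ∸ a) (ℕ.m+[n∸m]≡n a≤)
  where
  F = proj₁ (toFamily h)
  a≤ : a ≤ b ^ m
  a≤ = slice-size (ℕ.<⇒≤ 2≤b) F (base⇒code-injective F (proj₂ (toFamily h)))
  go : ∀ d → a + d ≡ b ^ m → a + 2 ≤ b ^ m
  go zero eq = contradiction (subst (λ n → HasBaseOfSize n b (suc m)) (trans (sym (ℕ.+-identityʳ a)) eq) h) (no-base-full 2≤b)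
  go (suc zero) eq = contradiction (complement 1≤a ℕ.≤-refl eq h) (no-base-1 2≤b)
  go (suc (suc d)) eq = subst (a + 2 ≤_) eq (ℕ.+-monoʳ-≤ a (s≤s (s≤s z≤n)))

-- Constructing bases

open Inverse using (to; from)

×↔* : ∀ {C : Set} {a b} → C ↔ Fin a → (C × Fin b) ↔ Fin (a * b)
×↔* e = ↔-sym Fin.*↔× ↔-∘ (e ×-↔ ↔-id _)

to-injective : ∀ {A B : Set} (e : A ↔ B) → Injective _≡_ _≡_ (to e)
to-injective e eq = trans (sym (Inverse.inverseʳ e refl)) (trans (cong (from e) eq) (Inverse.inverseʳ e refl))

-- `X` is any convenient model of the points. `ψ l` adds to the label `F l` a position inside the
-- block, and its injectivity makes `F l` regular. One conclusion excludes permutations of points,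
-- the other permutations of labels.
module Construct {X : Set} {m a b : ℕ} (e : X ↔ Fin (a * b)) (F : Fin m → X → Fin b)
  (ψ : Fin m → X → Fin a × Fin b) (ψ-inj : ∀ l → Injective _≡_ _≡_ (ψ l)) (ψF : ∀ l x → proj₂ (ψ l x) ≡ F l x) where

  private
    from-to : ∀ x → from e (to e x) ≡ x
    from-to x = Inverse.inverseʳ e refl
    to-from : ∀ k → to e (from e k) ≡ k
    to-from k = Inverse.inverseˡ e refl

  family : Family m a b
  family l = (λ k → F l (from e k)) , regular-if-injective (λ k → F l (from e k)) (λ k → ψ l (from e k))
    (λ eq → to-injective (↔-sym e) (ψ-inj l eq)) (λ k → ψF l (from e k))

  base-if-no-symmetry : ((σ τ : X → X) → (∀ x → τ (σ x) ≡ x) → (∀ x → σ (τ x) ≡ x) →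
      (∀ l x y → F l x ≡ F l y → F l (σ x) ≡ F l (σ y)) → ∀ x → σ x ≡ x) → HasBaseOfSize a b m
  base-if-no-symmetry h = fromFamily family λ σ fix k →
    trans (sym (to-from _)) (trans (cong (to e) (trans (cong (λ k → from e (σ ⟨$⟩ʳ k)) (sym (to-from k)))
      (h (λ x → from e (σ ⟨$⟩ʳ to e x)) (λ x → from e (σ ⟨$⟩ˡ to e x))
        (λ x → trans (cong (λ k → from e (σ ⟨$⟩ˡ k)) (to-from _)) (trans (cong (from e) (inverseˡ σ)) (from-to x)))
        (λ x → trans (cong (λ k → from e (σ ⟨$⟩ʳ k)) (to-from _)) (trans (cong (from e) (inverseʳ σ)) (from-to x)))
        (λ l x y eq → proj₁ (fix l (to e x) (to e y)) (trans (cong (F l) (from-to x)) (trans eq (cong (F l) (sym (from-to y))))))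
        (from e k)))) (to-from k))

  base-if-rigid : 1 ≤ a → (∀ {x y} → (∀ l → F l x ≡ F l y) → x ≡ y) →
    ((π : Fin m → Fin b → Fin b) → (∀ l → Injective _≡_ _≡_ (π l)) → (s t : X → X) →
      (∀ l x → F l (s x) ≡ π l (F l x)) → (∀ l x → π l (F l (t x)) ≡ F l x) → ∀ l j → π l j ≡ j) → HasBaseOfSize a b m
  base-if-rigid 1≤a F-inj rigid = fromFamily family (rigid⇒base family 1≤a (λ eq → to-injective (↔-sym e) (F-inj eq))
    λ π π-inj s t sπ tπ → rigid π π-inj (λ x → from e (s (to e x))) (λ x → from e (t (to e x)))
      (λ l x → trans (sπ l (to e x)) (cong (λ x → π l (F l x)) (from-to x)))
      (λ l x → trans (tπ l (to e x)) (cong (F l) (from-to x))))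

-- Residues

-- Equal remainders would make the quotients differ by at least one, hence `x + b ≤ y`.
%-distinct : ∀ b .{{_ : NonZero b}} {x y} → x < y → y < x + b → x % b ≢ y % b
%-distinct b {x} {y} x<y y<x+b eq = ℕ.<⇒≱ y<x+b (ℕ.≤-trans (ℕ.≤-reflexive step) (ℕ.≤-trans
    (ℕ.+-monoʳ-≤ r (ℕ.*-monoˡ-≤ b p<q)) (ℕ.≤-reflexive (sym y≡))))
  where
  r = x % b
  p = x / b
  q = y / b
  x≡ : x ≡ r + p * b
  x≡ = m≡m%n+[m/n]*n x b
  y≡ : y ≡ r + q * b
  y≡ = trans (m≡m%n+[m/n]*n y b) (cong (_+ q * b) (sym eq))
  p<q : p < q
  p<q = ℕ.*-cancelʳ-< b p q (ℕ.+-cancelˡ-< r _ _ (ℕ.<-≤-trans (s≤s (ℕ.≤-reflexive (sym x≡))) (ℕ.≤-trans x<y (ℕ.≤-reflexive y≡))))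
  step : x + b ≡ r + suc p * b
  step = trans (cong (_+ b) x≡) (trans (ℕ.+-assoc r (p * b) b) (cong (r +_) (ℕ.+-comm (p * b) b)))

module Cyclic (b : ℕ) .{{_ : NonZero b}} where

  residue : ℕ → Fin b
  residue x = fromℕ< (m%n<n x b)

  toℕ-residue : ∀ x → toℕ (residue x) ≡ x % b
  toℕ-residue x = Fin.toℕ-fromℕ< (m%n<n x b)

  residue-toℕ : ∀ i → residue (toℕ i) ≡ i
  residue-toℕ i = Fin.toℕ-injective (trans (toℕ-residue (toℕ i)) (m<n⇒m%n≡m (Fin.toℕ<n i)))

  residue-distinct : ∀ {x y} → x < y → y < x + b → residue x ≢ residue y
  residue-distinct {x} {y} x<y y<x+b eq =
    %-distinct b x<y y<x+b (trans (sym (toℕ-residue x)) (trans (cong toℕ eq) (toℕ-residue y)))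

  infixl 6 _⊕_
  _⊕_ : Fin b → Fin b → Fin b
  i ⊕ t = residue (toℕ i + toℕ t)

  ⊕-comm : ∀ i t → i ⊕ t ≡ t ⊕ i
  ⊕-comm i t = cong residue (ℕ.+-comm (toℕ i) (toℕ t))

  private
    close : ∀ i {t u} → toℕ t < toℕ u → i ⊕ t ≢ i ⊕ u
    close i {t} {u} t<u = residue-distinct (ℕ.+-monoʳ-< (toℕ i) t<u)
      (ℕ.<-≤-trans (ℕ.+-monoʳ-< (toℕ i) (Fin.toℕ<n u)) (ℕ.+-monoˡ-≤ b (ℕ.m≤m+n (toℕ i) (toℕ t))))

  ⊕-cancelˡ : ∀ i {t u} → i ⊕ t ≡ i ⊕ u → t ≡ u
  ⊕-cancelˡ i {t} {u} eq with ℕ.<-cmp (toℕ t) (toℕ u)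
  ... | tri≈ _ t≡u _ = Fin.toℕ-injective t≡u
  ... | tri< t<u _ _ = contradiction eq (close i t<u)
  ... | tri> _ _ u<t = contradiction (sym eq) (close i u<t)

  ⊕-cancelʳ : ∀ t {i j} → i ⊕ t ≡ j ⊕ t → i ≡ j
  ⊕-cancelʳ t {i} {j} eq = ⊕-cancelˡ t (trans (⊕-comm t i) (trans eq (⊕-comm j t)))

  ⊕-solve : ∀ i j → ∃ λ t → i ⊕ t ≡ j
  ⊕-solve i = injective⇒surjective (i ⊕_) (⊕-cancelˡ i)

  𝟎 : Fin b
  𝟎 = residue 0

  𝟏 : Fin b
  𝟏 = residue 1

  last : Fin b
  last = residue (b ∸ 1)

  toℕ-𝟎 : toℕ 𝟎 ≡ 0
  toℕ-𝟎 = trans (toℕ-residue 0) (m<n⇒m%n≡m (ℕ.n≢0⇒n>0 (≢-nonZero⁻¹ b)))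

  ⊕-𝟎 : ∀ i → i ⊕ 𝟎 ≡ i
  ⊕-𝟎 i = trans (cong residue (trans (cong (toℕ i +_) toℕ-𝟎) (ℕ.+-identityʳ (toℕ i)))) (residue-toℕ i)

  toℕ-next : ∀ {i} → suc (toℕ i) < b → toℕ (i ⊕ 𝟏) ≡ suc (toℕ i)
  toℕ-next {i} i+1<b = trans (toℕ-residue _) (trans (cong (_% b) eq) (m<n⇒m%n≡m i+1<b))
    where
    eq : toℕ i + toℕ 𝟏 ≡ suc (toℕ i)
    eq = trans (cong (toℕ i +_) (trans (toℕ-residue 1) (m<n⇒m%n≡m (ℕ.≤-trans (s≤s (s≤s z≤n)) i+1<b)))) (ℕ.+-comm (toℕ i) 1)

  last⊕𝟏 : 2 ≤ b → last ⊕ 𝟏 ≡ 𝟎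
  last⊕𝟏 2≤b = Fin.toℕ-injective (trans (toℕ-residue _) (trans (cong (_% b) eq) (trans (n%n≡0 b) (sym toℕ-𝟎))))
    where
    eq : toℕ last + toℕ 𝟏 ≡ b
    eq = trans (cong₂ _+_ (trans (toℕ-residue (b ∸ 1)) (m<n⇒m%n≡m (ℕ.≤-reflexive (ℕ.suc-pred b))))
      (trans (toℕ-residue 1) (m<n⇒m%n≡m 2≤b))) (trans (ℕ.+-comm (b ∸ 1) 1) (ℕ.suc-pred b))

  residue≢ : ∀ {x y} → x < y → y < b → residue x ≢ residue y
  residue≢ {x} x<y y<b = residue-distinct x<y (ℕ.<-≤-trans y<b (ℕ.m≤n+m b x))

  residue≢last : ∀ {x} → suc x < b → residue x ≢ last
  residue≢last {x} x+1<b = residue≢ (ℕ.≤-pred (ℕ.≤-trans x+1<b (ℕ.≤-reflexive (sym (ℕ.suc-pred b))))) (ℕ.≤-reflexive (ℕ.suc-pred b))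

  rotation-rigid : (π : Fin b → Fin b) → (∀ i → π (i ⊕ 𝟏) ≡ π i ⊕ 𝟏) → π 𝟎 ≡ 𝟎 → ∀ i → π i ≡ i
  rotation-rigid π π-next π𝟎 i = go (toℕ i) i refl
    where
    go : ∀ n i → toℕ i ≡ n → π i ≡ i
    go zero i eq = subst (λ i → π i ≡ i) (Fin.toℕ-injective (trans toℕ-𝟎 (sym eq))) π𝟎
    go (suc n) i eq = subst (λ i → π i ≡ i) step (trans (π-next i′) (cong (_⊕ 𝟏) (go n i′ (Fin.toℕ-fromℕ< n<b))))
      where
      n+1<b : suc n < b
      n+1<b = subst (_< b) eq (Fin.toℕ<n i)
      n<b : n < b
      n<b = ℕ.<⇒≤ n+1<b
      i′ : Fin b
      i′ = fromℕ< n<b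
      step : i′ ⊕ 𝟏 ≡ i
      step = Fin.toℕ-injective (trans (toℕ-next (subst (λ k → suc k < b) (sym (Fin.toℕ-fromℕ< n<b)) n+1<b))
        (trans (cong suc (Fin.toℕ-fromℕ< n<b)) (sym eq)))

-- Three or more partitions

-- An initial segment, moved by a transposition so that it meets the target and then embedded around
-- `z` by `punchIn`. It selects the codes of a diagonal cell; leaving out `z` while keeping `u`
-- makes the position `𝟎` recognizable later.
injection-avoiding : ∀ {w N} (z u : Fin N) → z ≢ u → 1 ≤ w → suc w ≤ N →
  ∃ λ (d : Fin w → Fin N) → (∀ {i j} → d i ≡ d j → i ≡ j) × (∀ i → d i ≢ z) × ∃ λ i → d i ≡ u
injection-avoiding {suc w} {suc N} z u z≢u _ (s≤s w≤N) = d , d-inj , (λ i → Fin.punchInᵢ≢i z _) , zero , d-zero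
  where
  inj : Fin (suc w) → Fin N
  inj i = fromℕ< (ℕ.<-≤-trans (Fin.toℕ<n i) w≤N)
  inj-injective : ∀ {i j} → inj i ≡ inj j → i ≡ j
  inj-injective eq = Fin.toℕ-injective (trans (sym (Fin.toℕ-fromℕ< _)) (trans (cong toℕ eq) (Fin.toℕ-fromℕ< _)))
  σ : Permutation′ N
  σ = transpose (inj zero) (punchOut z≢u)
  d : Fin (suc w) → Fin (suc N)
  d i = punchIn z (σ ⟨$⟩ʳ inj i)
  d-inj : ∀ {i j} → d i ≡ d j → i ≡ j
  d-inj {i} {j} eq = inj-injective (⟨$⟩ʳ-injective σ (Fin.punchIn-injective z (σ ⟨$⟩ʳ inj i) (σ ⟨$⟩ʳ inj j) eq))
  d-zero : d zero ≡ u
  d-zero = trans (cong (punchIn z) (transpose-left (inj zero) (punchOut z≢u))) (Fin.punchIn-punchOut z≢u)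

-- The points are pairs of a class and a position i in ℤ/b; every label is a bijection of the position within
-- each class. For the first two partitions the cell (i , i ⊕ 𝟏) has one point, the cell (i , i) has w points,
-- q further cells in every row are full, and the rest are empty. Hence only rotations are possible on the
-- first two coordinates, and exchanging the positions 𝟎 and last in one coordinate of the second kind of
-- class destroys those.
module Circulant (k b w q : ℕ) .{{_ : NonZero b}} (3≤b : 3 ≤ b) (2≤w : 2 ≤ w) (w<B : suc w ≤ b ^ suc k) (q+2≤b : q + 2 ≤ b) where

  open Cyclic b

  B = b ^ suc k
  C = ⊤ ⊎ (Fin w ⊎ (Fin q × Fin B))
  X = C × Fin b
  a = 1 + (w + q * B)

  pattern single = inj₁ tt
  pattern dia n = inj₂ (inj₁ n)
  pattern full t d = inj₂ (inj₂ (t , d))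

  e : C ↔ Fin a
  e = ↔-sym Fin.+↔⊎ ↔-∘ (↔-sym Fin.1↔⊤ ⊎-↔ (↔-sym Fin.+↔⊎ ↔-∘ (↔-id _ ⊎-↔ ↔-sym Fin.*↔×)))

  2≤b : 2 ≤ b
  2≤b = ℕ.<⇒≤ 3≤b

  𝟎≢𝟏 : 𝟎 ≢ 𝟏
  𝟎≢𝟏 = residue≢ (s≤s z≤n) 2≤b

  zeros ones : Fin (suc k) → Fin b
  zeros _ = 𝟎
  ones zero = 𝟏
  ones (suc l) = 𝟎

  z u : Fin B
  z = encode (suc k) b zeros
  u = encode (suc k) b ones

  z≢u : z ≢ u
  z≢u eq = 𝟎≢𝟏 (trans (sym (digit-encode (suc k) b zeros zero)) (trans (cong (λ y → digit (suc k) b y zero) eq) (digit-encode (suc k) b ones zero)))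

  abstract
    diagonal : ∃ λ (d : Fin w → Fin B) → (∀ {i j} → d i ≡ d j → i ≡ j) × (∀ i → d i ≢ z) × ∃ λ i → d i ≡ u
    diagonal = injection-avoiding z u z≢u (ℕ.<⇒≤ 2≤w) w<B

  D = proj₁ diagonal
  D-injective = proj₁ (proj₂ diagonal)
  D≢z = proj₁ (proj₂ (proj₂ diagonal))
  n₀ = proj₁ (proj₂ (proj₂ (proj₂ diagonal)))
  D-n₀ = proj₂ (proj₂ (proj₂ (proj₂ diagonal)))

  -- `transpose 𝟎 𝟎` is the identity, so only one coordinate is altered.
  τ : Fin (suc k) → Permutation′ b
  τ zero = transpose 𝟎 last
  τ (suc l) = transpose 𝟎 𝟎

  shift : C → Fin b
  shift single = 𝟏
  shift (dia n) = 𝟎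
  shift (full t d) = residue (2 + toℕ t)

  2+t<b : ∀ (t : Fin q) → 2 + toℕ t < b
  2+t<b t = ℕ.≤-trans (ℕ.≤-trans (s≤s (s≤s (Fin.toℕ<n t))) (ℕ.≤-reflexive (ℕ.+-comm 2 q))) q+2≤b

  code : Fin (suc k) → C → Fin b → Fin b
  code l single i = i
  code l (dia n) i = (τ l ⟨$⟩ʳ i) ⊕ digit (suc k) b (D n) l
  code l (full t d) i = i ⊕ digit (suc k) b d l

  F : Fin (suc (suc (suc k))) → X → Fin b
  F zero (c , i) = i
  F (suc zero) (c , i) = i ⊕ shift c
  F (suc (suc l)) (c , i) = code l c i

  F-position : ∀ l c {i j} → F l (c , i) ≡ F l (c , j) → i ≡ j
  F-position zero c eq = eq
  F-position (suc zero) c eq = ⊕-cancelʳ (shift c) eq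
  F-position (suc (suc l)) single eq = eq
  F-position (suc (suc l)) (dia n) eq = ⟨$⟩ʳ-injective (τ l) (⊕-cancelʳ (digit (suc k) b (D n) l) eq)
  F-position (suc (suc l)) (full t d) eq = ⊕-cancelʳ (digit (suc k) b d l) eq

  F-injective : ∀ {x y} → (∀ l → F l x ≡ F l y) → x ≡ y
  F-injective {c , i} {c′ , j} eq with eq zero
  ... | refl = cong (_, i) (same c c′ (⊕-cancelˡ i (eq (suc zero))) (λ l → eq (suc (suc l))))
    where
    same : ∀ c c′ → shift c ≡ shift c′ → (∀ l → code l c i ≡ code l c′ i) → c ≡ c′
    same single single _ _ = refl
    same single (dia n) p _ = contradiction (sym p) 𝟎≢𝟏
    same single (full t d) p _ = contradiction p (residue≢ (s≤s (s≤s z≤n)) (2+t<b t))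
    same (dia n) single p _ = contradiction p 𝟎≢𝟏
    same (dia n) (dia n′) _ r = cong (λ n → dia n) (D-injective (digit-injective (suc k) b (λ l → ⊕-cancelˡ _ (r l))))
    same (dia n) (full t d) p _ = contradiction p (residue≢ (s≤s z≤n) (2+t<b t))
    same (full t d) single p _ = contradiction (sym p) (residue≢ (s≤s (s≤s z≤n)) (2+t<b t))
    same (full t d) (dia n) p _ = contradiction (sym p) (residue≢ (s≤s z≤n) (2+t<b t))
    same (full t d) (full t′ d′) p r = cong₂ (λ t d → full t d) same-t (digit-injective (suc k) b (λ l → ⊕-cancelˡ _ (r l)))
      where
      same-t : t ≡ t′
      same-t with ℕ.<-cmp (toℕ t) (toℕ t′)
      ... | tri≈ _ t≡t′ _ = Fin.toℕ-injective t≡t′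
      ... | tri< t<t′ _ _ = contradiction p (residue≢ (s≤s (s≤s t<t′)) (2+t<b t′))
      ... | tri> _ _ t′<t = contradiction (sym p) (residue≢ (s≤s (s≤s t′<t)) (2+t<b t))

  another : ∀ {n} → 2 ≤ n → (i : Fin n) → ∃ λ j → j ≢ i
  another (s≤s (s≤s _)) zero = suc zero , λ ()
  another (s≤s (s≤s _)) (suc i) = zero , λ ()

  -- Being alone in a cell of the first two partitions is preserved by symmetries. It picks out the
  -- `single` points, since every other occupied cell has `w` or `B` points, at least two in either
  -- case.
  Alone : X → Set
  Alone x = ∀ y → F zero y ≡ F zero x → F (suc zero) y ≡ F (suc zero) x → y ≡ x

  single-alone : ∀ i → Alone (single , i)
  single-alone i (single , .i) refl _ = refl
  single-alone i (dia n , .i) refl eq = contradiction (⊕-cancelˡ i eq) 𝟎≢𝟏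
  single-alone i (full t d , .i) refl eq = contradiction (sym (⊕-cancelˡ i eq)) (residue≢ (s≤s (s≤s z≤n)) (2+t<b t))

  alone-single : ∀ x → Alone x → ∃ λ i → x ≡ (single , i)
  alone-single (single , i) _ = i , refl
  alone-single (dia n , i) alone with another 2≤w n
  ... | n′ , n′≢n with alone (dia n′ , i) refl refl
  ... | refl = contradiction refl n′≢n
  alone-single (full t d , i) alone with another (ℕ.≤-trans 2≤w (ℕ.<⇒≤ w<B)) d
  ... | d′ , d′≢d with alone (full t d′ , i) refl refl
  ... | refl = contradiction refl d′≢d

  -- In the diagonal cell of `i`, a point with all labels `i` needs the offset `z`, which `D`
  -- avoids, unless `τ` moves `i`. At `𝟎` the offset `u` makes up for the exchange, because
  -- `last ⊕ 𝟏` is `𝟎`. So the diagonal cells with a constant point are that of `𝟎` and possibly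
  -- that of `last`.
  Constant : Fin b → X → Set
  Constant i x = F zero x ≡ i × F (suc zero) x ≡ i × ∀ l → F (suc (suc l)) x ≡ i

  constant-ends : ∀ {i n} → Constant i (dia n , i) → i ≡ 𝟎 ⊎ i ≡ last
  constant-ends {i} {n} (_ , _ , eq) with i ≟ 𝟎
  ... | yes i≡𝟎 = inj₁ i≡𝟎
  ... | no i≢𝟎 with i ≟ last
  ... | yes i≡last = inj₂ i≡last
  ... | no i≢last = contradiction (digit-injective (suc k) b (λ l → trans (digits l) (sym (digit-encode (suc k) b zeros l)))) (D≢z n)
    where
    fixed : ∀ l → τ l ⟨$⟩ʳ i ≡ i
    fixed zero with i ≟ 𝟎
    ... | yes p = contradiction p i≢𝟎
    ... | no _ with i ≟ last
    ...   | yes p = contradiction p i≢last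
    ...   | no _ = refl
    fixed (suc l) with i ≟ 𝟎
    ... | yes p = contradiction p i≢𝟎
    ... | no _ with i ≟ 𝟎
    ...   | yes p = contradiction p i≢𝟎
    ...   | no _ = refl
    digits : ∀ l → digit (suc k) b (D n) l ≡ 𝟎
    digits l = ⊕-cancelˡ i (trans (cong (_⊕ digit (suc k) b (D n) l) (sym (fixed l))) (trans (eq l) (sym (⊕-𝟎 i))))

  constant-𝟎 : Constant 𝟎 (dia n₀ , 𝟎)
  constant-𝟎 = refl , ⊕-𝟎 𝟎 , λ l → trans (cong ((τ l ⟨$⟩ʳ 𝟎) ⊕_)
    (trans (cong (λ y → digit (suc k) b y l) D-n₀) (digit-encode (suc k) b ones l))) (at l)
    where
    at : ∀ l → (τ l ⟨$⟩ʳ 𝟎) ⊕ ones l ≡ 𝟎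
    at zero = trans (cong (_⊕ 𝟏) (transpose-left 𝟎 last)) (last⊕𝟏 2≤b)
    at (suc l) = trans (⊕-𝟎 _) (transpose-left 𝟎 𝟎)

  module Symmetry (π : Fin (suc (suc (suc k))) → Fin b → Fin b) (π-inj : ∀ l → Injective _≡_ _≡_ (π l)) (s t : X → X)
    (sπ : ∀ l x → F l (s x) ≡ π l (F l x)) (tπ : ∀ l x → π l (F l (t x)) ≡ F l x) where

    ρ : Fin b → Fin b
    ρ = π zero

    s-injective : ∀ {x y} → s x ≡ s y → x ≡ y
    s-injective {x} {y} eq = F-injective λ l → π-inj l (trans (sym (sπ l x)) (trans (cong (F l) eq) (sπ l y)))

    alone-s : ∀ {x} → Alone x → Alone (s x)
    alone-s {x} alone y p q = F-injective λ l → trans (sym (tπ l y)) (trans (cong (λ x → π l (F l x)) ty≡x) (sym (sπ l x)))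
      where
      ty≡x : t y ≡ x
      ty≡x = alone (t y) (π-inj zero (trans (tπ zero y) (trans p (sπ zero x))))
        (π-inj (suc zero) (trans (tπ (suc zero) y) (trans q (sπ (suc zero) x))))

    s-alone : ∀ {x} → Alone (s x) → Alone x
    s-alone {x} alone y p q = s-injective (alone (s y) (trans (sπ zero y) (trans (cong ρ p) (sym (sπ zero x))))
      (trans (sπ (suc zero) y) (trans (cong (π (suc zero)) q) (sym (sπ (suc zero) x)))))

    s-single : ∀ i → s (single , i) ≡ (single , ρ i)
    s-single i with alone-single (s (single , i)) (alone-s (single-alone i))
    ... | i′ , eq = trans eq (cong (single ,_) (trans (sym (cong (F zero) eq)) (sπ zero (single , i))))

    s-dia : ∀ n i → ∃ λ n′ → s (dia n , i) ≡ (dia n′ , ρ i)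
    s-dia n i with s (dia n , i) in eq | sπ zero (dia n , i)
    ... | single , i′ | _ with alone-single (dia n , i) (s-alone (subst Alone (sym eq) (single-alone i′)))
    ...   | _ , ()
    s-dia n i | dia n′ , .(ρ i) | refl = n′ , refl
    s-dia n i | full t′ d , .(ρ i) | refl = contradiction missing (D≢z _)
      where
      -- A full cell contains every code, but the code of d = z does not occur in the cell (i , i).
      g : Fin (suc k) → Fin b
      g l = (τ l ⟨$⟩ʳ i) ⊕ 𝟎
      h : Fin (suc k) → Fin b
      h l = proj₁ (⊕-solve (ρ i) (π (suc (suc l)) (g l)))
      y : X
      y = full t′ (encode (suc k) b h) , ρ i
      ty-dia : ∀ x → F zero x ≡ i → F (suc zero) x ≡ i ⊕ 𝟎 → ∃ λ n → x ≡ (dia n , i)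
      ty-dia (single , .i) refl q = contradiction (sym (⊕-cancelˡ i q)) 𝟎≢𝟏
      ty-dia (dia n , .i) refl q = n , refl
      ty-dia (full t d , .i) refl q = contradiction (sym (⊕-cancelˡ i q)) (residue≢ (s≤s z≤n) (2+t<b t))
      found = ty-dia (t y) (π-inj zero (tπ zero y)) (π-inj (suc zero) (trans (tπ (suc zero) y)
        (trans (sym (cong (F (suc zero)) eq)) (sπ (suc zero) (dia n , i)))))
      code-ty : ∀ l → F (suc (suc l)) (t y) ≡ g l
      code-ty l = π-inj (suc (suc l)) (trans (tπ (suc (suc l)) y)
        (trans (cong (ρ i ⊕_) (digit-encode (suc k) b h l)) (proj₂ (⊕-solve (ρ i) (π (suc (suc l)) (g l))))))
      missing : D (proj₁ found) ≡ z
      missing = digit-injective (suc k) b λ l → trans (⊕-cancelˡ (τ l ⟨$⟩ʳ i)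
        (trans (sym (cong (F (suc (suc l))) (proj₂ found))) (code-ty l))) (sym (digit-encode (suc k) b zeros l))

    π₁≡ρ : ∀ i → π (suc zero) i ≡ ρ i
    π₁≡ρ i with s-dia n₀ i
    ... | n′ , eq = trans (cong (π (suc zero)) (sym (⊕-𝟎 i)))
      (trans (sym (sπ (suc zero) (dia n₀ , i))) (trans (cong (F (suc zero)) eq) (⊕-𝟎 (ρ i))))

    ρ-next : ∀ i → ρ (i ⊕ 𝟏) ≡ ρ i ⊕ 𝟏
    ρ-next i = trans (sym (π₁≡ρ (i ⊕ 𝟏))) (trans (sym (sπ (suc zero) (single , i))) (cong (F (suc zero)) (s-single i)))

    π≡ρ : ∀ l i → π l i ≡ ρ i
    π≡ρ zero i = refl
    π≡ρ (suc zero) i = π₁≡ρ i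
    π≡ρ (suc (suc l)) i = trans (sym (sπ (suc (suc l)) (single , i))) (cong (F (suc (suc l))) (s-single i))

    constant-s : ∀ {i n} → Constant i (dia n , i) → ∃ λ n′ → Constant (ρ i) (dia n′ , ρ i)
    constant-s {i} {n} (p , q , r) with s-dia n i
    ... | n′ , eq = n′ , refl , step (suc zero) q , λ l → step (suc (suc l)) (r l)
      where
      step : ∀ l → F l (dia n , i) ≡ i → F l (dia n′ , ρ i) ≡ ρ i
      step l eq′ = trans (sym (cong (F l) eq)) (trans (sπ l (dia n , i)) (trans (cong (π l) eq′) (π≡ρ l i)))

    -- Diagonal cells with a constant point go to such cells, so `ρ 𝟎` is `𝟎` or `last`. In the
    -- second case the cell of `last` has a constant point too, and `ρ last` is again `𝟎` or `last`.
    -- The former gives `𝟏 ≡ last`, impossible for `b ≥ 3`, and the latter contradicts injectivity.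
    ρ𝟎 : ρ 𝟎 ≡ 𝟎
    ρ𝟎 with constant-s constant-𝟎
    ... | n′ , const with constant-ends const
    ... | inj₁ ρ𝟎≡𝟎 = ρ𝟎≡𝟎
    ... | inj₂ ρ𝟎≡last with constant-s (subst (λ i → Constant i (dia n′ , i)) ρ𝟎≡last const)
    ... | n″ , const′ with constant-ends const′
    ... | inj₁ ρlast≡𝟎 = contradiction (trans (sym (cong (_⊕ 𝟏) ρlast≡𝟎)) (trans (sym (ρ-next last)) (trans (cong ρ (last⊕𝟏 2≤b)) ρ𝟎≡last))) 𝟏≢last
      where
      𝟏≢last : 𝟎 ⊕ 𝟏 ≢ last
      𝟏≢last eq = residue≢last 3≤b (trans (sym (trans (⊕-comm 𝟎 𝟏) (⊕-𝟎 𝟏))) eq)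
    ... | inj₂ ρlast≡last = contradiction (π-inj zero (trans ρ𝟎≡last (sym ρlast≡last))) (residue≢last 2≤b)

    trivial : ∀ l i → π l i ≡ i
    trivial l i = trans (π≡ρ l i) (rotation-rigid ρ ρ-next ρ𝟎 i)

  ψ : Fin (3 + k) → X → Fin a × Fin b
  ψ l (c , i) = to e c , F l (c , i)

  ψ-injective : ∀ l → Injective _≡_ _≡_ (ψ l)
  ψ-injective l {c , i} {c′ , j} eq with to-injective e {c} {c′} (cong proj₁ eq)
  ... | refl = cong (c ,_) (F-position l c (cong proj₂ eq))

  base : HasBaseOfSize a b (3 + k)
  base = base-if-rigid (s≤s z≤n) F-injective (λ π π-inj s t sπ tπ → Symmetry.trivial π π-inj s t sπ tπ)
    where open Construct (×↔* e) F ψ ψ-injective (λ _ _ → refl)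

module _ (k b : ℕ) (3≤b : 3 ≤ b) where

  private
    instance
      b-nonZero : NonZero b
      b-nonZero = >-nonZero (ℕ.<⇒≤ (ℕ.<⇒≤ 3≤b))

    B = b ^ suc k

    instance
      B-nonZero : NonZero B
      B-nonZero = ℕ.m^n≢0 b (suc k)

    3≤B : 3 ≤ B
    3≤B = ℕ.≤-trans 3≤b (ℕ.≤-trans (ℕ.≤-reflexive (sym (ℕ.*-identityʳ b))) (ℕ.*-monoʳ-≤ b (ℕ.m^n>0 b k)))

    direct : ∀ q r → 3 ≤ r → r < B → q + 2 ≤ b → HasBaseOfSize (r + q * B) b (3 + k)
    direct q (suc r) (s≤s 2≤r) r<B q+2≤b = Circulant.base k b r q 3≤b 2≤r (ℕ.<⇒≤ r<B) q+2≤b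

    direct₀ : ∀ q n → suc n ≡ B → q + 2 ≤ b → HasBaseOfSize (B + q * B) b (3 + k)
    direct₀ q n n+1≡B q+2≤b = subst (λ m → HasBaseOfSize (m + q * B) b (3 + k)) n+1≡B
      (Circulant.base k b n q 3≤b (ℕ.≤-pred (subst (3 ≤_) (sym n+1≡B) 3≤B)) (ℕ.≤-reflexive n+1≡B) q+2≤b)

    dual : ∀ {a a′} → 3 ≤ a → 3 ≤ a′ → a + a′ ≡ b * B → HasBaseOfSize a b (3 + k) → HasBaseOfSize a′ b (3 + k)
    dual 3≤a 3≤a′ eq = complement (ℕ.≤-trans (s≤s z≤n) 3≤a) (ℕ.≤-trans (s≤s z≤n) 3≤a′) eq

    -- The small remainders 1 and 2 are out of reach of `direct`. The complement has remainder
    -- `x = B ∸ r`, which is at least 3, and quotient `y = b ∸ (q + 2)`.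
    low : ∀ {a} q r → a ≡ r + suc q * B → 3 ≤ a → a + 3 ≤ b * B → r + 3 ≤ B → 1 ≤ r → HasBaseOfSize a b (3 + k)
    low {a} q r a≡ 3≤a a+3≤ r+3≤B 1≤r = dual (ℕ.≤-trans 3≤x (ℕ.m≤m+n x _)) 3≤a sum (direct y x 3≤x x<B y+2≤b)
      where
      x = B ∸ r
      x+r : x + r ≡ B
      x+r = ℕ.m∸n+n≡m (ℕ.m+n≤o⇒m≤o r r+3≤B)
      3≤x : 3 ≤ x
      3≤x = ℕ.+-cancelʳ-≤ r 3 x (ℕ.≤-trans (ℕ.≤-reflexive (ℕ.+-comm 3 r)) (ℕ.≤-trans r+3≤B (ℕ.≤-reflexive (sym x+r))))
      x<B : x < B
      x<B = ℕ.<-≤-trans (ℕ.m<m+n x 1≤r) (ℕ.≤-reflexive x+r)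
      q+2≤b : suc (suc q) ≤ b
      q+2≤b = ℕ.*-cancelʳ-< B (suc q) b (ℕ.≤-<-trans (ℕ.≤-trans (ℕ.m≤n+m (suc q * B) r) (ℕ.≤-reflexive (sym a≡))) (ℕ.<-≤-trans (ℕ.m<m+n a (s≤s z≤n)) a+3≤))
      y = b ∸ suc (suc q)
      y+ : y + suc (suc q) ≡ b
      y+ = ℕ.m∸n+n≡m q+2≤b
      y+2≤b : y + 2 ≤ b
      y+2≤b = ℕ.≤-trans (ℕ.+-monoʳ-≤ y (s≤s (s≤s z≤n))) (ℕ.≤-reflexive y+)
      sum : x + y * B + a ≡ b * B
      sum = trans (cong (x + y * B +_) a≡) (trans (interchange x (y * B) r (suc q * B))
        (trans (cong₂ _+_ x+r (sym (ℕ.*-distribʳ-+ B y (suc q))))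
          (cong (_* B) (trans (sym (ℕ.+-suc y (suc q))) y+))))

    -- Remainder 0 is a full row of `w = B ∸ 1` diagonal codes with one less full cell. From
    -- remainder 3 on `direct` applies, except for the top quotient `q = b ∸ 1`; there the
    -- complement is smaller than `B`. Remainders 1 and 2 go to `low`.
    by-remainder : ∀ {a} q r → a ≡ r + q * B → r < B → 3 ≤ a → a + 3 ≤ b * B → (r ≡ 1 ⊎ r ≡ 2 → r + 3 ≤ B) → HasBaseOfSize a b (3 + k)
    by-remainder zero zero refl _ () _ _
    by-remainder (suc q) zero refl _ _ a+3≤ _ = direct₀ q (B ∸ 1) (ℕ.suc-pred B) (ℕ.≤-trans (ℕ.≤-reflexive (ℕ.+-comm q 2)) q+2≤b)
      where
      q+2≤b : suc (suc q) ≤ b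
      q+2≤b = ℕ.*-cancelʳ-< B (suc q) b (ℕ.<-≤-trans (ℕ.m<m+n _ (s≤s z≤n)) a+3≤)
    by-remainder {a} q r@(suc (suc (suc _))) a≡ r<B 3≤a a+3≤ _ with q + 2 ℕ.≤? b
    ... | yes q+2≤b = subst (λ a → HasBaseOfSize a b (3 + k)) (sym a≡) (direct q r (s≤s (s≤s (s≤s z≤n))) r<B q+2≤b)
    ... | no q+2≰b = dual 3≤a′ 3≤a (trans (ℕ.+-comm a′ a) a+a′) (subst (λ a → HasBaseOfSize a b (3 + k)) (ℕ.+-identityʳ a′)
          (direct zero a′ 3≤a′ a′<B (ℕ.≤-trans (ℕ.n≤1+n 2) 3≤b)))
      where
      a′ = B ∸ r
      a′+r : a′ + r ≡ B
      a′+r = ℕ.m∸n+n≡m (ℕ.<⇒≤ r<B)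
      a′<B : a′ < B
      a′<B = ℕ.<-≤-trans (ℕ.m<m+n a′ (s≤s z≤n)) (ℕ.≤-reflexive a′+r)
      b≡q+1 : b ≡ suc q
      b≡q+1 = ℕ.≤-antisym (ℕ.≤-pred (ℕ.≤-trans (ℕ.≰⇒> q+2≰b) (ℕ.≤-reflexive (ℕ.+-comm q 2))))
        (ℕ.*-cancelʳ-< B q b (ℕ.≤-<-trans (ℕ.≤-trans (ℕ.m≤n+m (q * B) r) (ℕ.≤-reflexive (sym a≡))) (ℕ.<-≤-trans (ℕ.m<m+n a (s≤s z≤n)) a+3≤)))
      a+a′ : a + a′ ≡ b * B
      a+a′ = trans (cong (_+ a′) a≡) (trans (ring r (q * B) a′) (trans (cong (_+ q * B) a′+r) (cong (_* B) (sym b≡q+1))))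
        where
        ring : ∀ x y z → x + y + z ≡ z + x + y
        ring = solve-∀
      3≤a′ : 3 ≤ a′
      3≤a′ = ℕ.+-cancelˡ-≤ a 3 a′ (ℕ.≤-trans a+3≤ (ℕ.≤-reflexive (sym a+a′)))
    by-remainder zero (suc zero) refl _ (s≤s ()) _ _
    by-remainder zero (suc (suc zero)) refl _ (s≤s (s≤s ())) _ _
    by-remainder {a} (suc q) (suc zero) a≡ r<B 3≤a a+3≤ h = low q 1 a≡ 3≤a a+3≤ (h (inj₁ refl)) (s≤s z≤n)
    by-remainder {a} (suc q) (suc (suc zero)) a≡ r<B 3≤a a+3≤ h = low q 2 a≡ 3≤a a+3≤ (h (inj₂ refl)) (s≤s z≤n)

  middle : ∀ {a} → 3 ≤ a → a + 3 ≤ b * B → (a % B ≡ 1 ⊎ a % B ≡ 2 → a % B + 3 ≤ B) → HasBaseOfSize a b (3 + k)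
  middle {a} = by-remainder (a / B) (a % B) (m≡m%n+[m/n]*n a B) (m%n<n a B)

-- Two partitions

infixl 5 _&_
_&_ : ∀ {c d c′ d′} → c ≤ d → c′ ≤ d′ → c + c′ ≤ d + d′
_&_ = ℕ.+-mono-≤

-- Linear arithmetic: a nonnegative combination c ≤ d of the hypotheses with c ≡ suc (d + k) is contradictory.
absurd : ∀ {c d} → c ≤ d → ∀ k → c ≡ suc (d + k) → ⊥
absurd c≤d k refl = ℕ.<⇒≱ (s≤s (ℕ.m≤m+n _ k)) c≤d

-- The goal is proved by contradiction: its negation `neg` is added by `&` to the hypotheses, each
-- listed as often as its coefficient demands. The sum of the smaller sides then exceeds that of the
-- larger sides by `suc k`, which the ring solver confirms.
lin : ∀ {c d x y} → (y < x → c ≤ d) → ∀ k → c ≡ suc (d + k) → x ≤ y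
lin c≤d k eq = ℕ.≮⇒≥ λ neg → absurd (c≤d neg) k eq

-- The b × b matrix whose row r has its 3 + α ones in the columns r, …, r + 2 + α modulo b, except that rows
-- 0, 2 and 3 are altered. Calling r adjacent to r′ when row r has at most one column outside row r′, the
-- adjacency graph consists of the isolated vertex 0 and the paths 2 – 1 – 3 and 4 – 5 – … – (b − 1).
module Band (α b : ℕ) .{{_ : NonZero b}} (h2 : 6 + α + α ≤ b) (h8 : 8 ≤ b) where

  open Cyclic b

  Row : ℕ → ℕ → Set
  Row 0 x = x ≡ 0 ⊎ (3 ≤ x × x ≤ 4 + α)
  Row 1 x = 1 ≤ x × x ≤ 3 + α
  Row 2 x = (1 ≤ x × x ≤ 2 + α) ⊎ x ≡ 4 + α
  Row 3 x = (2 ≤ x × x ≤ 3 + α) ⊎ x ≡ 5 + α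
  Row (suc (suc (suc (suc n)))) x = 4 + n ≤ x × x ≤ 6 + α + n

  In : ℕ → Fin b → Set
  In r c = ∃ λ x → Row r x × residue x ≡ c

  Adjacent : ℕ → ℕ → Set
  Adjacent r r′ = ∃ λ d → ∀ c → In r c → In r′ c ⊎ c ≡ d

  -- A certificate that `x` is congruent to none of `lo`, ..., `hi` modulo `b`: this interval lies
  -- strictly between `x` and `x + b`, or strictly between `x - b` and `x`.
  Outside : ℕ → ℕ → ℕ → Set
  Outside x lo hi = (x < lo × hi < x + b) ⊎ (hi < x × x < lo + b)

  opaque
    outside : ∀ {x lo hi} → Outside x lo hi → ∀ {y} → lo ≤ y → y ≤ hi → residue y ≢ residue x
    outside (inj₁ (x<lo , u)) lo≤y y≤hi eq = residue-distinct (ℕ.<-≤-trans x<lo lo≤y) (ℕ.≤-<-trans y≤hi u) (sym eq)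
    outside {x} (inj₂ (hi<x , u)) lo≤y y≤hi eq = residue-distinct (ℕ.≤-<-trans y≤hi hi<x) (ℕ.<-≤-trans u (ℕ.+-monoˡ-≤ b lo≤y)) eq

  opaque
    ∉-0 : ∀ x → Outside x 0 0 → Outside x 3 (4 + α) → ¬ In 0 (residue x)
    ∉-0 x o o′ (y , inj₁ refl , eq) = outside o ℕ.≤-refl ℕ.≤-refl eq
    ∉-0 x o o′ (y , inj₂ (p , q) , eq) = outside o′ p q eq

  opaque
    ∉-1 : ∀ x → Outside x 1 (3 + α) → ¬ In 1 (residue x)
    ∉-1 x o (y , (p , q) , eq) = outside o p q eq

  opaque
    ∉-2 : ∀ x → Outside x 1 (2 + α) → Outside x (4 + α) (4 + α) → ¬ In 2 (residue x)
    ∉-2 x o o′ (y , inj₁ (p , q) , eq) = outside o p q eq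
    ∉-2 x o o′ (y , inj₂ refl , eq) = outside o′ ℕ.≤-refl ℕ.≤-refl eq

  opaque
    ∉-3 : ∀ x → Outside x 2 (3 + α) → Outside x (5 + α) (5 + α) → ¬ In 3 (residue x)
    ∉-3 x o o′ (y , inj₁ (p , q) , eq) = outside o p q eq
    ∉-3 x o o′ (y , inj₂ refl , eq) = outside o′ ℕ.≤-refl ℕ.≤-refl eq

  opaque
    ∉-4+ : ∀ n x → Outside x (4 + n) (6 + α + n) → ¬ In (4 + n) (residue x)
    ∉-4+ n x o (y , (p , q) , eq) = outside o p q eq

  opaque
    residue-+b : ∀ x → residue (x + b) ≡ residue x
    residue-+b x = Fin.toℕ-injective (trans (toℕ-residue (x + b)) (trans ([m+n]%n≡m%n x b) (sym (toℕ-residue x))))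

  opaque
    not-adjacent : ∀ {r r′} x y → Row r x → Row r y → Outside x y y → ¬ In r′ (residue x) → ¬ In r′ (residue y) → ¬ Adjacent r r′
    not-adjacent x y rx ry o x∉ y∉ (d , sub) with sub (residue x) (x , rx , refl) | sub (residue y) (y , ry , refl)
    ... | inj₁ x∈ | _ = x∉ x∈
    ... | inj₂ _ | inj₁ y∈ = y∉ y∈
    ... | inj₂ p | inj₂ q = outside o ℕ.≤-refl ℕ.≤-refl (trans q (sym p))

  Outside₂ : ℕ → ℕ → ℕ → Set
  Outside₂ x lo hi = (suc x < lo × hi < x + b) ⊎ (hi < x × suc x < lo + b)

  opaque
    first : ∀ {x lo hi} → Outside₂ x lo hi → Outside x lo hi
    first (inj₁ (p , q)) = inj₁ (ℕ.<-trans (ℕ.n<1+n _) p , q)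
    first (inj₂ (p , q)) = inj₂ (p , ℕ.<-trans (ℕ.n<1+n _) q)

  opaque
    second : ∀ {x lo hi} → Outside₂ x lo hi → Outside (suc x) lo hi
    second (inj₁ (p , q)) = inj₁ (p , ℕ.<-trans q (ℕ.n<1+n _))
    second (inj₂ (p , q)) = inj₂ (ℕ.<-trans p (ℕ.n<1+n _) , q)

  -- Two consecutive columns of one row that another row misses are the usual witness against
  -- adjacency.
  Missing₂ : ℕ → ℕ → Set
  Missing₂ r x = ¬ In r (residue x) × ¬ In r (residue (suc x))

  opaque
    ∉₂-0 : ∀ x → Outside₂ x 0 0 → Outside₂ x 3 (4 + α) → Missing₂ 0 x
    ∉₂-0 x o o′ = ∉-0 x (first o) (first o′) , ∉-0 (suc x) (second o) (second o′)

  opaque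
    ∉₂-1 : ∀ x → Outside₂ x 1 (3 + α) → Missing₂ 1 x
    ∉₂-1 x o = ∉-1 x (first o) , ∉-1 (suc x) (second o)

  opaque
    ∉₂-2 : ∀ x → Outside₂ x 1 (2 + α) → Outside₂ x (4 + α) (4 + α) → Missing₂ 2 x
    ∉₂-2 x o o′ = ∉-2 x (first o) (first o′) , ∉-2 (suc x) (second o) (second o′)

  opaque
    ∉₂-3 : ∀ x → Outside₂ x 2 (3 + α) → Outside₂ x (5 + α) (5 + α) → Missing₂ 3 x
    ∉₂-3 x o o′ = ∉-3 x (first o) (first o′) , ∉-3 (suc x) (second o) (second o′)

  opaque
    ∉₂-4+ : ∀ n x → Outside₂ x (4 + n) (6 + α + n) → Missing₂ (4 + n) x
    ∉₂-4+ n x o = ∉-4+ n x (first o) , ∉-4+ n (suc x) (second o)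

  opaque
    not-adjacent₂ : ∀ {r r′} x → Row r x × Row r (suc x) → Missing₂ r′ x → ¬ Adjacent r r′
    not-adjacent₂ x (rx , ry) (x∉ , y∉) = not-adjacent x (suc x) rx ry (inj₁ (ℕ.≤-refl , ℕ.≤-trans (ℕ.≤-reflexive (ℕ.+-comm 2 x)) (ℕ.+-monoʳ-≤ x (ℕ.≤-trans (s≤s (s≤s z≤n)) h8)))) x∉ y∉

  opaque
    not-adjacent-window : ∀ {r′} n x → 4 + n ≤ x × suc x ≤ 6 + α + n → Missing₂ r′ x → ¬ Adjacent (4 + n) r′
    not-adjacent-window n x (p , q) = not-adjacent₂ {4 + n} x ((p , ℕ.<⇒≤ q) , (ℕ.m≤n⇒m≤1+n p , q))

  opaque
    -- Every other row misses two columns of row 0. For a window `4 + n`, ..., `6 + α + n` they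
    -- depend on how far it wraps around: columns 0 and 3 if it ends before `b`, columns 3 and 4 if
    -- it reaches column 2 at most, and `3 + α` and `4 + α` otherwise, when the window starts beyond
    -- them.
    adjacent-0 : ∀ {j} → j < b → Adjacent 0 j → j ≡ 0
    adjacent-0 {0} _ _ = refl
    adjacent-0 {1} _ adj = contradiction adj (not-adjacent {0} {1} 0 (4 + α) (inj₁ refl) (inj₂ (lin (λ neg → neg) (1 + α) (solve (b ∷ α ∷ [])) , lin (λ neg → neg) 0 (solve (b ∷ α ∷ [])))) (inj₁ (lin (λ neg → neg) (3 + α) (solve (b ∷ α ∷ [])) , lin (λ neg → neg & h2) (1 + α) (solve (b ∷ α ∷ [])))) (∉-1 0 (inj₁ (lin (λ neg → neg) 0 (solve (b ∷ α ∷ [])) , lin (λ neg → neg & h2) (2 + α) (solve (b ∷ α ∷ []))))) (∉-1 (4 + α) (inj₂ (lin (λ neg → neg) 0 (solve (b ∷ α ∷ [])) , lin (λ neg → neg & h2) (2 + α) (solve (b ∷ α ∷ []))))))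
    adjacent-0 {2} _ adj = contradiction adj (not-adjacent {0} {2} 0 (3 + α) (inj₁ refl) (inj₂ (lin (λ neg → neg) α (solve (b ∷ α ∷ [])) , lin (λ neg → neg) 1 (solve (b ∷ α ∷ [])))) (inj₁ (lin (λ neg → neg) (2 + α) (solve (b ∷ α ∷ [])) , lin (λ neg → neg & h2) (2 + α) (solve (b ∷ α ∷ [])))) (∉-2 0 (inj₁ (lin (λ neg → neg) 0 (solve (b ∷ α ∷ [])) , lin (λ neg → neg & h2) (3 + α) (solve (b ∷ α ∷ [])))) (inj₁ (lin (λ neg → neg) (3 + α) (solve (b ∷ α ∷ [])) , lin (λ neg → neg & h2) (1 + α) (solve (b ∷ α ∷ []))))) (∉-2 (3 + α) (inj₂ (lin (λ neg → neg) 0 (solve (b ∷ α ∷ [])) , lin (λ neg → neg & h2) (3 + α) (solve (b ∷ α ∷ [])))) (inj₁ (lin (λ neg → neg) 0 (solve (b ∷ α ∷ [])) , lin (λ neg → neg & h8) 6 (solve (b ∷ α ∷ []))))))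
    adjacent-0 {3} _ adj = contradiction adj (not-adjacent {0} {3} 0 (4 + α) (inj₁ refl) (inj₂ (lin (λ neg → neg) (1 + α) (solve (b ∷ α ∷ [])) , lin (λ neg → neg) 0 (solve (b ∷ α ∷ [])))) (inj₁ (lin (λ neg → neg) (3 + α) (solve (b ∷ α ∷ [])) , lin (λ neg → neg & h2) (1 + α) (solve (b ∷ α ∷ [])))) (∉-3 0 (inj₁ (lin (λ neg → neg) 1 (solve (b ∷ α ∷ [])) , lin (λ neg → neg & h2) (2 + α) (solve (b ∷ α ∷ [])))) (inj₁ (lin (λ neg → neg) (4 + α) (solve (b ∷ α ∷ [])) , lin (λ neg → neg & h2) α (solve (b ∷ α ∷ []))))) (∉-3 (4 + α) (inj₂ (lin (λ neg → neg) 0 (solve (b ∷ α ∷ [])) , lin (λ neg → neg & h2) (3 + α) (solve (b ∷ α ∷ [])))) (inj₁ (lin (λ neg → neg) 0 (solve (b ∷ α ∷ [])) , lin (λ neg → neg & h8) 6 (solve (b ∷ α ∷ []))))))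
    adjacent-0 {suc (suc (suc (suc n)))} jb adj with 7 + α + n ℕ.≤? b | 4 + α + n ℕ.≤? b
    ... | yes p | _ = contradiction adj (not-adjacent {0} {4 + n} 0 3 (inj₁ refl) (inj₂ (lin (λ neg → neg) 0 (solve (b ∷ n ∷ α ∷ [])) , lin (λ neg → neg) (1 + α) (solve (b ∷ n ∷ α ∷ [])))) (inj₁ (lin (λ neg → neg) 2 (solve (b ∷ n ∷ α ∷ [])) , lin (λ neg → neg & p) (3 + n + α) (solve (b ∷ n ∷ α ∷ [])))) (∉-4+ n 0 (inj₁ (lin (λ neg → neg) (3 + n) (solve (b ∷ n ∷ α ∷ [])) , lin (λ neg → neg & p) 0 (solve (b ∷ n ∷ α ∷ []))))) (∉-4+ n 3 (inj₁ (lin (λ neg → neg) n (solve (b ∷ n ∷ α ∷ [])) , lin (λ neg → neg & p) 3 (solve (b ∷ n ∷ α ∷ []))))))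
    ... | no p | yes q = contradiction adj (not-adjacent₂ {0} {4 + n} 3 ((inj₂ (lin (λ neg → neg) 0 (solve (b ∷ n ∷ α ∷ [])) , lin (λ neg → neg) (1 + α) (solve (b ∷ n ∷ α ∷ [])))) , (inj₂ (lin (λ neg → neg) 1 (solve (b ∷ n ∷ α ∷ [])) , lin (λ neg → neg) α (solve (b ∷ n ∷ α ∷ []))))) (∉₂-4+ n 3 (inj₁ (lin (λ neg → neg & neg & h2 & h8 & ℕ.≰⇒> p & ℕ.≰⇒> p) 1 (solve (b ∷ n ∷ α ∷ [])) , lin (λ neg → neg & q) 0 (solve (b ∷ n ∷ α ∷ []))))))
    ... | no p | no q = contradiction adj (not-adjacent₂ {0} {4 + n} (3 + α) ((inj₂ (lin (λ neg → neg) α (solve (b ∷ n ∷ α ∷ [])) , lin (λ neg → neg) 1 (solve (b ∷ n ∷ α ∷ [])))) , (inj₂ (lin (λ neg → neg) (1 + α) (solve (b ∷ n ∷ α ∷ [])) , lin (λ neg → neg) 0 (solve (b ∷ n ∷ α ∷ []))))) (∉₂-4+ n (3 + α) (inj₁ (lin (λ neg → neg & h2 & ℕ.≰⇒> q) 2 (solve (b ∷ n ∷ α ∷ [])) , lin (λ neg → neg & jb) 1 (solve (b ∷ n ∷ α ∷ []))))))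

  opaque
    adjacent-2 : ∀ {j} → j < b → Adjacent 2 j → j ≡ 1 ⊎ j ≡ 2
    adjacent-2 {0} _ adj = contradiction adj (not-adjacent₂ {2} {0} 1 ((inj₁ (lin (λ neg → neg) 0 (solve (b ∷ α ∷ [])) , lin (λ neg → neg) (1 + α) (solve (b ∷ α ∷ [])))) , (inj₁ (lin (λ neg → neg) 1 (solve (b ∷ α ∷ [])) , lin (λ neg → neg) α (solve (b ∷ α ∷ []))))) (∉₂-0 1 (inj₂ (lin (λ neg → neg) 0 (solve (b ∷ α ∷ [])) , lin (λ neg → neg & h8) 5 (solve (b ∷ α ∷ [])))) (inj₁ (lin (λ neg → neg) 0 (solve (b ∷ α ∷ [])) , lin (λ neg → neg & h2) (2 + α) (solve (b ∷ α ∷ []))))))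
    adjacent-2 {1} _ adj = inj₁ refl
    adjacent-2 {2} _ adj = inj₂ refl
    adjacent-2 {3} _ adj = contradiction adj (not-adjacent {2} {3} 1 (4 + α) (inj₁ (lin (λ neg → neg) 0 (solve (b ∷ α ∷ [])) , lin (λ neg → neg) (1 + α) (solve (b ∷ α ∷ [])))) (inj₂ refl) (inj₁ (lin (λ neg → neg) (2 + α) (solve (b ∷ α ∷ [])) , lin (λ neg → neg & h2) (2 + α) (solve (b ∷ α ∷ [])))) (∉-3 1 (inj₁ (lin (λ neg → neg) 0 (solve (b ∷ α ∷ [])) , lin (λ neg → neg & h2) (3 + α) (solve (b ∷ α ∷ [])))) (inj₁ (lin (λ neg → neg) (3 + α) (solve (b ∷ α ∷ [])) , lin (λ neg → neg & h2) (1 + α) (solve (b ∷ α ∷ []))))) (∉-3 (4 + α) (inj₂ (lin (λ neg → neg) 0 (solve (b ∷ α ∷ [])) , lin (λ neg → neg & h2) (3 + α) (solve (b ∷ α ∷ [])))) (inj₁ (lin (λ neg → neg) 0 (solve (b ∷ α ∷ [])) , lin (λ neg → neg & h8) 6 (solve (b ∷ α ∷ []))))))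
    adjacent-2 {suc (suc (suc (suc n)))} jb adj with 6 + α + n ℕ.≤? b
    ... | yes p = contradiction adj (not-adjacent₂ {2} {4 + n} 1 ((inj₁ (lin (λ neg → neg) 0 (solve (b ∷ n ∷ α ∷ [])) , lin (λ neg → neg) (1 + α) (solve (b ∷ n ∷ α ∷ [])))) , (inj₁ (lin (λ neg → neg) 1 (solve (b ∷ n ∷ α ∷ [])) , lin (λ neg → neg) α (solve (b ∷ n ∷ α ∷ []))))) (∉₂-4+ n 1 (inj₁ (lin (λ neg → neg) (1 + n) (solve (b ∷ n ∷ α ∷ [])) , lin (λ neg → neg & p) 0 (solve (b ∷ n ∷ α ∷ []))))))
    ... | no p = contradiction adj (not-adjacent {2} {4 + n} (2 + α) (4 + α) (inj₁ (lin (λ neg → neg) (1 + α) (solve (b ∷ n ∷ α ∷ [])) , lin (λ neg → neg) 0 (solve (b ∷ n ∷ α ∷ [])))) (inj₂ refl) (inj₁ (lin (λ neg → neg) 1 (solve (b ∷ n ∷ α ∷ [])) , lin (λ neg → neg & jb) (2 + n) (solve (b ∷ n ∷ α ∷ [])))) (∉-4+ n (2 + α) (inj₁ (lin (λ neg → neg & h2 & ℕ.≰⇒> p) 2 (solve (b ∷ n ∷ α ∷ [])) , lin (λ neg → neg & jb) 0 (solve (b ∷ n ∷ α ∷ []))))) (∉-4+ n (4 + α) (inj₁ (lin (λ neg → neg & h2 & ℕ.≰⇒> p) 0 (solve (b ∷ n ∷ α ∷ [])) , lin (λ neg → neg & jb) 2 (solve (b ∷ n ∷ α ∷ []))))))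

  opaque
    adjacent-3 : ∀ {j} → j < b → Adjacent 3 j → j ≡ 1 ⊎ j ≡ 3
    adjacent-3 {0} _ adj = contradiction adj (not-adjacent {3} {0} 2 (5 + α) (inj₁ (lin (λ neg → neg) 0 (solve (b ∷ α ∷ [])) , lin (λ neg → neg) (1 + α) (solve (b ∷ α ∷ [])))) (inj₂ refl) (inj₁ (lin (λ neg → neg) (2 + α) (solve (b ∷ α ∷ [])) , lin (λ neg → neg & h2) (2 + α) (solve (b ∷ α ∷ [])))) (∉-0 2 (inj₂ (lin (λ neg → neg) 1 (solve (b ∷ α ∷ [])) , lin (λ neg → neg & h8) 5 (solve (b ∷ α ∷ [])))) (inj₁ (lin (λ neg → neg) 0 (solve (b ∷ α ∷ [])) , lin (λ neg → neg & h2) (3 + α) (solve (b ∷ α ∷ []))))) (∉-0 (5 + α) (inj₂ (lin (λ neg → neg) (4 + α) (solve (b ∷ α ∷ [])) , lin (λ neg → neg & h2) α (solve (b ∷ α ∷ [])))) (inj₂ (lin (λ neg → neg) 0 (solve (b ∷ α ∷ [])) , lin (λ neg → neg & h2) (3 + α) (solve (b ∷ α ∷ []))))))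
    adjacent-3 {1} _ adj = inj₁ refl
    adjacent-3 {2} _ adj = contradiction adj (not-adjacent {3} {2} (3 + α) (5 + α) (inj₁ (lin (λ neg → neg) (1 + α) (solve (b ∷ α ∷ [])) , lin (λ neg → neg) 0 (solve (b ∷ α ∷ [])))) (inj₂ refl) (inj₁ (lin (λ neg → neg) 1 (solve (b ∷ α ∷ [])) , lin (λ neg → neg & h8) 5 (solve (b ∷ α ∷ [])))) (∉-2 (3 + α) (inj₂ (lin (λ neg → neg) 0 (solve (b ∷ α ∷ [])) , lin (λ neg → neg & h2) (3 + α) (solve (b ∷ α ∷ [])))) (inj₁ (lin (λ neg → neg) 0 (solve (b ∷ α ∷ [])) , lin (λ neg → neg & h8) 6 (solve (b ∷ α ∷ []))))) (∉-2 (5 + α) (inj₂ (lin (λ neg → neg) 2 (solve (b ∷ α ∷ [])) , lin (λ neg → neg & h2) (1 + α) (solve (b ∷ α ∷ [])))) (inj₂ (lin (λ neg → neg) 0 (solve (b ∷ α ∷ [])) , lin (λ neg → neg & h8) 6 (solve (b ∷ α ∷ []))))))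
    adjacent-3 {3} _ adj = inj₂ refl
    adjacent-3 {suc (suc (suc (suc n)))} jb adj with 5 + α + n ℕ.≤? b
    ... | yes p = contradiction adj (not-adjacent₂ {3} {4 + n} 2 ((inj₁ (lin (λ neg → neg) 0 (solve (b ∷ n ∷ α ∷ [])) , lin (λ neg → neg) (1 + α) (solve (b ∷ n ∷ α ∷ [])))) , (inj₁ (lin (λ neg → neg) 1 (solve (b ∷ n ∷ α ∷ [])) , lin (λ neg → neg) α (solve (b ∷ n ∷ α ∷ []))))) (∉₂-4+ n 2 (inj₁ (lin (λ neg → neg) n (solve (b ∷ n ∷ α ∷ [])) , lin (λ neg → neg & p) 0 (solve (b ∷ n ∷ α ∷ []))))))
    ... | no p = contradiction adj (not-adjacent {3} {4 + n} (3 + α) (5 + α) (inj₁ (lin (λ neg → neg) (1 + α) (solve (b ∷ n ∷ α ∷ [])) , lin (λ neg → neg) 0 (solve (b ∷ n ∷ α ∷ [])))) (inj₂ refl) (inj₁ (lin (λ neg → neg) 1 (solve (b ∷ n ∷ α ∷ [])) , lin (λ neg → neg & jb) (2 + n) (solve (b ∷ n ∷ α ∷ [])))) (∉-4+ n (3 + α) (inj₁ (lin (λ neg → neg & h2 & ℕ.≰⇒> p) 2 (solve (b ∷ n ∷ α ∷ [])) , lin (λ neg → neg & jb) 1 (solve (b ∷ n ∷ α ∷ []))))) (∉-4+ n (5 + α) (inj₁ (lin (λ neg → neg & h2 & ℕ.≰⇒> p) 0 (solve (b ∷ n ∷ α ∷ [])) , lin (λ neg → neg & jb) 3 (solve (b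 ∷ n ∷ α ∷ []))))))

  private
    opaque
      far-0 : ∀ {n} → 4 + n < b → ¬ Adjacent (4 + n) 0
      far-0 {zero} rb = not-adjacent-window {0} 0 (5 + α) (lin (λ neg → neg) (1 + α) (solve (b ∷ α ∷ [])) , lin (λ neg → neg) 0 (solve (b ∷ α ∷ []))) (∉₂-0 (5 + α) (inj₂ (lin (λ neg → neg) (4 + α) (solve (b ∷ α ∷ [])) , lin (λ neg → neg & neg & h2 & h8) 1 (solve (b ∷ α ∷ [])))) (inj₂ (lin (λ neg → neg) 0 (solve (b ∷ α ∷ [])) , lin (λ neg → neg & h2) (2 + α) (solve (b ∷ α ∷ [])))))
      far-0 {suc m} rb with α ℕ.≤? m | 7 + m ℕ.≤? b
      ... | yes p | yes q = not-adjacent-window {0} (1 + m) (5 + m) (lin (λ neg → neg) 0 (solve (b ∷ m ∷ α ∷ [])) , lin (λ neg → neg) (1 + α) (solve (b ∷ m ∷ α ∷ []))) (∉₂-0 (5 + m) (inj₂ (lin (λ neg → neg) (4 + m) (solve (b ∷ m ∷ α ∷ [])) , lin (λ neg → neg & q) 0 (solve (b ∷ m ∷ α ∷ [])))) (inj₂ (lin (λ neg → neg & p) 0 (solve (b ∷ m ∷ α ∷ [])) , lin (λ neg → neg & q) 3 (solve (b ∷ m ∷ α ∷ [])))))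
      -- This is the last row, `b ≡ 6 + m`. Its window begins with the columns b - 1, 0 and 1, and
      -- row 0 contains column 0, so columns b - 1 and 1 are the witnesses instead of two
      -- consecutive ones.
      ... | yes p | no q = λ (d , sub) → case sub (residue (5 + m)) (5 + m , (lin (λ neg → neg) 0 (solve (b ∷ m ∷ α ∷ [])) , lin (λ neg → neg) (2 + α) (solve (b ∷ m ∷ α ∷ []))) , refl) , sub (residue (7 + m)) (7 + m , (lin (λ neg → neg) 2 (solve (b ∷ m ∷ α ∷ [])) , lin (λ neg → neg) α (solve (b ∷ m ∷ α ∷ []))) , refl) of λ
        { (inj₁ i , _) → (∉-0 (5 + m) (inj₂ (lin (λ neg → neg) (4 + m) (solve (b ∷ m ∷ α ∷ [])) , lin (λ neg → neg & rb) 0 (solve (b ∷ m ∷ α ∷ [])))) (inj₂ (lin (λ neg → neg & p) 0 (solve (b ∷ m ∷ α ∷ [])) , lin (λ neg → neg & rb) 3 (solve (b ∷ m ∷ α ∷ []))))) i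
        ; (_ , inj₁ i) → (∉-0 1 (inj₂ (lin (λ neg → neg) 0 (solve (b ∷ α ∷ [])) , lin (λ neg → neg & h8) 6 (solve (b ∷ α ∷ [])))) (inj₁ (lin (λ neg → neg) 1 (solve (b ∷ α ∷ [])) , lin (λ neg → neg & h2) (2 + α) (solve (b ∷ α ∷ []))))) (subst (In 0) wrap i)
        ; (inj₂ i , inj₂ j) → outside {5 + m} {7 + m} {7 + m} (inj₁ (lin (λ neg → neg) 1 (solve (b ∷ m ∷ α ∷ [])) , lin (λ neg → neg & h8) 5 (solve (b ∷ m ∷ α ∷ [])))) ℕ.≤-refl ℕ.≤-refl (trans j (sym i)) }
        where
        wrap : residue (7 + m) ≡ residue 1
        wrap = trans (cong (λ x → residue (1 + x)) {6 + m} {b} (ℕ.≤-antisym (lin (λ neg → neg & rb) 0 (solve (b ∷ m ∷ []))) (lin (λ neg → neg & ℕ.≰⇒> q) 0 (solve (b ∷ m ∷ []))))) (residue-+b 1)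
      ... | no p | _ = not-adjacent-window {0} (1 + m) (5 + α + m) (lin (λ neg → neg) α (solve (b ∷ m ∷ α ∷ [])) , lin (λ neg → neg) 1 (solve (b ∷ m ∷ α ∷ []))) (∉₂-0 (5 + α + m) (inj₂ (lin (λ neg → neg) (4 + m + α) (solve (b ∷ m ∷ α ∷ [])) , lin (λ neg → neg & h2 & ℕ.≰⇒> p) 0 (solve (b ∷ m ∷ α ∷ [])))) (inj₂ (lin (λ neg → neg) m (solve (b ∷ m ∷ α ∷ [])) , lin (λ neg → neg & h2 & ℕ.≰⇒> p) 3 (solve (b ∷ m ∷ α ∷ [])))))

    opaque
      far-1 : ∀ {n} → 4 + n < b → ¬ Adjacent (4 + n) 1
      far-1 {n} rb with α ℕ.≤? n
      ... | yes p = not-adjacent-window {1} n (4 + n) (ℕ.≤-refl , lin (λ neg → neg) (1 + α) (solve (b ∷ n ∷ α ∷ []))) (∉₂-1 (4 + n) (inj₂ (lin (λ neg → neg & p) 0 (solve (b ∷ n ∷ α ∷ [])) , lin (λ neg → neg & rb) 0 (solve (b ∷ n ∷ α ∷ [])))))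
      ... | no p = not-adjacent-window {1} n (5 + α + n) (lin (λ neg → neg) (1 + α) (solve (b ∷ n ∷ α ∷ [])) , lin (λ neg → neg) 0 (solve (b ∷ n ∷ α ∷ []))) (∉₂-1 (5 + α + n) (inj₂ (lin (λ neg → neg) (1 + n) (solve (b ∷ n ∷ α ∷ [])) , lin (λ neg → neg & h2 & ℕ.≰⇒> p) 1 (solve (b ∷ n ∷ α ∷ [])))))

    opaque
      far-2 : ∀ {n} → 4 + n < b → ¬ Adjacent (4 + n) 2
      far-2 {n} rb with 1 + α ℕ.≤? n
      ... | yes p = not-adjacent-window {2} n (4 + n) (ℕ.≤-refl , lin (λ neg → neg) (1 + α) (solve (b ∷ n ∷ α ∷ []))) (∉₂-2 (4 + n) (inj₂ (lin (λ neg → neg & p) 2 (solve (b ∷ n ∷ α ∷ [])) , lin (λ neg → neg & rb) 0 (solve (b ∷ n ∷ α ∷ [])))) (inj₂ (lin (λ neg → neg & p) 0 (solve (b ∷ n ∷ α ∷ [])) , lin (λ neg → neg & rb) (3 + α) (solve (b ∷ n ∷ α ∷ [])))))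
      ... | no p = not-adjacent-window {2} n (5 + α + n) (lin (λ neg → neg) (1 + α) (solve (b ∷ n ∷ α ∷ [])) , lin (λ neg → neg) 0 (solve (b ∷ n ∷ α ∷ []))) (∉₂-2 (5 + α + n) (inj₂ (lin (λ neg → neg) (2 + n) (solve (b ∷ n ∷ α ∷ [])) , lin (λ neg → neg & h2 & ℕ.≰⇒> p) 0 (solve (b ∷ n ∷ α ∷ [])))) (inj₂ (lin (λ neg → neg) n (solve (b ∷ n ∷ α ∷ [])) , lin (λ neg → neg & rb) 2 (solve (b ∷ n ∷ α ∷ [])))))

    opaque
      far-3 : ∀ {n} → 4 + n < b → ¬ Adjacent (4 + n) 3
      far-3 {zero} rb = not-adjacent {4} {3} (4 + α) (6 + α) (lin (λ neg → neg) α (solve (b ∷ α ∷ [])) , lin (λ neg → neg) 2 (solve (b ∷ α ∷ []))) (lin (λ neg → neg) (2 + α) (solve (b ∷ α ∷ [])) , lin (λ neg → neg) 0 (solve (b ∷ α ∷ []))) (inj₁ (lin (λ neg → neg) 1 (solve (b ∷ α ∷ [])) , lin (λ neg → neg & h8) 5 (solve (b ∷ α ∷ [])))) (∉-3 (4 + α) (inj₂ (lin (λ neg → neg) 0 (solve (b ∷ α ∷ [])) , lin (λ neg → neg & h2) (3 + α) (solve (b ∷ α ∷ [])))) (inj₁ (lin (λ neg → neg) 0 (solve (b ∷ α ∷ [])) , lin (λ neg → neg & h8) 6 (solve (b ∷ α ∷ []))))) (∉-3 (6 + α) (inj₂ (lin (λ neg → neg) 2 (solve (b ∷ α ∷ []))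 , lin (λ neg → neg & h2) (1 + α) (solve (b ∷ α ∷ [])))) (inj₂ (lin (λ neg → neg) 0 (solve (b ∷ α ∷ [])) , lin (λ neg → neg & h8) 6 (solve (b ∷ α ∷ [])))))
      far-3 {suc m} rb with 1 + α ℕ.≤? m
      ... | yes p = not-adjacent-window {3} (1 + m) (5 + m) (lin (λ neg → neg) 0 (solve (b ∷ m ∷ α ∷ [])) , lin (λ neg → neg) (1 + α) (solve (b ∷ m ∷ α ∷ []))) (∉₂-3 (5 + m) (inj₂ (lin (λ neg → neg & p) 2 (solve (b ∷ m ∷ α ∷ [])) , lin (λ neg → neg & rb) 1 (solve (b ∷ m ∷ α ∷ [])))) (inj₂ (lin (λ neg → neg & p) 0 (solve (b ∷ m ∷ α ∷ [])) , lin (λ neg → neg & rb) (4 + α) (solve (b ∷ m ∷ α ∷ [])))))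
      ... | no p = not-adjacent-window {3} (1 + m) (6 + α + m) (lin (λ neg → neg) (1 + α) (solve (b ∷ m ∷ α ∷ [])) , lin (λ neg → neg) 0 (solve (b ∷ m ∷ α ∷ []))) (∉₂-3 (6 + α + m) (inj₂ (lin (λ neg → neg) (2 + m) (solve (b ∷ m ∷ α ∷ [])) , lin (λ neg → neg & h2 & ℕ.≰⇒> p) 0 (solve (b ∷ m ∷ α ∷ [])))) (inj₂ (lin (λ neg → neg) m (solve (b ∷ m ∷ α ∷ [])) , lin (λ neg → neg & rb) 3 (solve (b ∷ m ∷ α ∷ [])))))

    opaque
      -- A window covers at most half of the columns, so it cannot reach both ends of another window
      -- starting two or more columns away: it misses the first two or the last two columns of that
      -- window.
      far-up : ∀ {n n′} → 4 + n′ < b → 2 + n ≤ n′ → ¬ Adjacent (4 + n) (4 + n′)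
      far-up {n} {n′} rb d with 3 + α + n′ ℕ.≤? n + b
      ... | yes p = not-adjacent-window {4 + n′} n (4 + n) (ℕ.≤-refl , lin (λ neg → neg) (1 + α) (solve (b ∷ n ∷ n′ ∷ α ∷ []))) (∉₂-4+ (n′) (4 + n) (inj₁ (lin (λ neg → neg & d) 0 (solve (b ∷ n ∷ n′ ∷ α ∷ [])) , lin (λ neg → neg & p) 0 (solve (b ∷ n ∷ n′ ∷ α ∷ [])))))
      ... | no p = not-adjacent-window {4 + n′} n (5 + α + n) (lin (λ neg → neg) (1 + α) (solve (b ∷ n ∷ n′ ∷ α ∷ [])) , lin (λ neg → neg) 0 (solve (b ∷ n ∷ n′ ∷ α ∷ []))) (∉₂-4+ (n′) (5 + α + n) (inj₁ (lin (λ neg → neg & h2 & ℕ.≰⇒> p) 1 (solve (b ∷ n ∷ n′ ∷ α ∷ [])) , lin (λ neg → neg & rb) (3 + n) (solve (b ∷ n ∷ n′ ∷ α ∷ [])))))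

    opaque
      far-down : ∀ {n n′} → 4 + n < b → 2 + n′ ≤ n → ¬ Adjacent (4 + n) (4 + n′)
      far-down {n} {n′} rb d with 3 + α + n′ ℕ.≤? n
      ... | yes p = not-adjacent-window {4 + n′} n (4 + n) (ℕ.≤-refl , lin (λ neg → neg) (1 + α) (solve (b ∷ n ∷ n′ ∷ α ∷ []))) (∉₂-4+ (n′) (4 + n) (inj₂ (lin (λ neg → neg & p) 0 (solve (b ∷ n ∷ n′ ∷ α ∷ [])) , lin (λ neg → neg & rb) (3 + n′) (solve (b ∷ n ∷ n′ ∷ α ∷ [])))))
      ... | no p = not-adjacent-window {4 + n′} n (5 + α + n) (lin (λ neg → neg) (1 + α) (solve (b ∷ n ∷ n′ ∷ α ∷ [])) , lin (λ neg → neg) 0 (solve (b ∷ n ∷ n′ ∷ α ∷ []))) (∉₂-4+ (n′) (5 + α + n) (inj₂ (lin (λ neg → neg & d) 0 (solve (b ∷ n ∷ n′ ∷ α ∷ [])) , lin (λ neg → neg & h2 & ℕ.≰⇒> p) 1 (solve (b ∷ n ∷ n′ ∷ α ∷ [])))))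

  opaque
    adjacent-4+ : ∀ {n j} → 4 + n < b → j < b → Adjacent (4 + n) j → j ≡ 4 + n ⊎ j ≡ 5 + n ⊎ 4 + n ≡ suc j × 4 ≤ j
    adjacent-4+ {n} {0} rb jb adj = contradiction adj (far-0 rb)
    adjacent-4+ {n} {1} rb jb adj = contradiction adj (far-1 rb)
    adjacent-4+ {n} {2} rb jb adj = contradiction adj (far-2 rb)
    adjacent-4+ {n} {3} rb jb adj = contradiction adj (far-3 rb)
    adjacent-4+ {n} {suc (suc (suc (suc n′)))} rb jb adj with ℕ.<-cmp n n′
    ... | tri≈ _ refl _ = inj₁ refl
    ... | tri< n<n′ _ _ with 2 + n ℕ.≤? n′
    ...   | yes d = contradiction adj (far-up jb d)
    ...   | no d = inj₂ (inj₁ (cong (4 +_) (ℕ.≤-antisym (lin (λ neg → neg & ℕ.≰⇒> d) 0 (solve (n ∷ n′ ∷ []))) n<n′)))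
    adjacent-4+ {n} {suc (suc (suc (suc n′)))} rb jb adj | tri> _ _ n′<n with 2 + n′ ℕ.≤? n
    ...   | yes d = contradiction adj (far-down rb d)
    ...   | no d = inj₂ (inj₂ (cong (4 +_) (ℕ.≤-antisym (lin (λ neg → neg & ℕ.≰⇒> d) 0 (solve (n ∷ n′ ∷ []))) n′<n) , s≤s (s≤s (s≤s (s≤s z≤n)))))

-- Symmetries of the altered band matrix

module BandSymmetry (α b β : ℕ) .{{_ : NonZero b}} (h2 : 6 + α + α ≤ b) (h8 : 8 ≤ b) (b1 : b ≤ 8 + β) (b2 : 8 + β ≤ b) where

  open Cyclic b
  open Band α b h2 h8

  sub-row : ∀ {r r′} d → (∀ x → Row r x → Row r′ x ⊎ x ≡ d) → Adjacent r r′
  sub-row d f = residue d , λ c (x , row , eq) → [ (λ row′ → inj₁ (x , row′ , eq)) , (λ x≡d → inj₂ (trans (sym eq) (cong residue x≡d))) ]′ (f x row)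

  opaque
    adjacent-1-2 : Adjacent 1 2
    adjacent-1-2 = sub-row {1} {2} (3 + α) λ x (p , q) → [ (λ q → inj₁ (inj₁ (p , ℕ.≤-pred q))) , inj₂ ]′ (ℕ.m≤n⇒m<n∨m≡n q)

  opaque
    adjacent-1-3 : Adjacent 1 3
    adjacent-1-3 = sub-row {1} {3} 1 λ x (p , q) → [ (λ p → inj₁ (inj₁ (p , q))) , (λ eq → inj₂ (sym eq)) ]′ (ℕ.m≤n⇒m<n∨m≡n p)

  opaque
    adjacent-2-1 : Adjacent 2 1
    adjacent-2-1 = sub-row {2} {1} (4 + α) λ { x (inj₁ (p , q)) → inj₁ (p , ℕ.m≤n⇒m≤1+n q) ; x (inj₂ eq) → inj₂ eq }

  opaque
    adjacent-3-1 : Adjacent 3 1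
    adjacent-3-1 = sub-row {3} {1} (5 + α) λ { x (inj₁ (p , q)) → inj₁ (ℕ.<⇒≤ p , q) ; x (inj₂ eq) → inj₂ eq }

  opaque
    adjacent-up : ∀ n → Adjacent (4 + n) (5 + n)
    adjacent-up n = sub-row {4 + n} {5 + n} (4 + n) λ x (p , q) →
      [ (λ p → inj₁ (p , ℕ.≤-trans q (ℕ.+-monoʳ-≤ (6 + α) (ℕ.n≤1+n n)))) , (λ eq → inj₂ (sym eq)) ]′ (ℕ.m≤n⇒m<n∨m≡n p)

  opaque
    adjacent-down : ∀ n → Adjacent (5 + n) (4 + n)
    adjacent-down n = sub-row {5 + n} {4 + n} (6 + α + suc n) go
      where
      go : ∀ x → 5 + n ≤ x × x ≤ 6 + α + suc n → (4 + n ≤ x × x ≤ 6 + α + n) ⊎ x ≡ 6 + α + suc n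
      go x (p , q) with ℕ.m≤n⇒m<n∨m≡n q
      ... | inj₁ q′ = inj₁ (ℕ.<⇒≤ p , lin (λ neg → neg & (q′)) 0 (solve (n ∷ x ∷ α ∷ [])))
      ... | inj₂ eq = inj₂ eq

  -- At most two columns lie outside row 1. This breaks the reflection of the path 4 - ... - (b -
  -- 1): the last row has only the columns b - 1 and 0 outside row 1, whereas row 4 has the three
  -- columns `4 + α`, `5 + α` and `6 + α`.
  NearOne : ℕ → Set
  NearOne r = ∃ λ d → ∃ λ d′ → ∀ c → In r c → In 1 c ⊎ c ≡ d ⊎ c ≡ d′

  opaque
    near-last : NearOne (7 + β)
    near-last = residue (7 + β) , residue (8 + β) , λ { c (x , (p , q) , refl) → go x p q }
      where
      go : ∀ x → 7 + β ≤ x → x ≤ 6 + α + (3 + β) → In 1 (residue x) ⊎ residue x ≡ residue (7 + β) ⊎ residue x ≡ residue (8 + β)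
      go x p q with ℕ.m≤n⇒m<n∨m≡n p
      ... | inj₂ refl = inj₂ (inj₁ refl)
      ... | inj₁ p with ℕ.m≤n⇒m<n∨m≡n p
      ... | inj₂ refl = inj₂ (inj₂ refl)
      ... | inj₁ p with ℕ.m≤n⇒∃[o]m+o≡n p
      ... | o , refl = inj₁ (1 + o , (s≤s z≤n , lin (λ neg → neg & q) 2 (solve (o ∷ α ∷ β ∷ []))) ,
          trans (sym (residue-+b (1 + o))) (cong residue (trans (cong (1 + o +_) (ℕ.≤-antisym b1 b2)) (trans (ℕ.+-comm (1 + o) (8 + β)) (ℕ.+-suc (8 + β) o)))))

  opaque
    not-near-4 : ¬ NearOne 4
    not-near-4 (d , d′ , f) = go (f (residue (4 + α)) (4 + α , (lin (λ neg → neg) α (solve (b ∷ α ∷ [])) , lin (λ neg → neg) 2 (solve (b ∷ α ∷ []))) , refl))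
        (f (residue (5 + α)) (5 + α , (lin (λ neg → neg) (1 + α) (solve (b ∷ α ∷ [])) , lin (λ neg → neg) 1 (solve (b ∷ α ∷ []))) , refl)) (f (residue (6 + α)) (6 + α , (lin (λ neg → neg) (2 + α) (solve (b ∷ α ∷ [])) , lin (λ neg → neg) 0 (solve (b ∷ α ∷ []))) , refl))
      where
      4≢5 : residue (4 + α) ≢ residue (5 + α)
      4≢5 = residue-distinct {4 + α} {5 + α} (lin (λ neg → neg) 0 (solve (b ∷ α ∷ []))) (lin (λ neg → neg & h8) 6 (solve (b ∷ α ∷ [])))
      4≢6 : residue (4 + α) ≢ residue (6 + α)
      4≢6 = residue-distinct {4 + α} {6 + α} (lin (λ neg → neg) 1 (solve (b ∷ α ∷ []))) (lin (λ neg → neg & h8) 5 (solve (b ∷ α ∷ [])))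
      5≢6 : residue (5 + α) ≢ residue (6 + α)
      5≢6 = residue-distinct {5 + α} {6 + α} (lin (λ neg → neg) 0 (solve (b ∷ α ∷ []))) (lin (λ neg → neg & h8) 6 (solve (b ∷ α ∷ [])))
      go : In 1 (residue (4 + α)) ⊎ residue (4 + α) ≡ d ⊎ residue (4 + α) ≡ d′ → In 1 (residue (5 + α)) ⊎ residue (5 + α) ≡ d ⊎ residue (5 + α) ≡ d′ →
        In 1 (residue (6 + α)) ⊎ residue (6 + α) ≡ d ⊎ residue (6 + α) ≡ d′ → ⊥
      go (inj₁ i) _ _ = (∉-1 (4 + α) (inj₂ (lin (λ neg → neg) 0 (solve (b ∷ α ∷ [])) , lin (λ neg → neg & h2) (2 + α) (solve (b ∷ α ∷ []))))) i
      go _ (inj₁ i) _ = (∉-1 (5 + α) (inj₂ (lin (λ neg → neg) 1 (solve (b ∷ α ∷ [])) , lin (λ neg → neg & h2) (1 + α) (solve (b ∷ α ∷ []))))) i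
      go _ _ (inj₁ i) = (∉-1 (6 + α) (inj₂ (lin (λ neg → neg) 2 (solve (b ∷ α ∷ [])) , lin (λ neg → neg & h2) α (solve (b ∷ α ∷ []))))) i
      go (inj₂ (inj₁ x)) (inj₂ (inj₁ y)) _ = 4≢5 (trans x (sym y))
      go (inj₂ (inj₂ x)) (inj₂ (inj₂ y)) _ = 4≢5 (trans x (sym y))
      go (inj₂ (inj₁ x)) _ (inj₂ (inj₁ y)) = 4≢6 (trans x (sym y))
      go (inj₂ (inj₂ x)) _ (inj₂ (inj₂ y)) = 4≢6 (trans x (sym y))
      go _ (inj₂ (inj₁ x)) (inj₂ (inj₁ y)) = 5≢6 (trans x (sym y))
      go _ (inj₂ (inj₂ x)) (inj₂ (inj₂ y)) = 5≢6 (trans x (sym y))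

  module _ (p q : Fin b → Fin b) (p-inj : Injective _≡_ _≡_ p) (q-inj : Injective _≡_ _≡_ q)
    (preserve : ∀ {i c} → In (toℕ i) c → In (toℕ (p i)) (q c)) (reflect : ∀ {i c} → In (toℕ (p i)) (q c) → In (toℕ i) c) where

    row : ∀ r → r < b → Fin b
    row r r<b = fromℕ< r<b

    opaque
      toℕ-row : ∀ {r} (r<b : r < b) → toℕ (row r r<b) ≡ r
      toℕ-row r<b = Fin.toℕ-fromℕ< r<b

    opaque
      adjacent-p : ∀ {i j} → Adjacent (toℕ i) (toℕ j) → Adjacent (toℕ (p i)) (toℕ (p j))
      adjacent-p {i} {j} (d , f) = q d , λ c c∈ → go c (injective⇒surjective q q-inj c) c∈
        where
        go : ∀ c → (∃ λ c′ → q c′ ≡ c) → In (toℕ (p i)) c → In (toℕ (p j)) c ⊎ c ≡ q d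
        go c (c′ , refl) c∈ = [ (λ c′∈ → inj₁ (preserve c′∈)) , (λ eq → inj₂ (cong q eq)) ]′ (f c′ (reflect c∈))

    opaque
      p-adjacent : ∀ {i j} → Adjacent (toℕ (p i)) (toℕ (p j)) → Adjacent (toℕ i) (toℕ j)
      p-adjacent {i} {j} (d , f) = proj₁ d′ , λ c c∈ → [ (λ z → inj₁ (reflect z)) , (λ eq → inj₂ (q-inj (trans eq (sym (proj₂ d′))))) ]′ (f (q c) (preserve c∈))
        where
        d′ : ∃ λ c → q c ≡ d
        d′ = injective⇒surjective q q-inj d

    Fixed : ℕ → Set
    Fixed r = ∀ i → toℕ i ≡ r → p i ≡ i

    OnlyNeighbour : Fin b → Fin b → Set
    OnlyNeighbour i k = ∀ l → Adjacent (toℕ i) (toℕ l) → l ≡ i ⊎ l ≡ k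

    opaque
      only-p : ∀ {i k} → OnlyNeighbour i k → OnlyNeighbour (p i) (p k)
      only-p {i} {k} only l adj with injective⇒surjective p p-inj l
      ... | l′ , refl = [ (λ eq → inj₁ (cong p eq)) , (λ eq → inj₂ (cong p eq)) ]′ (only l′ (p-adjacent adj))

    opaque
      same : ∀ {i j : Fin b} {n} → toℕ i ≡ n → toℕ j ≡ n → i ≡ j
      same eq eq′ = Fin.toℕ-injective (trans eq (sym eq′))

    opaque
      1<b : 1 < b
      1<b = (lin (λ neg → neg & h8) 6 (solve (b ∷ α ∷ [])))
    opaque
      2<b : 2 < b
      2<b = (lin (λ neg → neg & h8) 5 (solve (b ∷ α ∷ [])))
    opaque
      3<b : 3 < b
      3<b = (lin (λ neg → neg & h8) 4 (solve (b ∷ α ∷ [])))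
    r₁ r₂ r₃ : Fin b
    r₁ = row 1 1<b
    r₂ = row 2 2<b
    r₃ = row 3 3<b

    opaque
      row≢ : ∀ {m n} (m<b : m < b) (n<b : n < b) → m ≢ n → row m m<b ≢ row n n<b
      row≢ m<b n<b m≢n eq = m≢n (trans (sym (toℕ-row m<b)) (trans (cong toℕ eq) (toℕ-row n<b)))

    opaque
      adj : ∀ {m n} (i j : Fin b) → toℕ i ≡ m → toℕ j ≡ n → Adjacent m n → Adjacent (toℕ i) (toℕ j)
      adj i j refl refl a = a

    opaque
      jda : ∀ {m n} (i j : Fin b) → toℕ i ≡ m → toℕ j ≡ n → Adjacent (toℕ i) (toℕ j) → Adjacent m n
      jda i j refl refl a = a

    opaque
      only-2 : OnlyNeighbour r₂ r₁
      only-2 l a = [ (λ eq → inj₂ (same eq (toℕ-row 1<b))) , (λ eq → inj₁ (same eq (toℕ-row 2<b))) ]′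
        (adjacent-2 (Fin.toℕ<n l) (jda r₂ l (toℕ-row 2<b) refl a))

    opaque
      only-3 : OnlyNeighbour r₃ r₁
      only-3 l a = [ (λ eq → inj₂ (same eq (toℕ-row 1<b))) , (λ eq → inj₁ (same eq (toℕ-row 3<b))) ]′
        (adjacent-3 (Fin.toℕ<n l) (jda r₃ l (toℕ-row 3<b) refl a))

    opaque
      below : ∀ {r} (k : Fin b) → suc r ≡ toℕ k → r < b
      below k eq = ℕ.<-trans (ℕ.≤-reflexive eq) (Fin.toℕ<n k)

    -- Row 1 is the only row with two neighbours that have no other neighbour.
    opaque
      no-isolated-pair : ∀ {n} i j k → toℕ i ≡ 4 + n → toℕ j ≡ 5 + n → 4 + n ≡ suc (toℕ k) → 4 ≤ toℕ k → OnlyNeighbour j i → OnlyNeighbour k i → ⊥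
      no-isolated-pair {n} i j k i≡ j≡ k≡ 4≤k oj ok with 6 + n ℕ.<? b
      ... | yes r<b with oj (row (6 + n) r<b) (adj j (row (6 + n) r<b) j≡ (toℕ-row r<b) (adjacent-up (suc n)))
      ...   | inj₁ eq = ℕ.1+n≢n (trans (sym (toℕ-row r<b)) (trans (cong toℕ eq) j≡))
      ...   | inj₂ eq = ℕ.m+1+n≢n 1 (trans (sym (toℕ-row r<b)) (trans (cong toℕ eq) i≡))
      no-isolated-pair {n} i j k i≡ j≡ k≡ 4≤k oj ok | no r≮b with ℕ.m≤n⇒∃[o]m+o≡n 4≤k
      -- Here `8 ≤ b` enters: with seven rows the path 4 - 5 - 6 could not be told from 2 - 1 - 3.
      ... | zero , 4≡k = (absurd (h8 & (ℕ.≮⇒≥ r≮b) & (ℕ.≤-reflexive (trans k≡ (cong suc (sym 4≡k))))) 0 (solve (b ∷ n ∷ [])))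
      ... | suc n″ , eq with ok (row (4 + n″) (below k eq)) (adj k (row (4 + n″) (below k eq)) (sym eq) (toℕ-row (below k eq)) (adjacent-down n″))
      ...   | inj₁ eq′ = ℕ.1+n≢n (trans eq (trans (sym (cong toℕ eq′)) (toℕ-row (below k eq))))
      ...   | inj₂ eq′ = ℕ.m+1+n≢n 1 (trans (cong suc eq) (trans (sym k≡) (trans (sym i≡) (trans (sym (cong toℕ eq′)) (toℕ-row (below k eq))))))

    opaque
      -- The image of row 1 has two neighbours without further neighbours. Row 0 has no neighbour,
      -- rows 2 and 3 have one each, and `no-isolated-pair` deals with the long path.
      fixed-1 : p r₁ ≡ r₁
      fixed-1 = go (toℕ (p r₁)) refl
        where
        a₂ : Adjacent (toℕ (p r₁)) (toℕ (p r₂))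
        a₂ = adjacent-p (adj r₁ r₂ (toℕ-row 1<b) (toℕ-row 2<b) adjacent-1-2)
        a₃ : Adjacent (toℕ (p r₁)) (toℕ (p r₃))
        a₃ = adjacent-p (adj r₁ r₃ (toℕ-row 1<b) (toℕ-row 3<b) adjacent-1-3)
        1≢2 : p r₂ ≢ p r₁
        1≢2 eq = row≢ 2<b 1<b (λ ()) (p-inj eq)
        1≢3 : p r₃ ≢ p r₁
        1≢3 eq = row≢ 3<b 1<b (λ ()) (p-inj eq)
        2≢3 : p r₂ ≢ p r₃
        2≢3 eq = row≢ 2<b 3<b (λ ()) (p-inj eq)
        go : ∀ v → toℕ (p r₁) ≡ v → p r₁ ≡ r₁
        go 0 eq = contradiction (same (adjacent-0 (Fin.toℕ<n (p r₂)) (jda (p r₁) (p r₂) eq refl a₂)) eq) 1≢2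
        go 1 eq = same eq (toℕ-row 1<b)
        go 2 eq with adjacent-2 (Fin.toℕ<n (p r₂)) (jda (p r₁) (p r₂) eq refl a₂) | adjacent-2 (Fin.toℕ<n (p r₃)) (jda (p r₁) (p r₃) eq refl a₃)
        ... | inj₂ eq′ | _ = contradiction (same eq′ eq) 1≢2
        ... | _ | inj₂ eq′ = contradiction (same eq′ eq) 1≢3
        ... | inj₁ eq′ | inj₁ eq″ = contradiction (same eq′ eq″) 2≢3
        go 3 eq with adjacent-3 (Fin.toℕ<n (p r₂)) (jda (p r₁) (p r₂) eq refl a₂) | adjacent-3 (Fin.toℕ<n (p r₃)) (jda (p r₁) (p r₃) eq refl a₃)
        ... | inj₂ eq′ | _ = contradiction (same eq′ eq) 1≢2
        ... | _ | inj₂ eq′ = contradiction (same eq′ eq) 1≢3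
        ... | inj₁ eq′ | inj₁ eq″ = contradiction (same eq′ eq″) 2≢3
        go (suc (suc (suc (suc n)))) eq with adjacent-4+ (subst (_< b) eq (Fin.toℕ<n (p r₁))) (Fin.toℕ<n (p r₂)) (jda (p r₁) (p r₂) eq refl a₂)
          | adjacent-4+ (subst (_< b) eq (Fin.toℕ<n (p r₁))) (Fin.toℕ<n (p r₃)) (jda (p r₁) (p r₃) eq refl a₃)
        ... | inj₁ eq′ | _ = contradiction (same eq′ eq) 1≢2
        ... | _ | inj₁ eq′ = contradiction (same eq′ eq) 1≢3
        ... | inj₂ (inj₁ eq′) | inj₂ (inj₁ eq″) = contradiction (same eq′ eq″) 2≢3
        ... | inj₂ (inj₂ (eq′ , _)) | inj₂ (inj₂ (eq″ , _)) = contradiction (same (ℕ.suc-injective (sym eq′)) (ℕ.suc-injective (sym eq″))) 2≢3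
        ... | inj₂ (inj₁ eq′) | inj₂ (inj₂ (eq″ , 4≤)) = ⊥-elim (no-isolated-pair (p r₁) (p r₂) (p r₃) eq eq′ eq″ 4≤ (only-p only-2) (only-p only-3))
        ... | inj₂ (inj₂ (eq″ , 4≤)) | inj₂ (inj₁ eq′) = ⊥-elim (no-isolated-pair (p r₁) (p r₃) (p r₂) eq eq′ eq″ 4≤ (only-p only-3) (only-p only-2))

    ℓ<b : 7 + β < b
    ℓ<b = b2
    m<b : 6 + β < b
    m<b = ℕ.<⇒≤ b2
    ℓ m : Fin b
    ℓ = row (7 + β) ℓ<b
    m = row (6 + β) m<b

    opaque
      only-last : OnlyNeighbour ℓ m
      only-last l a with adjacent-4+ {3 + β} ℓ<b (Fin.toℕ<n l) (jda ℓ l (toℕ-row ℓ<b) refl a)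
      ... | inj₁ eq = inj₁ (same eq (toℕ-row ℓ<b))
      ... | inj₂ (inj₁ eq) = contradiction (subst (_< b) eq (Fin.toℕ<n l)) (ℕ.≤⇒≯ b1)
      ... | inj₂ (inj₂ (eq , _)) = inj₂ (same (ℕ.suc-injective (sym eq)) (toℕ-row m<b))

    opaque
      near-p : NearOne (toℕ (p ℓ))
      near-p = let d , d′ , f = subst NearOne (sym (toℕ-row ℓ<b)) near-last in q d , q d′ , λ c c∈ → go d d′ f c (injective⇒surjective q q-inj c) c∈
        where
        go : ∀ d d′ → (∀ c → In (toℕ ℓ) c → In 1 c ⊎ c ≡ d ⊎ c ≡ d′) → ∀ c → (∃ λ c′ → q c′ ≡ c) → In (toℕ (p ℓ)) c → In 1 c ⊎ c ≡ q d ⊎ c ≡ q d′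
        go d d′ f c (c′ , refl) c∈ with f c′ (reflect c∈)
        ... | inj₁ c′∈ = inj₁ (subst (λ r → In r (q c′)) (trans (cong toℕ fixed-1) (toℕ-row 1<b)) (preserve (subst (λ r → In r c′) (sym (toℕ-row 1<b)) c′∈)))
        ... | inj₂ (inj₁ eq) = inj₂ (inj₁ (cong q eq))
        ... | inj₂ (inj₂ eq) = inj₂ (inj₂ (cong q eq))

    opaque
      -- The image has a single neighbour, which is not the fixed row 1. Row 0 has none, rows 2 and
      -- 3 have only row 1, and the inner rows of the long path have two. Of the two ends of that
      -- path, row 4 is excluded by `NearOne`.
      fixed-last : p ℓ ≡ ℓ
      fixed-last = go (toℕ (p ℓ)) refl
        where
        a : Adjacent (toℕ (p ℓ)) (toℕ (p m))
        a = adjacent-p (adj ℓ m (toℕ-row ℓ<b) (toℕ-row m<b) (adjacent-down (2 + β)))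
        m≢ℓ : p m ≢ p ℓ
        m≢ℓ eq = ℕ.1+n≢n (trans (sym (toℕ-row ℓ<b)) (trans (sym (cong toℕ (p-inj eq))) (toℕ-row m<b)))
        m≢1 : ∀ {i} → p m ≡ i → toℕ i ≢ 1
        m≢1 eq i≡1 = contradiction (trans (sym (toℕ-row m<b)) (trans (cong toℕ (p-inj (trans eq (trans (same i≡1 (toℕ-row 1<b)) (sym fixed-1))))) (toℕ-row 1<b))) λ ()
        go : ∀ v → toℕ (p ℓ) ≡ v → p ℓ ≡ ℓ
        go 0 eq = contradiction (same (adjacent-0 (Fin.toℕ<n (p m)) (jda (p ℓ) (p m) eq refl a)) eq) m≢ℓ
        go 1 eq = contradiction (trans (sym (toℕ-row ℓ<b)) (trans (cong toℕ (p-inj (trans (same eq (toℕ-row 1<b)) (sym fixed-1)))) (toℕ-row 1<b))) λ ()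
        go 2 eq with adjacent-2 (Fin.toℕ<n (p m)) (jda (p ℓ) (p m) eq refl a)
        ... | inj₁ eq′ = contradiction eq′ (m≢1 refl)
        ... | inj₂ eq′ = contradiction (same eq′ eq) m≢ℓ
        go 3 eq with adjacent-3 (Fin.toℕ<n (p m)) (jda (p ℓ) (p m) eq refl a)
        ... | inj₁ eq′ = contradiction eq′ (m≢1 refl)
        ... | inj₂ eq′ = contradiction (same eq′ eq) m≢ℓ
        go 4 eq = contradiction (subst NearOne eq near-p) not-near-4
        go (suc (suc (suc (suc (suc n))))) eq with 6 + n ℕ.<? b
        ... | no r≮b = same (trans eq (ℕ.≤-antisym (ℕ.≤-pred (ℕ.≤-trans (subst (_< b) eq (Fin.toℕ<n (p ℓ))) b1)) (ℕ.≤-pred (ℕ.≤-trans b2 (ℕ.≮⇒≥ r≮b))))) (toℕ-row ℓ<b)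
        ... | yes r<b = contradiction (trans (trans (sym (toℕ-row r<b)) (cong toℕ (trans up (sym down)))) (toℕ-row s<b)) (ℕ.m+1+n≢n 1)
          where
          s<b : 4 + n < b
          s<b = ℕ.<-trans (ℕ.n<1+n _) (ℕ.<-trans (ℕ.n<1+n _) r<b)
          up : row (6 + n) r<b ≡ p m
          up with only-p only-last (row (6 + n) r<b) (adj (p ℓ) (row (6 + n) r<b) eq (toℕ-row r<b) (adjacent-up (suc n)))
          ... | inj₂ eq′ = eq′
          ... | inj₁ eq′ = contradiction (trans (sym (toℕ-row r<b)) (trans (cong toℕ eq′) eq)) ℕ.1+n≢n
          down : row (4 + n) s<b ≡ p m
          down with only-p only-last (row (4 + n) s<b) (adj (p ℓ) (row (4 + n) s<b) eq (toℕ-row s<b) (adjacent-down n))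
          ... | inj₂ eq′ = eq′
          ... | inj₁ eq′ = contradiction (sym (trans (sym (toℕ-row s<b)) (trans (cong toℕ eq′) eq))) ℕ.1+n≢n

    opaque
      -- Downward induction from the last row: the image of row `4 + n` is adjacent to the fixed row
      -- `5 + n`, and rows `5 + n` and `6 + n` are already images of themselves. `d` bounds the
      -- distance to the end.
      fixed-tail : ∀ d n → 3 + β ≤ d + n → ∀ i → toℕ i ≡ 4 + n → p i ≡ i
      fixed-tail zero n ≤n i eq = subst (λ i → p i ≡ i) (same (toℕ-row ℓ<b) (trans eq (ℕ.≤-antisym
        (lin (λ neg → neg & (subst (_< b) eq (Fin.toℕ<n i)) & b1) 0 (solve (b ∷ n ∷ β ∷ []))) (ℕ.+-monoʳ-≤ 4 ≤n)))) fixed-last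
      fixed-tail (suc d) n ≤n i eq with 5 + n ℕ.<? b
      ... | no r≮b = subst (λ i → p i ≡ i) (same (toℕ-row ℓ<b) (trans eq (ℕ.≤-antisym
        (lin (λ neg → neg & (subst (_< b) eq (Fin.toℕ<n i)) & b1) 0 (solve (b ∷ n ∷ β ∷ []))) (lin (λ neg → neg & (ℕ.≮⇒≥ r≮b) & b2) 0 (solve (b ∷ n ∷ β ∷ [])))))) fixed-last
      ... | yes r<b with adjacent-4+ r<b (Fin.toℕ<n (p i)) (jda (p j) (p i) (trans (cong toℕ pj≡j) (toℕ-row r<b)) refl (adjacent-p (adj j i (toℕ-row r<b) eq (adjacent-down n))))
        where
        j : Fin b
        j = row (5 + n) r<b
        pj≡j : p j ≡ j
        pj≡j = fixed-tail d (suc n) (ℕ.≤-trans ≤n (ℕ.≤-reflexive (sym (ℕ.+-suc d n)))) j (toℕ-row r<b)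
      ... | inj₁ eq′ = contradiction (trans (sym eq) (trans (cong toℕ (p-inj (trans (same eq′ (toℕ-row r<b)) (sym (fixed-tail d (suc n) (ℕ.≤-trans ≤n (ℕ.≤-reflexive (sym (ℕ.+-suc d n)))) (row (5 + n) r<b) (toℕ-row r<b)))))) (toℕ-row r<b))) (λ e → ℕ.1+n≢n (sym e))
      ... | inj₂ (inj₁ eq′) = contradiction (trans (sym eq) (trans (cong toℕ (p-inj (sym (fixed-tail d (2 + n) (ℕ.≤-trans ≤n (ℕ.≤-trans (ℕ.≤-reflexive (sym (ℕ.+-suc d n))) (ℕ.+-monoʳ-≤ d (ℕ.n≤1+n (suc n))))) (p i) eq′)))) eq′)) (λ e → ℕ.m+1+n≢n 1 (sym e))
      ... | inj₂ (inj₂ (eq′ , _)) = same (ℕ.suc-injective (sym eq′)) eq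

    opaque
      fixed-4+ : ∀ n i → toℕ i ≡ 4 + n → p i ≡ i
      fixed-4+ n = fixed-tail (3 + β) n (ℕ.m≤m+n _ n)

    opaque
      fixed-1′ : Fixed 1
      fixed-1′ i eq = subst (λ i → p i ≡ i) (same (toℕ-row 1<b) eq) fixed-1

    opaque
      -- Only the images 0, 2 and 3 are still free, and rows 2 and 3 are adjacent to the fixed row 1
      -- while row 0 is not.
      fixed-0 : Fixed 0
      fixed-0 i i≡0 = go (toℕ (p i)) refl
        where
        not-1 : Adjacent (toℕ (p i)) 1 → ⊥
        not-1 a = contradiction (adjacent-0 1<b (jda i r₁ i≡0 (toℕ-row 1<b) (p-adjacent (adj (p i) (p r₁) refl (trans (cong toℕ fixed-1) (toℕ-row 1<b)) a)))) λ ()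
        go : ∀ v → toℕ (p i) ≡ v → p i ≡ i
        go 0 eq = same eq i≡0
        go 1 eq = p-inj (fixed-1′ (p i) eq)
        go 2 eq = ⊥-elim (not-1 (subst (λ r → Adjacent r 1) (sym eq) adjacent-2-1))
        go 3 eq = ⊥-elim (not-1 (subst (λ r → Adjacent r 1) (sym eq) adjacent-3-1))
        go (suc (suc (suc (suc n)))) eq = p-inj (fixed-4+ n (p i) eq)

    opaque
      transfer : ∀ {r c} → r < b → Fixed r → In r c → In r (q c)
      transfer {r} {c} r<b fix c∈ = subst (λ r → In r (q c)) (trans (cong toℕ (fix (row r r<b) (toℕ-row r<b))) (toℕ-row r<b))
        (preserve (subst (λ r → In r c) (sym (toℕ-row r<b)) c∈))

    opaque
      transfer⁻ : ∀ {r c} → r < b → Fixed r → In r (q c) → In r c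
      transfer⁻ {r} {c} r<b fix c∈ = subst (λ r → In r c) (toℕ-row r<b)
        (reflect (subst (λ r → In r (q c)) (sym (trans (cong toℕ (fix (row r r<b) (toℕ-row r<b))) (toℕ-row r<b))) c∈))

    Col : ℕ → Set
    Col x = q (residue x) ≡ residue x

    opaque
      -- Both rows are fixed, and this is the only column of row `4 + n` that is missing in row
      -- `5 + n`. `col-end` is the mirror image, with the last column of row `5 + n`.
      col-4+ : ∀ n → 5 + n < b → Col (4 + n)
      col-4+ n r<b with transfer {4 + n} (ℕ.<-trans (ℕ.n<1+n _) r<b) (fixed-4+ n) (4 + n , (lin (λ neg → neg) 0 (solve (b ∷ n ∷ α ∷ [])) , lin (λ neg → neg) (2 + α) (solve (b ∷ n ∷ α ∷ []))) , refl)
      ... | x , (lo , hi) , eq with ℕ.m≤n⇒m<n∨m≡n lo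
      ...   | inj₂ refl = sym eq
      ...   | inj₁ lo′ = contradiction (transfer⁻ {5 + n} r<b (fixed-4+ (suc n)) (x , (lo′ , ℕ.≤-trans hi (ℕ.+-monoʳ-≤ (6 + α) (ℕ.n≤1+n n))) , eq)) (∉-4+ (1 + n) (4 + n) (inj₁ (lin (λ neg → neg) 0 (solve (b ∷ n ∷ α ∷ [])) , lin (λ neg → neg & h2) (2 + α) (solve (b ∷ n ∷ α ∷ [])))))

    opaque
      col-end : ∀ n → 5 + n < b → Col (7 + α + n)
      col-end n r<b with transfer {5 + n} r<b (fixed-4+ (suc n)) (7 + α + n , (lin (λ neg → neg) (2 + α) (solve (b ∷ n ∷ α ∷ [])) , lin (λ neg → neg) 0 (solve (b ∷ n ∷ α ∷ []))) , refl)
      ... | x , (lo , hi) , eq with ℕ.m≤n⇒m<n∨m≡n hi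
      ...   | inj₂ x≡ = trans (sym eq) (cong residue (trans x≡ (ℕ.+-suc (6 + α) n)))
      ...   | inj₁ hi′ = contradiction (transfer⁻ {4 + n} (ℕ.<-trans (ℕ.n<1+n _) r<b) (fixed-4+ n) (x , (ℕ.<⇒≤ lo , lin (λ neg → neg & (hi′)) 0 (solve (n ∷ x ∷ α ∷ []))) , eq)) (∉-4+ n (7 + α + n) (inj₂ (lin (λ neg → neg) 0 (solve (b ∷ n ∷ α ∷ [])) , lin (λ neg → neg & h2) (2 + α) (solve (b ∷ n ∷ α ∷ [])))))

    room : ∀ n → n + (7 + α) ≤ b → 5 + n < b
    room n g = (lin (λ neg → neg & g) (1 + α) (solve (b ∷ n ∷ α ∷ [])))
    room′ : ∀ n → n + (7 + α) ≤ b → 6 + n < b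
    room′ n g = (lin (λ neg → neg & g) α (solve (b ∷ n ∷ α ∷ [])))

    large : 7 + α ≤ b
    large = (lin (λ neg → neg & neg & h2 & h8) 1 (solve (b ∷ α ∷ [])))

    -- Chosen so that the windows of rows `5 + γ` and `6 + γ` end in `b` and `b + 1`, that is, in
    -- columns 0 and 1.
    γ = b ∸ (7 + α)
    opaque
      γ+ : γ + (7 + α) ≡ b
      γ+ = ℕ.m∸n+n≡m large

    opaque
      col-0 : Col 0
      col-0 = subst (λ c → q c ≡ c) (trans (cong residue (trans (ℕ.+-comm (7 + α) γ) γ+)) (residue-+b 0)) (col-end γ (room γ (ℕ.≤-reflexive γ+)))

    opaque
      col-1 : Col 1
      col-1 = subst (λ c → q c ≡ c) (trans (cong residue (trans (ℕ.+-suc (7 + α) γ) (cong suc (trans (ℕ.+-comm (7 + α) γ) γ+)))) (residue-+b 1)) (col-end (suc γ) (room′ γ (ℕ.≤-reflexive γ+)))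

    opaque
      clash : ∀ {x y} → Col x → residue x ≡ q (residue y) → residue x ≡ residue y
      clash col eq = q-inj (trans col eq)

    opaque
      -- Among the columns 0, 3, 4, ..., `4 + α` of the fixed row 0 this is the only one not yet
      -- known to be fixed. Column 2 then follows in the same way from row 1.
      col-3 : Col 3
      col-3 with transfer {0} (ℕ.<-trans (s≤s z≤n) 1<b) fixed-0 (3 , inj₂ (lin (λ neg → neg) 0 (solve (b ∷ α ∷ [])) , lin (λ neg → neg) (1 + α) (solve (b ∷ α ∷ []))) , refl)
      ... | x , inj₁ refl , eq = contradiction (clash {0} {3} col-0 eq) (residue-distinct {0} {3} (s≤s z≤n) (lin (λ neg → neg & h8) 4 (solve (b ∷ α ∷ []))))
      ... | x , inj₂ (lo , hi) , eq with ℕ.m≤n⇒m<n∨m≡n lo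
      ...   | inj₂ refl = sym eq
      ...   | inj₁ lo′ with ℕ.m≤n⇒∃[o]m+o≡n lo′
      ...     | n , refl = contradiction (sym (clash {4 + n} {3} (col-4+ n (lin (λ neg → neg & h2 & hi) α (solve (b ∷ n ∷ α ∷ [])))) eq)) (residue-distinct {3} {4 + n} (lin (λ neg → neg) n (solve (n ∷ []))) (lin (λ neg → neg & h2 & hi) (4 + α) (solve (b ∷ n ∷ α ∷ []))))

    opaque
      col-2 : Col 2
      col-2 with transfer {1} 1<b fixed-1′ (2 , (lin (λ neg → neg) 1 (solve (b ∷ α ∷ [])) , lin (λ neg → neg) (1 + α) (solve (b ∷ α ∷ []))) , refl)
      ... | 1 , _ , eq = contradiction (clash {1} {2} col-1 eq) (residue-distinct {1} {2} (s≤s (s≤s z≤n)) (lin (λ neg → neg & h8) 6 (solve (b ∷ α ∷ []))))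
      ... | 2 , _ , eq = sym eq
      ... | 3 , _ , eq = contradiction (sym (clash {3} {2} col-3 eq)) (residue-distinct {2} {3} (s≤s (s≤s (s≤s z≤n))) (lin (λ neg → neg & h8) 6 (solve (b ∷ α ∷ []))))
      ... | suc (suc (suc (suc n))) , (_ , hi) , eq = contradiction (sym (clash {4 + n} {2} (col-4+ n (lin (λ neg → neg & h2 & hi) (1 + α) (solve (b ∷ n ∷ α ∷ [])))) eq)) (residue-distinct {2} {4 + n} (lin (λ neg → neg) (1 + n) (solve (n ∷ []))) (lin (λ neg → neg & h2 & hi) (4 + α) (solve (b ∷ n ∷ α ∷ []))))

    opaque
      col-but-last : ∀ v → v < b → suc v ≢ b → Col v
      col-but-last 0 _ _ = col-0
      col-but-last 1 _ _ = col-1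
      col-but-last 2 _ _ = col-2
      col-but-last 3 _ _ = col-3
      col-but-last (suc (suc (suc (suc n)))) v<b v≢ = col-4+ n (ℕ.≤∧≢⇒< v<b v≢)

    opaque
      q-trivial : ∀ c → q c ≡ c
      q-trivial c with suc (toℕ c) ℕ.≟ b
      ... | no c≢ = subst (λ c → q c ≡ c) (residue-toℕ c) (col-but-last (toℕ c) (Fin.toℕ<n c) c≢)
      ... | yes c≡ with suc (toℕ (q c)) ℕ.≟ b
      ...   | yes qc≡ = Fin.toℕ-injective (ℕ.suc-injective (trans qc≡ (sym c≡)))
      ...   | no qc≢ = q-inj (subst (λ c → q c ≡ c) (residue-toℕ (q c)) (col-but-last (toℕ (q c)) (Fin.toℕ<n (q c)) qc≢))

    opaque
      1∈2 : In 2 (residue 1)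
      1∈2 = 1 , inj₁ (lin (λ neg → neg) 0 (solve (b ∷ α ∷ [])) , lin (λ neg → neg) (1 + α) (solve (b ∷ α ∷ []))) , refl

    opaque
      1∉3 : ¬ In 3 (residue 1)
      1∉3 = (∉-3 1 (inj₁ (lin (λ neg → neg) 0 (solve (b ∷ α ∷ [])) , lin (λ neg → neg & h2) (3 + α) (solve (b ∷ α ∷ [])))) (inj₁ (lin (λ neg → neg) (3 + α) (solve (b ∷ α ∷ [])) , lin (λ neg → neg & h2) (1 + α) (solve (b ∷ α ∷ [])))))

    opaque
      -- Adjacency cannot distinguish rows 2 and 3, but once the columns are fixed, column 1 does.
      fixed-2 : Fixed 2
      fixed-2 i i≡2 = go (toℕ (p i)) refl
        where
        go : ∀ v → toℕ (p i) ≡ v → p i ≡ i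
        go 0 eq = p-inj (fixed-0 (p i) eq)
        go 1 eq = p-inj (fixed-1′ (p i) eq)
        go 2 eq = same eq i≡2
        go 3 eq = contradiction (subst (λ c → In 3 c) (q-trivial (residue 1)) (subst (λ r → In r (q (residue 1))) eq (preserve (subst (λ r → In r (residue 1)) (sym i≡2) 1∈2)))) 1∉3
        go (suc (suc (suc (suc n)))) eq = p-inj (fixed-4+ n (p i) eq)

    opaque
      p-trivial : ∀ i → p i ≡ i
      p-trivial i = go (toℕ i) refl
        where
        go : ∀ v → toℕ i ≡ v → p i ≡ i
        go 0 eq = fixed-0 i eq
        go 1 eq = fixed-1′ i eq
        go 2 eq = fixed-2 i eq
        go 3 i≡3 = go′ (toℕ (p i)) refl
          where
          go′ : ∀ v → toℕ (p i) ≡ v → p i ≡ i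
          go′ 0 eq = p-inj (fixed-0 (p i) eq)
          go′ 1 eq = p-inj (fixed-1′ (p i) eq)
          go′ 2 eq = p-inj (fixed-2 (p i) eq)
          go′ 3 eq = same eq i≡3
          go′ (suc (suc (suc (suc n)))) eq = p-inj (fixed-4+ n (p i) eq)
        go (suc (suc (suc (suc n)))) eq = fixed-4+ n i eq

-- The base given by the altered band matrix

module BandBase (α b : ℕ) .{{_ : NonZero b}} (h2 : 6 + α + α ≤ b) (h8 : 8 ≤ b) where

  open Cyclic b
  open Band α b h2 h8

  a = 3 + α

  -- The altered matrix arises from the band matrix by the involution swap of its ones, the t-th one of
  -- row r being (r , t): it exchanges (0 , 1) with (2 , 1 + α) and (0 , 2) with (3 , 1 + α).
  swap : ℕ → ℕ → ℕ × ℕ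
  swap 0 1 = 2 , 1 + α
  swap 0 2 = 3 , 1 + α
  swap 0 t = 0 , t
  swap 2 t with t ℕ.≟ 1 + α
  ... | yes _ = 0 , 1
  ... | no _ = 2 , t
  swap 3 t with t ℕ.≟ 1 + α
  ... | yes _ = 0 , 2
  ... | no _ = 3 , t
  swap r t = r , t

  swap-2 : swap 2 (1 + α) ≡ (0 , 1)
  swap-2 with 1 + α ℕ.≟ 1 + α
  ... | yes _ = refl
  ... | no ≢ = contradiction refl ≢

  swap-3 : swap 3 (1 + α) ≡ (0 , 2)
  swap-3 with 1 + α ℕ.≟ 1 + α
  ... | yes _ = refl
  ... | no ≢ = contradiction refl ≢

  swap-involutive : ∀ r t → swap (proj₁ (swap r t)) (proj₂ (swap r t)) ≡ (r , t)
  swap-involutive 0 0 = refl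
  swap-involutive 0 1 = swap-2
  swap-involutive 0 2 = swap-3
  swap-involutive 0 (suc (suc (suc t))) = refl
  swap-involutive 1 t = refl
  swap-involutive 2 t with t ℕ.≟ 1 + α in eq
  ... | yes refl = refl
  ... | no _ rewrite eq = refl
  swap-involutive 3 t with t ℕ.≟ 1 + α in eq
  ... | yes refl = refl
  ... | no _ rewrite eq = refl
  swap-involutive (suc (suc (suc (suc n)))) t = refl

  swap-bounds : ∀ r t → r < b → t < 3 + α → proj₁ (swap r t) < b × proj₂ (swap r t) < 3 + α
  swap-bounds 0 0 r<b t<a = r<b , t<a
  swap-bounds 0 1 r<b t<a = ℕ.≤-trans (s≤s (s≤s (s≤s z≤n))) h8 , ℕ.n≤1+n _
  swap-bounds 0 2 r<b t<a = ℕ.≤-trans (s≤s (s≤s (s≤s (s≤s z≤n)))) h8 , ℕ.n≤1+n _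
  swap-bounds 0 (suc (suc (suc t))) r<b t<a = r<b , t<a
  swap-bounds 1 t r<b t<a = r<b , t<a
  swap-bounds 2 t r<b t<a with t ℕ.≟ 1 + α
  ... | yes _ = ℕ.≤-trans (s≤s z≤n) r<b , s≤s (s≤s z≤n)
  ... | no _ = r<b , t<a
  swap-bounds 3 t r<b t<a with t ℕ.≟ 1 + α
  ... | yes _ = ℕ.≤-trans (s≤s z≤n) r<b , s≤s (s≤s (s≤s z≤n))
  ... | no _ = r<b , t<a
  swap-bounds (suc (suc (suc (suc n)))) t r<b t<a = r<b , t<a

  -- The entry `(r , t)` of the band matrix lies in column r + t, so the `t`-th entry of an altered
  -- row lies in the column of its partner under `swap`.
  column : ℕ → ℕ → ℕ
  column r t = proj₁ (swap r t) + proj₂ (swap r t)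

  column-row : ∀ r t → t < 3 + α → Row r (column r t)
  column-row 0 0 _ = inj₁ refl
  column-row 0 1 _ = inj₂ (s≤s (s≤s (s≤s z≤n)) , ℕ.n≤1+n _)
  column-row 0 2 _ = inj₂ (s≤s (s≤s (s≤s z≤n)) , ℕ.≤-refl)
  column-row 0 (suc (suc (suc t))) p = inj₂ (s≤s (s≤s (s≤s z≤n)) , ℕ.<⇒≤ (ℕ.<-trans p (ℕ.n<1+n _)))
  column-row 1 t p = s≤s z≤n , p
  column-row 2 t p with t ℕ.≟ 1 + α
  ... | yes _ = inj₁ (s≤s z≤n , s≤s z≤n)
  ... | no t≢ with t ℕ.≤? α
  ...   | yes q = inj₁ (s≤s z≤n , s≤s (s≤s q))
  ...   | no q = inj₂ (cong (2 +_) (ℕ.≤-antisym (ℕ.≤-pred p) (ℕ.≤∧≢⇒< (ℕ.≰⇒> q) (λ eq → t≢ (sym eq)))))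
  column-row 3 t p with t ℕ.≟ 1 + α
  ... | yes _ = inj₁ (s≤s (s≤s z≤n) , s≤s (s≤s z≤n))
  ... | no t≢ with t ℕ.≤? α
  ...   | yes q = inj₁ (s≤s (s≤s z≤n) , s≤s (s≤s (s≤s q)))
  ...   | no q = inj₂ (cong (3 +_) (ℕ.≤-antisym (ℕ.≤-pred p) (ℕ.≤∧≢⇒< (ℕ.≰⇒> q) (λ eq → t≢ (sym eq)))))
  column-row (suc (suc (suc (suc n)))) t p = ℕ.m≤m+n (4 + n) t , upper t p
    where
    upper : ∀ t → t < 3 + α → 4 + n + t ≤ 6 + α + n
    upper t p = (lin (λ neg → neg & p) 0 (solve (n ∷ t ∷ α ∷ [])))

  row-column : ∀ r x → Row r x → ∃ λ t → t < 3 + α × column r t ≡ x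
  row-column 0 x (inj₁ refl) = 0 , s≤s z≤n , refl
  row-column 0 (suc (suc (suc x))) (inj₂ (p , q)) with ℕ.<-cmp x α
  ... | tri< x<α _ _ = 3 + x , s≤s (s≤s (s≤s x<α)) , refl
  ... | tri≈ _ refl _ = 1 , s≤s (s≤s z≤n) , refl
  ... | tri> _ _ α<x = 2 , s≤s (s≤s (s≤s z≤n)) , cong (3 +_) (ℕ.≤-antisym α<x (ℕ.≤-pred (ℕ.≤-pred (ℕ.≤-pred q))))
  row-column 0 1 (inj₂ (s≤s () , q))
  row-column 0 2 (inj₂ (s≤s (s≤s ()) , q))
  row-column 1 (suc x) (p , q) = x , q , refl
  row-column 2 1 (inj₁ (p , q)) = 1 + α , ℕ.n≤1+n _ , cong (λ y → proj₁ y + proj₂ y) swap-2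
  row-column 2 (suc (suc x)) (inj₁ (p , q)) = x , ℕ.≤-trans (ℕ.≤-pred q) (ℕ.≤-trans (ℕ.n≤1+n _) (ℕ.n≤1+n _)) , plain
    where
    plain : column 2 x ≡ 2 + x
    plain with x ℕ.≟ 1 + α
    ... | yes refl = contradiction (ℕ.≤-pred (ℕ.≤-pred q)) ℕ.1+n≰n
    ... | no _ = refl
  row-column 2 x (inj₂ refl) = 2 + α , ℕ.≤-refl , plain
    where
    plain : column 2 (2 + α) ≡ 4 + α
    plain with 2 + α ℕ.≟ 1 + α
    ... | yes eq = contradiction eq ℕ.1+n≢n
    ... | no _ = refl
  row-column 3 1 (inj₁ (s≤s () , q))
  row-column 3 2 (inj₁ (p , q)) = 1 + α , ℕ.n≤1+n _ , cong (λ y → proj₁ y + proj₂ y) swap-3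
  row-column 3 (suc (suc (suc x))) (inj₁ (p , q)) = x , s≤s (ℕ.≤-trans (ℕ.≤-pred (ℕ.≤-pred (ℕ.≤-pred q))) (ℕ.≤-trans (ℕ.n≤1+n _) (ℕ.n≤1+n _))) , plain
    where
    plain : column 3 x ≡ 3 + x
    plain with x ℕ.≟ 1 + α
    ... | yes refl = contradiction (ℕ.≤-pred (ℕ.≤-pred (ℕ.≤-pred q))) ℕ.1+n≰n
    ... | no _ = refl
  row-column 3 x (inj₂ refl) = 2 + α , ℕ.≤-refl , plain
    where
    plain : column 3 (2 + α) ≡ 5 + α
    plain with 2 + α ℕ.≟ 1 + α
    ... | yes eq = contradiction eq ℕ.1+n≢n
    ... | no _ = refl
  row-column (suc (suc (suc (suc n)))) x (p , q) with ℕ.m≤n⇒∃[o]m+o≡n p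
  ... | o , refl = o , (lin (λ neg → neg & q) 0 (solve (n ∷ o ∷ α ∷ []))) , refl

  column-injective : ∀ r {t u} → t < 3 + α → u < 3 + α → column r t ≡ column r u → t ≡ u
  column-injective 0 {0} {0} p q eq = refl
  column-injective 0 {0} {1} p q ()
  column-injective 0 {1} {0} p q ()
  column-injective 0 {0} {2} p q ()
  column-injective 0 {2} {0} p q ()
  column-injective 0 {0} {suc (suc (suc u))} p q ()
  column-injective 0 {suc (suc (suc u))} {0} p q ()
  column-injective 0 {1} {1} p q eq = refl
  column-injective 0 {1} {2} p q eq = contradiction (sym eq) ℕ.1+n≢n
  column-injective 0 {1} {suc (suc (suc u))} p q refl = contradiction q (ℕ.<-irrefl refl)
  column-injective 0 {2} {1} p q eq = contradiction eq ℕ.1+n≢n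
  column-injective 0 {2} {2} p q eq = refl
  column-injective 0 {2} {suc (suc (suc u))} p q refl = contradiction q (ℕ.≤⇒≯ (ℕ.≤-trans (ℕ.n≤1+n _) (ℕ.≤-reflexive refl)))
  column-injective 0 {suc (suc (suc t))} {1} p q refl = contradiction p (ℕ.<-irrefl refl)
  column-injective 0 {suc (suc (suc t))} {2} p q refl = contradiction p (ℕ.≤⇒≯ (ℕ.≤-trans (ℕ.n≤1+n _) (ℕ.≤-reflexive refl)))
  column-injective 0 {suc (suc (suc t))} {suc (suc (suc u))} p q eq = eq
  column-injective 1 p q eq = ℕ.suc-injective eq
  column-injective 2 {t} {u} p q eq with t ℕ.≟ 1 + α | u ℕ.≟ 1 + α
  ... | yes t≡ | yes u≡ = trans t≡ (sym u≡)
  ... | no _ | no _ = ℕ.suc-injective (ℕ.suc-injective eq)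
  column-injective 2 {t} {u} p q () | yes _ | no _
  column-injective 2 {t} {u} p q () | no _ | yes _
  column-injective 3 {t} {u} p q eq with t ℕ.≟ 1 + α | u ℕ.≟ 1 + α
  ... | yes t≡ | yes u≡ = trans t≡ (sym u≡)
  ... | no _ | no _ = ℕ.suc-injective (ℕ.suc-injective (ℕ.suc-injective eq))
  column-injective 3 {t} {u} p q () | yes _ | no _
  column-injective 3 {t} {u} p q () | no _ | yes _
  column-injective (suc (suc (suc (suc n)))) p q eq = ℕ.+-cancelˡ-≡ (4 + n) _ _ eq

  start : ℕ → ℕ
  start 0 = 0
  start 1 = 1
  start 2 = 1
  start 3 = 2
  start (suc (suc (suc (suc n)))) = 4 + n

  -- Consequently distinct columns of a row remain distinct modulo `b`.
  row-range : ∀ r x → Row r x → start r ≤ x × x < start r + b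
  row-range 0 x (inj₁ refl) = z≤n , (lin (λ neg → neg & h8) 7 (solve (b ∷ α ∷ [])))
  row-range 0 x (inj₂ (p , q)) = z≤n , (lin (λ neg → neg & h2 & q) (1 + α) (solve (b ∷ x ∷ α ∷ [])))
  row-range 1 x (p , q) = p , (lin (λ neg → neg & h2 & q) (3 + α) (solve (b ∷ x ∷ α ∷ [])))
  row-range 2 x (inj₁ (p , q)) = p , (lin (λ neg → neg & h2 & q) (4 + α) (solve (b ∷ x ∷ α ∷ [])))
  row-range 2 x (inj₂ refl) = s≤s z≤n , (lin (λ neg → neg & h2) (2 + α) (solve (b ∷ α ∷ [])))
  row-range 3 x (inj₁ (p , q)) = p , (lin (λ neg → neg & h2 & q) (4 + α) (solve (b ∷ x ∷ α ∷ [])))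
  row-range 3 x (inj₂ refl) = s≤s (s≤s z≤n) , (lin (λ neg → neg & h2) (2 + α) (solve (b ∷ α ∷ [])))
  row-range (suc (suc (suc (suc n)))) x (p , q) = p , (lin (λ neg → neg & h2 & q) (3 + α) (solve (b ∷ n ∷ x ∷ α ∷ [])))

  residue-row : ∀ r x y → Row r x → Row r y → residue x ≡ residue y → x ≡ y
  residue-row r x y rx ry eq with row-range r x rx | row-range r y ry | ℕ.<-cmp x y
  ... | _ | _ | tri≈ _ x≡y _ = x≡y
  ... | lo , _ | _ , hi | tri< x<y _ _ = contradiction eq (residue-distinct x<y (ℕ.<-≤-trans hi (ℕ.+-monoˡ-≤ b lo)))
  ... | _ , hi | lo , _ | tri> _ _ y<x = contradiction (sym eq) (residue-distinct y<x (ℕ.<-≤-trans hi (ℕ.+-monoˡ-≤ b lo)))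

  residue-cancel : ∀ t {r r′} → r < b → r′ < b → residue (r + t) ≡ residue (r′ + t) → r ≡ r′
  residue-cancel t {r} {r′} r<b r′<b eq with ℕ.<-cmp r r′
  ... | tri≈ _ r≡r′ _ = r≡r′
  ... | tri< r<r′ _ _ = contradiction eq (residue-distinct (ℕ.+-monoˡ-< t r<r′) (lin (λ neg → neg & (r′<b)) r (solve (b ∷ r ∷ r′ ∷ t ∷ []))))
  ... | tri> _ _ r′<r = contradiction (sym eq) (residue-distinct (ℕ.+-monoˡ-< t r′<r) (lin (λ neg → neg & (r<b)) (r′) (solve (b ∷ r ∷ r′ ∷ t ∷ []))))

  X = Fin a × Fin b

  F : Fin 2 → X → Fin b
  F zero (t , i) = i
  F (suc zero) (t , i) = residue (column (toℕ i) (toℕ t))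

  bounds : ∀ x → proj₁ (swap (toℕ (proj₂ x)) (toℕ (proj₁ x))) < b × proj₂ (swap (toℕ (proj₂ x)) (toℕ (proj₁ x))) < 3 + α
  bounds (t , i) = swap-bounds (toℕ i) (toℕ t) (Fin.toℕ<n i) (Fin.toℕ<n t)

  ψ : Fin 2 → X → Fin a × Fin b
  ψ zero x = x
  ψ (suc zero) x = fromℕ< (proj₂ (bounds x)) , F (suc zero) x

  -- For the second partition, the position and the column of the swapped entry determine its row,
  -- and a second `swap` recovers the original entry.
  ψ-injective : ∀ l → Injective _≡_ _≡_ (ψ l)
  ψ-injective zero eq = eq
  ψ-injective (suc zero) {x@(t , i)} {y@(u , j)} eq = unswap (trans (sym (swap-involutive (toℕ i) (toℕ t)))
      (trans (cong₂ swap same-row same-class) (swap-involutive (toℕ j) (toℕ u))))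
    where
    same-class : proj₂ (swap (toℕ i) (toℕ t)) ≡ proj₂ (swap (toℕ j) (toℕ u))
    same-class = trans (sym (Fin.toℕ-fromℕ< (proj₂ (bounds x)))) (trans (cong (λ z → toℕ (proj₁ z)) eq) (Fin.toℕ-fromℕ< (proj₂ (bounds y))))
    same-row : proj₁ (swap (toℕ i) (toℕ t)) ≡ proj₁ (swap (toℕ j) (toℕ u))
    same-row = residue-cancel (proj₂ (swap (toℕ i) (toℕ t))) (proj₁ (bounds x)) (proj₁ (bounds y))
      (trans (cong proj₂ eq) (cong (λ c → residue (proj₁ (swap (toℕ j) (toℕ u)) + c)) (sym same-class)))
    unswap : (toℕ i , toℕ t) ≡ (toℕ j , toℕ u) → (t , i) ≡ (u , j)
    unswap p = cong₂ _,_ (Fin.toℕ-injective (cong proj₂ p)) (Fin.toℕ-injective (cong proj₁ p))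

  ψF : ∀ l x → proj₂ (ψ l x) ≡ F l x
  ψF zero x = refl
  ψF (suc zero) x = refl

  F-injective : ∀ {x y} → (∀ l → F l x ≡ F l y) → x ≡ y
  F-injective {t , i} {u , j} eq with eq zero
  ... | refl = cong (_, i) (Fin.toℕ-injective (column-injective (toℕ i) (Fin.toℕ<n t) (Fin.toℕ<n u)
    (residue-row (toℕ i) _ _ (column-row (toℕ i) (toℕ t) (Fin.toℕ<n t)) (column-row (toℕ i) (toℕ u) (Fin.toℕ<n u)) (eq (suc zero)))))

  point : ∀ {i c} → In (toℕ i) c → ∃ λ t → F (suc zero) (t , i) ≡ c
  point {i} (x , row , eq) with row-column (toℕ i) x row
  ... | t , t<a , eq′ = fromℕ< t<a , trans (cong (λ t → residue (column (toℕ i) t)) (Fin.toℕ-fromℕ< t<a)) (trans (cong residue eq′) eq)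

  in-row : ∀ t i → In (toℕ i) (F (suc zero) (t , i))
  in-row t i = column (toℕ i) (toℕ t) , column-row (toℕ i) (toℕ t) (Fin.toℕ<n t) , refl

  base : HasBaseOfSize a b 2
  base = base-if-rigid (s≤s z≤n) F-injective rigid
    where
    open Construct {X} {2} {a} {b} (×↔* (↔-id _)) F ψ ψ-injective ψF
    8+β≡b : ∃ λ β → 8 + β ≡ b
    8+β≡b = ℕ.m≤n⇒∃[o]m+o≡n h8
    rigid : (π : Fin 2 → Fin b → Fin b) → (∀ l → Injective _≡_ _≡_ (π l)) → (s t : X → X) →
      (∀ l x → F l (s x) ≡ π l (F l x)) → (∀ l x → π l (F l (t x)) ≡ F l x) → ∀ l j → π l j ≡ j
    rigid π π-inj s t sπ tπ = λ { zero → p-trivial p q p-inj q-inj preserve reflect ; (suc zero) → q-trivial p q p-inj q-inj preserve reflect }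
      where
      p = π zero
      q = π (suc zero)
      p-inj : Injective _≡_ _≡_ p
      p-inj = π-inj zero
      q-inj : Injective _≡_ _≡_ q
      q-inj = π-inj (suc zero)
      open BandSymmetry α b (proj₁ 8+β≡b) h2 h8 (ℕ.≤-reflexive (sym (proj₂ 8+β≡b))) (ℕ.≤-reflexive (proj₂ 8+β≡b))
      preserve : ∀ {i c} → In (toℕ i) c → In (toℕ (p i)) (q c)
      preserve {i} {c} c∈ with point {i} c∈
      ... | t₀ , refl = subst (λ c → In (toℕ (p i)) c) (sπ (suc zero) (t₀ , i))
        (subst (λ j → In (toℕ j) (F (suc zero) (s (t₀ , i)))) (sπ zero (t₀ , i)) (in-row (proj₁ (s (t₀ , i))) (proj₂ (s (t₀ , i)))))
      reflect : ∀ {i c} → In (toℕ (p i)) (q c) → In (toℕ i) c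
      reflect {i} {c} c∈ with point {p i} c∈
      ... | t₀ , eq = subst (λ c → In (toℕ i) c) (q-inj (trans (tπ (suc zero) (t₀ , p i)) eq))
        (subst (λ j → In (toℕ j) (F (suc zero) (t (t₀ , p i)))) (p-inj (tπ zero (t₀ , p i))) (in-row (proj₁ (t (t₀ , p i))) (proj₂ (t (t₀ , p i)))))

band-base : ∀ a b → 3 ≤ a → a + a ≤ b → 8 ≤ b → HasBaseOfSize a b 2
band-base (suc (suc (suc α))) b _ 2a≤b 8≤b = BandBase.base α b {{>-nonZero (ℕ.≤-trans (s≤s z≤n) 8≤b)}} (lin (λ neg → neg & (2a≤b)) 0 (solve (b ∷ α ∷ []))) 8≤b
band-base 1 b (s≤s ()) _ _
band-base 2 b (s≤s (s≤s ())) _ _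

-- The band construction wants rows with at most half of the columns; otherwise the complement has
-- such rows.
two-partitions : ∀ a b → 3 ≤ a → a + 3 ≤ b → 8 ≤ b → HasBaseOfSize a b 2
two-partitions a b 3≤a a+3≤b 8≤b with a + a ℕ.≤? b
... | yes 2a≤b = band-base a b 3≤a 2a≤b 8≤b
... | no 2a≰b = complement (ℕ.≤-trans (s≤s z≤n) 3≤c) (ℕ.≤-trans (s≤s z≤n) 3≤a) (trans c+a (sym (ℕ.*-identityʳ b))) (band-base c b 3≤c 2c≤b 8≤b)
  where
  c = b ∸ a
  c+a : c + a ≡ b
  c+a = ℕ.m∸n+n≡m (ℕ.m+n≤o⇒m≤o a a+3≤b)
  3≤c : 3 ≤ c
  3≤c = ℕ.+-cancelˡ-≤ a 3 c (ℕ.≤-trans a+3≤b (ℕ.≤-reflexive (trans (sym c+a) (ℕ.+-comm c a))))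
  half : ∀ c → c + a ≡ b → c + c ≤ b
  half c eq = (lin (λ neg → neg & (ℕ.≰⇒> 2a≰b) & (ℕ.≤-reflexive eq) & (ℕ.≤-reflexive eq)) 1 (solve (a ∷ b ∷ c ∷ [])))
  2c≤b : c + c ≤ b
  2c≤b = half c c+a

-- Blocks of size two

module Matchings (b : ℕ) .{{_ : NonZero b}} (4≤b : 4 ≤ b) where

  open Cyclic b

  X = Fin 2 × Fin b

  pattern even i = zero , i
  pattern odd i = suc zero , i

  𝟐 : Fin b
  𝟐 = residue 2

  2≤b : 2 ≤ b
  2≤b = ℕ.≤-trans (s≤s (s≤s z≤n)) 4≤b

  toℕ-small : ∀ {x} → x < b → toℕ (residue x) ≡ x
  toℕ-small {x} x<b = trans (toℕ-residue x) (m<n⇒m%n≡m x<b)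

  𝟎⊕𝟏 : 𝟎 ⊕ 𝟏 ≡ 𝟏
  𝟎⊕𝟏 = trans (⊕-comm 𝟎 𝟏) (⊕-𝟎 𝟏)

  𝟏⊕𝟏 : 𝟏 ⊕ 𝟏 ≡ 𝟐
  𝟏⊕𝟏 = cong residue (cong₂ _+_ (toℕ-small 2≤b) (toℕ-small 2≤b))

  𝟎≢𝟏 : 𝟎 ≢ 𝟏
  𝟎≢𝟏 = residue≢ (s≤s z≤n) 2≤b

  𝟎≢𝟐 : 𝟎 ≢ 𝟐
  𝟎≢𝟐 = residue≢ (s≤s z≤n) (ℕ.≤-trans (s≤s (s≤s (s≤s z≤n))) 4≤b)

  𝟏≢𝟐 : 𝟏 ≢ 𝟐
  𝟏≢𝟐 = residue≢ (s≤s (s≤s z≤n)) (ℕ.≤-trans (s≤s (s≤s (s≤s z≤n))) 4≤b)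

  𝟏≢last : 𝟏 ≢ last
  𝟏≢last = residue≢last (ℕ.≤-trans (s≤s (s≤s (s≤s z≤n))) 4≤b)

  𝟐≢last : 𝟐 ≢ last
  𝟐≢last = residue≢last 4≤b

  next≢ : ∀ i → i ≢ i ⊕ 𝟏
  next≢ i eq = 𝟎≢𝟏 (⊕-cancelˡ i (trans (⊕-𝟎 i) eq))

  -- Numbering even i as 2i and odd i as 2i + 1, the three matchings of ℤ/2b are: {2i , 2i + 1}; {2i + 1 , 2i + 2};
  -- and the second one with its pairs on the six points −1, 0, …, 4 replaced by {0 , 1}, {2 , 4} and {3 , −1}.
  ψ : Fin 3 → X → Fin 2 × Fin b
  ψ zero x = x
  ψ (suc zero) (even i) = even i
  ψ (suc zero) (odd i) = odd (i ⊕ 𝟏)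
  ψ (suc (suc zero)) (even i) with i ≟ 𝟐
  ... | yes _ = odd 𝟏
  ... | no _ = even i
  ψ (suc (suc zero)) (odd i) with i ≟ 𝟎
  ... | yes _ = odd 𝟎
  ... | no _ with i ≟ last
  ...   | yes _ = even 𝟐
  ...   | no _ = odd (i ⊕ 𝟏)

  ψ-injective : ∀ l → Injective _≡_ _≡_ (ψ l)
  ψ-injective zero eq = eq
  ψ-injective (suc zero) {even i} {even j} eq = eq
  ψ-injective (suc zero) {even i} {odd j} ()
  ψ-injective (suc zero) {odd i} {even j} ()
  ψ-injective (suc zero) {odd i} {odd j} eq = cong (λ i → odd i) (⊕-cancelʳ 𝟏 (cong proj₂ eq))
  ψ-injective (suc (suc zero)) {even i} {even j} eq with i ≟ 𝟐 | j ≟ 𝟐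
  ... | yes refl | yes refl = refl
  ... | no _ | no _ = eq
  ψ-injective (suc (suc zero)) {even i} {even j} () | yes _ | no _
  ψ-injective (suc (suc zero)) {even i} {even j} () | no _ | yes _
  ψ-injective (suc (suc zero)) {even i} {odd j} eq with i ≟ 𝟐 | j ≟ 𝟎
  ... | yes _ | yes _ = contradiction (sym (cong proj₂ eq)) 𝟎≢𝟏
  ... | yes _ | no j≢𝟎 with j ≟ last
  ...   | no _ = contradiction (⊕-cancelʳ 𝟏 (trans (sym (cong proj₂ eq)) (sym 𝟎⊕𝟏))) j≢𝟎
  ψ-injective (suc (suc zero)) {even i} {odd j} eq | no i≢𝟐 | no _ with j ≟ last
  ...   | yes _ = contradiction (cong proj₂ eq) i≢𝟐
  ψ-injective (suc (suc zero)) {odd i} {even j} eq with i ≟ 𝟎 | j ≟ 𝟐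
  ... | yes _ | yes _ = contradiction (cong proj₂ eq) 𝟎≢𝟏
  ... | no i≢𝟎 | yes _ with i ≟ last
  ...   | no _ = contradiction (⊕-cancelʳ 𝟏 (trans (cong proj₂ eq) (sym 𝟎⊕𝟏))) i≢𝟎
  ψ-injective (suc (suc zero)) {odd i} {even j} eq | no _ | no j≢𝟐 with i ≟ last
  ...   | yes _ = contradiction (sym (cong proj₂ eq)) j≢𝟐
  ψ-injective (suc (suc zero)) {odd i} {odd j} eq with i ≟ 𝟎 | j ≟ 𝟎
  ... | yes refl | yes refl = refl
  ... | yes _ | no _ with j ≟ last
  ...   | no j≢ = contradiction (⊕-cancelʳ 𝟏 (trans (sym (cong proj₂ eq)) (sym (last⊕𝟏 2≤b)))) j≢
  ψ-injective (suc (suc zero)) {odd i} {odd j} eq | no _ | yes _ with i ≟ last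
  ...   | no i≢ = contradiction (⊕-cancelʳ 𝟏 (trans (cong proj₂ eq) (sym (last⊕𝟏 2≤b)))) i≢
  ψ-injective (suc (suc zero)) {odd i} {odd j} eq | no _ | no _ with i ≟ last | j ≟ last
  ...   | yes refl | yes refl = refl
  ...   | no _ | no _ = cong (λ i → odd i) (⊕-cancelʳ 𝟏 (cong proj₂ eq))

  F : Fin 3 → X → Fin b
  F l x = proj₂ (ψ l x)

  mate₀-even : ∀ {x i} → F zero x ≡ i → x ≢ even i → x ≡ odd i
  mate₀-even {even i} refl x≢ = contradiction refl x≢
  mate₀-even {odd i} refl _ = refl

  mate₀-odd : ∀ {x i} → F zero x ≡ i → x ≢ odd i → x ≡ even i
  mate₀-odd {even i} refl _ = refl
  mate₀-odd {odd i} refl x≢ = contradiction refl x≢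

  mate₁-odd : ∀ {x i} → F (suc zero) x ≡ i ⊕ 𝟏 → x ≢ odd i → x ≡ even (i ⊕ 𝟏)
  mate₁-odd {even j} refl _ = refl
  mate₁-odd {odd j} eq x≢ = contradiction (cong (λ i → odd i) (⊕-cancelʳ 𝟏 eq)) x≢

  mate₁-even : ∀ {x i} → F (suc zero) x ≡ i ⊕ 𝟏 → x ≢ even (i ⊕ 𝟏) → x ≡ odd i
  mate₁-even {even j} refl x≢ = contradiction refl x≢
  mate₁-even {odd j} eq _ = cong (λ i → odd i) (⊕-cancelʳ 𝟏 eq)

  F₂-odd-𝟎 : F (suc (suc zero)) (odd 𝟎) ≡ 𝟎
  F₂-odd-𝟎 with 𝟎 ≟ 𝟎
  ... | yes _ = refl
  ... | no ≢ = contradiction refl ≢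

  F₂-even-𝟎 : F (suc (suc zero)) (even 𝟎) ≡ 𝟎
  F₂-even-𝟎 with 𝟎 ≟ 𝟐
  ... | yes eq = contradiction eq 𝟎≢𝟐
  ... | no _ = refl

  F₂-even-𝟏 : F (suc (suc zero)) (even 𝟏) ≡ 𝟏
  F₂-even-𝟏 with 𝟏 ≟ 𝟐
  ... | yes eq = contradiction eq 𝟏≢𝟐
  ... | no _ = refl

  F₂-odd-𝟏 : F (suc (suc zero)) (odd 𝟏) ≡ 𝟐
  F₂-odd-𝟏 with 𝟏 ≟ 𝟎
  ... | yes eq = contradiction (sym eq) 𝟎≢𝟏
  ... | no _ with 𝟏 ≟ last
  ...   | yes eq = contradiction eq 𝟏≢last
  ...   | no _ = 𝟏⊕𝟏

  F₂-odd-last : F (suc (suc zero)) (odd last) ≡ 𝟐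
  F₂-odd-last with last ≟ 𝟎
  ... | yes eq = contradiction (sym eq) (residue≢last 2≤b)
  ... | no _ with last ≟ last
  ...   | yes _ = refl
  ...   | no ≢ = contradiction refl ≢

  mate₂ : ∀ {x} → F (suc (suc zero)) x ≡ 𝟏 → x ≢ even 𝟏 → x ≡ even 𝟐
  mate₂ {even i} eq x≢ with i ≟ 𝟐
  ... | yes refl = refl
  ... | no _ = contradiction (cong (λ i → even i) eq) x≢
  mate₂ {odd i} eq x≢ with i ≟ 𝟎
  ... | yes _ = contradiction eq 𝟎≢𝟏
  ... | no i≢𝟎 with i ≟ last
  ...   | yes _ = contradiction (sym eq) 𝟏≢𝟐
  ...   | no _ = contradiction (⊕-cancelʳ 𝟏 (trans eq (sym 𝟎⊕𝟏))) i≢𝟎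

  shared : ∀ i → F (suc (suc zero)) (even i) ≡ F (suc (suc zero)) (odd i) → i ≡ 𝟎
  shared i eq with i ≟ 𝟎
  ... | yes i≡𝟎 = i≡𝟎
  ... | no i≢𝟎 with i ≟ 𝟐 | i ≟ last
  ...   | yes p | yes q = contradiction (trans (sym p) q) 𝟐≢last
  ...   | yes _ | no _ = contradiction (⊕-cancelʳ 𝟏 (trans (sym eq) (sym 𝟎⊕𝟏))) i≢𝟎
  ...   | no i≢𝟐 | yes _ = contradiction eq i≢𝟐
  ...   | no _ | no _ = contradiction eq (next≢ i)

  -- As this is the only pair common to the first and the third matching, every symmetry fixes its
  -- two points or exchanges them.
  shared-pair : ∀ {x y} → x ≢ y → F zero x ≡ F zero y → F (suc (suc zero)) x ≡ F (suc (suc zero)) y →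
    (x ≡ even 𝟎 × y ≡ odd 𝟎) ⊎ (x ≡ odd 𝟎 × y ≡ even 𝟎)
  shared-pair {even i} {even .i} x≢y refl _ = contradiction refl x≢y
  shared-pair {odd i} {odd .i} x≢y refl _ = contradiction refl x≢y
  shared-pair {even i} {odd .i} _ refl eq with shared i eq
  ... | refl = inj₁ (refl , refl)
  shared-pair {odd i} {even .i} _ refl eq with shared i (sym eq)
  ... | refl = inj₂ (refl , refl)

  module _ (σ τ : X → X) (τσ : ∀ x → τ (σ x) ≡ x) (preserve : ∀ l x y → F l x ≡ F l y → F l (σ x) ≡ F l (σ y)) where

    σ-injective : ∀ {x y} → σ x ≡ σ y → x ≡ y
    σ-injective {x} {y} eq = trans (sym (τσ x)) (trans (cong τ eq) (τσ y))

    image : ∀ l {x y z} → F l x ≡ F l y → σ y ≡ z → F l (σ x) ≡ F l z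
    image l {x} {y} eq eq′ = trans (preserve l x y eq) (cong (F l) eq′)

    distinct : ∀ {x y z} → x ≢ y → σ y ≡ z → σ x ≢ z
    distinct x≢y eq eq′ = x≢y (σ-injective (trans eq′ (sym eq)))

    step : ∀ i → σ (even i) ≡ even i → σ (odd i) ≡ odd i
    step i eq = mate₀-even (image zero refl eq) (distinct (λ ()) eq)

    step′ : ∀ i → σ (odd i) ≡ odd i → σ (even (i ⊕ 𝟏)) ≡ even (i ⊕ 𝟏)
    step′ i eq = mate₁-odd (image (suc zero) refl eq) (distinct (λ ()) eq)

    -- The first two matchings form a single cycle through all points, along which fixedness
    -- propagates.
    from-𝟎 : σ (even 𝟎) ≡ even 𝟎 → ∀ i → σ (even i) ≡ even i
    from-𝟎 σ𝟎 i = go (toℕ i) i refl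
      where
      go : ∀ n i → toℕ i ≡ n → σ (even i) ≡ even i
      go zero i eq = subst (λ i → σ (even i) ≡ even i) (Fin.toℕ-injective (trans toℕ-𝟎 (sym eq))) σ𝟎
      go (suc n) i eq = subst (λ i → σ (even i) ≡ even i) next (step′ i′ (step i′ (go n i′ (Fin.toℕ-fromℕ< n<b))))
        where
        n+1<b : suc n < b
        n+1<b = subst (_< b) eq (Fin.toℕ<n i)
        n<b : n < b
        n<b = ℕ.<⇒≤ n+1<b
        i′ : Fin b
        i′ = fromℕ< n<b
        next : i′ ⊕ 𝟏 ≡ i
        next = Fin.toℕ-injective (trans (toℕ-next (subst (λ k → suc k < b) (sym (Fin.toℕ-fromℕ< n<b)) n+1<b))
          (trans (cong suc (Fin.toℕ-fromℕ< n<b)) (sym eq)))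

    -- In the numbering of ℤ/2b, sending 0 to 1 forces -1 ↦ 2 by the second matching, 3 ↦ 4 by the
    -- third, 4 ↦ 3 by the second and 5 ↦ 2 by the first. Hence 5 = -1, which happens for `b = 3`
    -- but not for `b ≥ 4`.
    not-exchanged : σ (even 𝟎) ≡ odd 𝟎 → ⊥
    not-exchanged eq = 𝟐≢last (cong proj₂ (σ-injective (trans σ-odd-𝟐 (sym σ-last))))
      where
      σ-last : σ (odd last) ≡ even 𝟏
      σ-last = trans (mate₁-odd {i = 𝟎} (image (suc zero) (last⊕𝟏 2≤b) eq) (distinct (λ ()) eq)) (cong (λ i → even i) 𝟎⊕𝟏)
      σ-odd-𝟏 : σ (odd 𝟏) ≡ even 𝟐
      σ-odd-𝟏 = mate₂ (trans (image (suc (suc zero)) (trans F₂-odd-𝟏 (sym F₂-odd-last)) σ-last) F₂-even-𝟏)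
        (distinct (λ p → 𝟏≢last (cong proj₂ p)) σ-last)
      σ-even-𝟐 : σ (even 𝟐) ≡ odd 𝟏
      σ-even-𝟐 = mate₁-even (trans (image (suc zero) (sym 𝟏⊕𝟏) σ-odd-𝟏) (sym 𝟏⊕𝟏))
        (λ p → distinct (λ ()) σ-odd-𝟏 (trans p (cong (λ i → even i) 𝟏⊕𝟏)))
      σ-odd-𝟐 : σ (odd 𝟐) ≡ even 𝟏
      σ-odd-𝟐 = mate₀-odd (image zero refl σ-even-𝟐) (distinct (λ ()) σ-even-𝟐)

    σ-trivial : ∀ x → σ x ≡ x
    σ-trivial with shared-pair {σ (even 𝟎)} {σ (odd 𝟎)} (λ eq → contradiction (σ-injective eq) λ ()) (preserve zero (even 𝟎) (odd 𝟎) refl)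
      (preserve (suc (suc zero)) (even 𝟎) (odd 𝟎) (trans F₂-even-𝟎 (sym F₂-odd-𝟎)))
    ... | inj₂ (eq , _) = ⊥-elim (not-exchanged eq)
    ... | inj₁ (eq , _) = λ { (even i) → from-𝟎 eq i ; (odd i) → step i (from-𝟎 eq i) }

  base : HasBaseOfSize 2 b 3
  base = base-if-no-symmetry λ σ τ τσ _ preserve → σ-trivial σ τ τσ preserve
    where open Construct (×↔* (↔-id _)) F ψ ψ-injective (λ _ _ → refl)

matchings-base : ∀ b → 4 ≤ b → HasBaseOfSize 2 b 3
matchings-base b 4≤b = Matchings.base b {{>-nonZero (ℕ.≤-trans (s≤s z≤n) 4≤b)}} 4≤b

-- Exhaustive search

allᵇ : ∀ {n} → (Fin n → Bool) → Bool
allᵇ {zero} p = true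
allᵇ {suc n} p = p zero ∧ allᵇ (λ i → p (suc i))

anyᵇ : ∀ {A : Set} → (A → Bool) → List A → Bool
anyᵇ p [] = false
anyᵇ p (x ∷ xs) = p x ∨ anyᵇ p xs

T-∧ : ∀ {x y} → T (x ∧ y) → T x × T y
T-∧ {true} t = tt , t

T-∨ : ∀ {x y} → T (x ∨ y) → T x ⊎ T y
T-∨ {true} t = inj₁ t
T-∨ {false} t = inj₂ t

T-or : ∀ {x y} → T (not x ∨ y) → T x → T y
T-or {true} t _ = t

T-does : ∀ {P : Set} (P? : Dec P) → T (does P?) → P
T-does (yes p) _ = p

does-T : ∀ {P : Set} (P? : Dec P) → P → T (does P?)
does-T (yes _) _ = tt
does-T (no ¬p) p = ¬p p

T-allᵇ : ∀ {n} (p : Fin n → Bool) → T (allᵇ p) → ∀ i → T (p i)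
T-allᵇ p t zero = proj₁ (T-∧ {p zero} t)
T-allᵇ p t (suc i) = T-allᵇ (λ i → p (suc i)) (proj₂ (T-∧ {p zero} t)) i

T-allᵇ⁻ : ∀ {n} (p : Fin n → Bool) → (∀ i → T (p i)) → T (allᵇ p)
T-allᵇ⁻ {zero} p t = tt
T-allᵇ⁻ {suc n} p t with p zero | t zero
... | true | _ = T-allᵇ⁻ (λ i → p (suc i)) (λ i → t (suc i))

T-anyᵇ : ∀ {A : Set} (p : A → Bool) xs → T (anyᵇ p xs) → ∃ λ x → x ∈ xs × T (p x)
T-anyᵇ p (x ∷ xs) t with T-∨ {p x} t
... | inj₁ px = x , Any.here refl , px
... | inj₂ t′ = let y , y∈ , py = T-anyᵇ p xs t′ in y , Any.there y∈ , py

T-all : ∀ {A : Set} (f : A → Bool) xs → T (all f xs) → ∀ {x} → x ∈ xs → T (f x)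
T-all f (x ∷ xs) s (Any.here refl) = proj₁ (T-∧ {f x} s)
T-all f (x ∷ xs) s (Any.there x∈) = T-all f xs (proj₂ (T-∧ {f x} s)) x∈

graph : ∀ {m n} → (Fin m → Fin n) → List (Fin m) → List (Fin m × Fin n)
graph f = List.map (λ x → x , f x)

module _ {m n : ℕ} (compatible : Fin m × Fin n → Fin m × Fin n → Bool) where

  -- Backtracking over the graphs of all maps: a branch is cut when the new pair is incompatible
  -- with itself or with an earlier pair, and `leaf` must hold for each graph that survives.
  exhaust : (List (Fin m × Fin n) → Bool) → List (Fin m × Fin n) → List (Fin m) → Bool
  exhaust leaf pairs [] = leaf pairs
  exhaust leaf pairs (x ∷ xs) = allᵇ λ y → not (all (compatible (x , y)) ((x , y) ∷ pairs)) ∨ exhaust leaf ((x , y) ∷ pairs) xs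

  module _ (f : Fin m → Fin n) (ok : ∀ x u → T (compatible (x , f x) (u , f u))) where

    private
      compatible-graph : ∀ x xs → T (all (compatible (x , f x)) (graph f xs))
      compatible-graph x [] = tt
      compatible-graph x (u ∷ xs) with compatible (x , f x) (u , f u) | ok x u
      ... | true | _ = compatible-graph x xs

    -- The branch that follows `f` itself is never cut. Pairs are added in front, so the final graph
    -- lists the points in reverse order; `points` is that order.
    exhaust-sound : ∀ leaf done xs → T (exhaust leaf (graph f done) xs) → T (leaf (graph f (xs List.ʳ++ done)))
    exhaust-sound leaf done [] t = t
    exhaust-sound leaf done (x ∷ xs) t = exhaust-sound leaf (x ∷ done) xs
      (T-or {all (compatible (x , f x)) (graph f (x ∷ done))}
        (T-allᵇ (λ y → not (all (compatible (x , y)) ((x , y) ∷ graph f done)) ∨ exhaust leaf ((x , y) ∷ graph f done) xs) t (f x))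
        (compatible-graph x (x ∷ done)))

∈-ʳ++ : ∀ {A : Set} {x : A} xs {ys} → x ∈ xs ⊎ x ∈ ys → x ∈ (xs List.ʳ++ ys)
∈-ʳ++ [] (inj₂ x∈) = x∈
∈-ʳ++ (y ∷ xs) (inj₁ (Any.here eq)) = ∈-ʳ++ xs (inj₂ (Any.here eq))
∈-ʳ++ (y ∷ xs) (inj₁ (Any.there x∈)) = ∈-ʳ++ xs (inj₁ x∈)
∈-ʳ++ (y ∷ xs) (inj₂ x∈) = ∈-ʳ++ xs (inj₂ (Any.there x∈))

points : ∀ n → List (Fin n)
points n = allFin n List.ʳ++ []

∈-points : ∀ {n} (x : Fin n) → x ∈ points n
∈-points {n} x = ∈-ʳ++ (allFin n) (inj₁ (∈.∈-allFin x))

-- Explicit bases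

module _ {k n b : ℕ} (f : Fin k → Fin n → Fin b) where

  same-blocks : Fin n × Fin n → Fin n × Fin n → Bool
  same-blocks (x , y) (u , v) = allᵇ λ l → if does (f l x ≟ f l u) then does (f l y ≟ f l v) else not (does (f l y ≟ f l v))

  only-identity : Bool
  only-identity = exhaust same-blocks (all λ (x , y) → does (x ≟ y)) [] (allFin n)

  module _ (σ : Fin n → Fin n) (preserve : ∀ l x u → f l x ≡ f l u → f l (σ x) ≡ f l (σ u))
    (reflect : ∀ l x u → f l (σ x) ≡ f l (σ u) → f l x ≡ f l u) where

    private
      same-blocks-ok : ∀ x u → T (same-blocks (x , σ x) (u , σ u))
      same-blocks-ok x u = T-allᵇ⁻ _ at
        where
        at : ∀ l → T (if does (f l x ≟ f l u) then does (f l (σ x) ≟ f l (σ u)) else not (does (f l (σ x) ≟ f l (σ u))))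
        at l with f l x ≟ f l u | f l (σ x) ≟ f l (σ u)
        ... | yes _ | yes _ = tt
        ... | yes p | no ¬q = ¬q (preserve l x u p)
        ... | no ¬p | yes q = ¬p (reflect l x u q)
        ... | no _ | no _ = tt

    only-identity-sound : T only-identity → ∀ x → σ x ≡ x
    only-identity-sound t x = sym (T-does (x ≟ σ x) (T-all (λ (x , y) → does (x ≟ y)) (graph σ (points n))
      (exhaust-sound same-blocks σ same-blocks-ok (all λ (x , y) → does (x ≟ y)) [] (allFin n) t) (∈.∈-map⁺ (λ x → x , σ x) (∈-points x))))

explicit-base : ∀ {k a b} (f : Fin k → Labelling a b) → (∀ l → IsRegular a b (f l)) → T (only-identity f) → HasBaseOfSize a b k
explicit-base f regular t = fromFamily (λ l → f l , regular l) λ σ fix →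
  only-identity-sound f (σ ⟨$⟩ʳ_) (λ l x u → proj₁ (fix l x u)) (λ l x u → proj₂ (fix l x u)) t

table : ∀ {k a b} → Vec (Vec (Fin b) (a * b)) k → Fin k → Labelling a b
table t l x = Vec.lookup (Vec.lookup t l) x

regular? : ∀ {k a b} (f : Fin k → Labelling a b) → Dec (∀ l → IsRegular a b (f l))
regular? {k} {a} {b} f = all? λ l → all? λ j → count (λ x → f l x ≟ j) ℕ.≟ a

-- The tables were found by computer search.
module _ where

  private
    infixr 5 _∷′_
    pattern _∷′_ x xs = Vec._∷_ x xs
    pattern []′ = Vec.[]
    pattern #0 = zero
    pattern #1 = suc zero
    pattern #2 = suc (suc zero)
    pattern #3 = suc (suc (suc zero))

  base-2-3 : HasBaseOfSize 2 3 4
  base-2-3 = explicit-base {4} {2} {3} f (toWitness {a? = regular? {4} {2} {3} f} tt) tt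
    where
    f : Fin 4 → Labelling 2 3
    f = table {4} {2} {3} ((#0 ∷′ #0 ∷′ #1 ∷′ #1 ∷′ #2 ∷′ #2 ∷′ []′)
      ∷′ (#0 ∷′ #0 ∷′ #1 ∷′ #2 ∷′ #1 ∷′ #2 ∷′ []′)
      ∷′ (#2 ∷′ #1 ∷′ #2 ∷′ #0 ∷′ #0 ∷′ #1 ∷′ []′)
      ∷′ (#2 ∷′ #0 ∷′ #2 ∷′ #0 ∷′ #1 ∷′ #1 ∷′ []′) ∷′ []′)

  base-4-3 : HasBaseOfSize 4 3 3
  base-4-3 = explicit-base {3} {4} {3} f (toWitness {a? = regular? {3} {4} {3} f} tt) tt
    where
    f : Fin 3 → Labelling 4 3
    f = table {3} {4} {3} ((#0 ∷′ #0 ∷′ #0 ∷′ #0 ∷′ #1 ∷′ #1 ∷′ #1 ∷′ #1 ∷′ #2 ∷′ #2 ∷′ #2 ∷′ #2 ∷′ []′)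
      ∷′ (#0 ∷′ #2 ∷′ #1 ∷′ #0 ∷′ #0 ∷′ #1 ∷′ #1 ∷′ #0 ∷′ #1 ∷′ #2 ∷′ #2 ∷′ #2 ∷′ []′)
      ∷′ (#1 ∷′ #1 ∷′ #2 ∷′ #0 ∷′ #1 ∷′ #2 ∷′ #0 ∷′ #2 ∷′ #0 ∷′ #2 ∷′ #0 ∷′ #1 ∷′ []′) ∷′ []′)

  base-6-4 : HasBaseOfSize 6 4 3
  base-6-4 = explicit-base {3} {6} {4} f (toWitness {a? = regular? {3} {6} {4} f} tt) tt
    where
    f : Fin 3 → Labelling 6 4
    f = table {3} {6} {4} ((#0 ∷′ #0 ∷′ #0 ∷′ #0 ∷′ #0 ∷′ #0 ∷′ #1 ∷′ #1 ∷′ #1 ∷′ #1 ∷′ #1 ∷′ #1 ∷′ #2 ∷′ #2 ∷′ #2 ∷′ #2 ∷′ #2 ∷′ #2 ∷′ #3 ∷′ #3 ∷′ #3 ∷′ #3 ∷′ #3 ∷′ #3 ∷′ []′)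
      ∷′ (#1 ∷′ #2 ∷′ #3 ∷′ #1 ∷′ #0 ∷′ #2 ∷′ #3 ∷′ #2 ∷′ #3 ∷′ #0 ∷′ #1 ∷′ #1 ∷′ #0 ∷′ #3 ∷′ #2 ∷′ #2 ∷′ #0 ∷′ #1 ∷′ #1 ∷′ #0 ∷′ #3 ∷′ #0 ∷′ #3 ∷′ #2 ∷′ []′)
      ∷′ (#3 ∷′ #3 ∷′ #3 ∷′ #1 ∷′ #2 ∷′ #2 ∷′ #1 ∷′ #0 ∷′ #3 ∷′ #1 ∷′ #0 ∷′ #2 ∷′ #3 ∷′ #0 ∷′ #1 ∷′ #0 ∷′ #2 ∷′ #2 ∷′ #1 ∷′ #0 ∷′ #1 ∷′ #2 ∷′ #0 ∷′ #3 ∷′ []′) ∷′ []′)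

-- Two blocks

pattern 0₂ = zero
pattern 1₂ = suc zero

infixl 6 _⊻_
_⊻_ : Fin 2 → Fin 2 → Fin 2
0₂ ⊻ y = y
1₂ ⊻ 0₂ = 1₂
1₂ ⊻ 1₂ = 0₂

⊻-identityʳ : ∀ x → x ⊻ 0₂ ≡ x
⊻-identityʳ 0₂ = refl
⊻-identityʳ 1₂ = refl

⊻-cancelʳ : ∀ {x y} z → x ⊻ z ≡ y ⊻ z → x ≡ y
⊻-cancelʳ {0₂} {0₂} _ _ = refl
⊻-cancelʳ {1₂} {1₂} _ _ = refl
⊻-cancelʳ {0₂} {1₂} 0₂ ()
⊻-cancelʳ {0₂} {1₂} 1₂ ()
⊻-cancelʳ {1₂} {0₂} 0₂ ()
⊻-cancelʳ {1₂} {0₂} 1₂ ()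

⊻-cancelˡ : ∀ {x y} z → z ⊻ x ≡ z ⊻ y → x ≡ y
⊻-cancelˡ 0₂ eq = eq
⊻-cancelˡ {0₂} {0₂} 1₂ _ = refl
⊻-cancelˡ {1₂} {1₂} 1₂ _ = refl
⊻-cancelˡ {0₂} {1₂} 1₂ ()
⊻-cancelˡ {1₂} {0₂} 1₂ ()

injective⇒translation : (π : Fin 2 → Fin 2) → Injective _≡_ _≡_ π → ∀ x → π x ≡ x ⊻ π 0₂
injective⇒translation π π-inj 0₂ = refl
injective⇒translation π π-inj 1₂ with π 0₂ in p | π 1₂ in q
... | 0₂ | 1₂ = refl
... | 1₂ | 0₂ = refl
... | 0₂ | 0₂ = contradiction (π-inj (trans p (sym q))) λ ()
... | 1₂ | 1₂ = contradiction (π-inj (trans p (sym q))) λ ()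

avoid-two : ∀ {M N} → M ≡ 2 + N → (o u : Fin M) → o ≢ u →
  ∃ λ (d : Fin N → Fin M) → (∀ {i j} → d i ≡ d j → i ≡ j) × (∀ i → d i ≢ o) × (∀ i → d i ≢ u)
avoid-two refl o u o≢u = (λ i → punchIn o (punchIn u′ i)) , (λ eq → Fin.punchIn-injective u′ _ _ (Fin.punchIn-injective o _ _ eq)) ,
  (λ i → Fin.punchInᵢ≢i o _) , λ i eq → Fin.punchInᵢ≢i u′ i (Fin.punchIn-injective o _ _ (trans eq (sym (Fin.punchIn-punchOut o≢u))))
  where u′ = punchOut o≢u

-- The codes form the union of the antipode-free plane {x | x₀ + x₁ + x₂ = 0, x₂ = x₃ = …}, containing 0, and of a
-- set of antipodal pairs. A translation preserving this set preserves the plane, so it is by a vector of the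
-- plane; such translations permute the four pairs whose last coordinates are given by u without fixed points,
-- so s = 1 or s = 3 of those four pairs are not mapped to themselves.
module Binary (k N s r : ℕ) (size : 2 ^ k ≡ 2 + N) (1≤k : 1 ≤ k) (S : Fin s → Fin 2 × Fin 2) (S-injective : ∀ {i j} → S i ≡ S j → i ≡ j)
  (S-moved : ∀ c i → (c , i) ≢ (0₂ , 0₂) → ∃ λ m → ∀ m′ → S m′ ≢ (proj₁ (S m) ⊻ c , proj₂ (S m) ⊻ (c ⊻ i)))
  (r≤ : r ≤ 4 * N) where

  zeros ones : Fin k → Fin 2
  zeros _ = 0₂
  ones _ = 1₂

  o u : Fin (2 ^ k)
  o = encode k 2 zeros
  u = encode k 2 ones

  o≢u : o ≢ u
  o≢u eq = contradiction (trans (sym (digit-encode k 2 zeros l)) (trans (cong (λ y → digit k 2 y l) eq) (digit-encode k 2 ones l))) λ ()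
    where
    l : Fin k
    l = fromℕ< 1≤k

  D : ∃ λ (d : Fin N → Fin (2 ^ k)) → (∀ {i j} → d i ≡ d j → i ≡ j) × (∀ i → d i ≢ o) × (∀ i → d i ≢ u)
  D = avoid-two size o u o≢u

  d = proj₁ D

  inject : Fin r → Fin (4 * N)
  inject i = fromℕ< (ℕ.<-≤-trans (Fin.toℕ<n i) r≤)

  inject-injective : ∀ {i j} → inject i ≡ inject j → i ≡ j
  inject-injective eq = Fin.toℕ-injective (trans (sym (Fin.toℕ-fromℕ< _)) (trans (cong toℕ eq) (Fin.toℕ-fromℕ< _)))

  other : Fin r → Fin 4 × Fin N
  other i = remQuot {4} N (inject i)

  other-injective : ∀ {i j} → other i ≡ other j → i ≡ j
  other-injective {i} {j} eq = inject-injective (trans (sym (Fin.combine-remQuot {4} N (inject i)))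
    (trans (cong (λ p → combine (proj₁ p) (proj₂ p)) eq) (Fin.combine-remQuot {4} N (inject j))))

  C = Fin 2 ⊎ (Fin s ⊎ Fin r)
  X = C × Fin 2
  a = 2 + (s + r)

  pattern plane c = inj₁ c
  pattern special m = inj₂ (inj₁ m)

  e : C ↔ Fin a
  e = ↔-sym Fin.+↔⊎ ↔-∘ (↔-id _ ⊎-↔ ↔-sym Fin.+↔⊎)

  E : Fin s ⊎ Fin r → (Fin 2 × Fin 2) × Fin (2 ^ k)
  E (inj₁ m) = S m , u
  E (inj₂ i) = remQuot {2} 2 (proj₁ (other i)) , d (proj₂ (other i))

  E-injective : ∀ {x y} → E x ≡ E y → x ≡ y
  E-injective {inj₁ m} {inj₁ m′} eq = cong inj₁ (S-injective (cong proj₁ eq))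
  E-injective {inj₁ m} {inj₂ i} eq = contradiction (sym (cong proj₂ eq)) (proj₂ (proj₂ (proj₂ D)) _)
  E-injective {inj₂ i} {inj₁ m} eq = contradiction (cong proj₂ eq) (proj₂ (proj₂ (proj₂ D)) _)
  E-injective {inj₂ i} {inj₂ j} eq = cong inj₂ (other-injective (cong₂ _,_
    (trans (sym (Fin.combine-remQuot {2} 2 (proj₁ (other i)))) (trans (cong (λ p → combine (proj₁ (proj₁ p)) (proj₂ (proj₁ p))) eq) (Fin.combine-remQuot {2} 2 (proj₁ (other j)))))
    (proj₁ (proj₂ D) (cong proj₂ eq))))

  E≢o : ∀ x → proj₂ (E x) ≢ o
  E≢o (inj₁ m) eq = o≢u (sym eq)
  E≢o (inj₂ i) eq = proj₁ (proj₂ (proj₂ D)) _ eq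

  F : Fin (3 + k) → X → Fin 2
  F zero (plane c , i) = c ⊻ i
  F (suc zero) (plane c , i) = c
  F (suc (suc l)) (plane c , i) = i
  F zero (inj₂ x , i) = proj₁ (proj₁ (E x)) ⊻ i
  F (suc zero) (inj₂ x , i) = proj₂ (proj₁ (E x)) ⊻ i
  F (suc (suc zero)) (inj₂ x , i) = i
  F (suc (suc (suc l))) (inj₂ x , i) = digit k 2 (proj₂ (E x)) l ⊻ i

  -- On the plane the second label is the class `c` itself, so there `i` takes over the role of the
  -- class.
  ψ′ : Fin (3 + k) → X → C × Fin 2
  ψ′ (suc zero) (plane c , i) = plane i , c
  ψ′ l (c , i) = c , F l (c , i)

  F-position : ∀ l x {i j} → F l (inj₂ x , i) ≡ F l (inj₂ x , j) → i ≡ j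
  F-position zero x eq = ⊻-cancelˡ _ eq
  F-position (suc zero) x eq = ⊻-cancelˡ _ eq
  F-position (suc (suc zero)) x eq = eq
  F-position (suc (suc (suc l))) x eq = ⊻-cancelˡ _ eq

  ψ′-injective : ∀ l → Injective _≡_ _≡_ (ψ′ l)
  ψ′-injective zero {plane c , i} {plane c′ , j} eq with ,-injectiveˡ eq
  ... | refl = cong (plane c ,_) (⊻-cancelˡ c (,-injectiveʳ eq))
  ψ′-injective (suc zero) {plane c , i} {plane c′ , j} refl = refl
  ψ′-injective (suc (suc l)) {plane c , i} {plane c′ , j} eq = eq
  ψ′-injective zero {inj₂ x , i} {inj₂ y , j} eq with ,-injectiveˡ eq
  ... | refl = cong (inj₂ x ,_) (F-position zero x (,-injectiveʳ eq))
  ψ′-injective (suc zero) {inj₂ x , i} {inj₂ y , j} eq with ,-injectiveˡ eq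
  ... | refl = cong (inj₂ x ,_) (F-position (suc zero) x (,-injectiveʳ eq))
  ψ′-injective (suc (suc l)) {inj₂ x , i} {inj₂ y , j} eq with ,-injectiveˡ eq
  ... | refl = cong (inj₂ x ,_) (F-position (suc (suc l)) x (,-injectiveʳ eq))
  ψ′-injective zero {plane _ , _} {inj₂ _ , _} ()
  ψ′-injective zero {inj₂ _ , _} {plane _ , _} ()
  ψ′-injective (suc zero) {plane _ , _} {inj₂ _ , _} ()
  ψ′-injective (suc zero) {inj₂ _ , _} {plane _ , _} ()
  ψ′-injective (suc (suc l)) {plane _ , _} {inj₂ _ , _} ()
  ψ′-injective (suc (suc l)) {inj₂ _ , _} {plane _ , _} ()

  ψ′F : ∀ l x → proj₂ (ψ′ l x) ≡ F l x
  ψ′F zero (c , i) = refl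
  ψ′F (suc zero) (plane c , i) = refl
  ψ′F (suc zero) (inj₂ x , i) = refl
  ψ′F (suc (suc l)) (c , i) = refl

  ψ : Fin (3 + k) → X → Fin a × Fin 2
  ψ l x = to e (proj₁ (ψ′ l x)) , proj₂ (ψ′ l x)

  ψ-injective : ∀ l → Injective _≡_ _≡_ (ψ l)
  ψ-injective l eq = ψ′-injective l (cong₂ _,_ (to-injective e (cong proj₁ eq)) (cong proj₂ eq))

  same-end : ∀ {x} {v : Fin 2} → (∀ l → digit k 2 (proj₂ (E x)) l ⊻ v ≡ v) → ⊥
  same-end {x} {v} eq = E≢o x (digit-injective k 2 λ l → trans (⊻-cancelʳ v (eq l)) (sym (digit-encode k 2 zeros l)))

  F-injective : ∀ {x y} → (∀ l → F l x ≡ F l y) → x ≡ y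
  F-injective {plane c , i} {plane c′ , j} eq = cong₂ (λ c i → plane c , i) (eq (suc zero)) (eq (suc (suc zero)))
  F-injective {plane c , i} {inj₂ y , j} eq = ⊥-elim (same-end {y} λ l → trans (sym (eq (suc (suc (suc l))))) (eq (suc (suc zero))))
  F-injective {inj₂ x , i} {plane c , j} eq = ⊥-elim (same-end {x} λ l → trans (eq (suc (suc (suc l)))) (sym (eq (suc (suc zero)))))
  F-injective {inj₂ x , i} {inj₂ y , j} eq with eq (suc (suc zero))
  ... | refl = cong (λ x → inj₂ x , i) (E-injective (cong₂ _,_ (cong₂ _,_ (⊻-cancelʳ i (eq zero)) (⊻-cancelʳ i (eq (suc zero))))
    (digit-injective k 2 λ l → ⊻-cancelʳ i (eq (suc (suc (suc l)))))))

  Antipodal : X → X → Set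
  Antipodal x y = ∀ l → F l y ≡ F l x ⊻ 1₂

  antipode : ∀ x i → Antipodal (inj₂ x , i) (inj₂ x , i ⊻ 1₂)
  antipode x i = λ { zero → assoc _ i ; (suc zero) → assoc _ i ; (suc (suc zero)) → refl ; (suc (suc (suc l))) → assoc _ i }
    where
    assoc : ∀ x y → x ⊻ (y ⊻ 1₂) ≡ x ⊻ y ⊻ 1₂
    assoc 0₂ _ = refl
    assoc 1₂ 0₂ = refl
    assoc 1₂ 1₂ = refl

  -- The first three coordinates have sum 0 on the plane, hence sum 1 in an antipode. Outside the
  -- plane the last `k` coordinates never all equal the third, and an antipode of a plane point
  -- would have them equal.
  no-antipode : ∀ {c i y} → ¬ Antipodal (plane c , i) y
  no-antipode {c} {i} {plane c′ , j} eq = odd c i c′ j (eq zero) (eq (suc zero)) (eq (suc (suc zero)))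
    where
    odd : ∀ c i c′ j → c′ ⊻ j ≡ c ⊻ i ⊻ 1₂ → c′ ≡ c ⊻ 1₂ → j ≡ i ⊻ 1₂ → ⊥
    odd 0₂ 0₂ _ _ () refl refl
    odd 0₂ 1₂ _ _ () refl refl
    odd 1₂ 0₂ _ _ () refl refl
    odd 1₂ 1₂ _ _ () refl refl
  no-antipode {c} {i} {inj₂ y , j} eq = same-end {y} {j} λ l → trans (eq (suc (suc (suc l)))) (sym (eq (suc (suc zero))))

  module Symmetry (π : Fin (3 + k) → Fin 2 → Fin 2) (π-inj : ∀ l → Injective _≡_ _≡_ (π l)) (s′ t : X → X)
    (sπ : ∀ l x → F l (s′ x) ≡ π l (F l x)) (tπ : ∀ l x → π l (F l (t x)) ≡ F l x) where

    translation : ∀ l x → π l x ≡ x ⊻ π l 0₂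
    translation l = injective⇒translation (π l) (π-inj l)

    s-plane : ∀ c i → ∃ λ c′ → ∃ λ i′ → s′ (plane c , i) ≡ (plane c′ , i′)
    s-plane c i with s′ (plane c , i) in eq
    ... | plane c′ , i′ = c′ , i′ , refl
    ... | inj₂ x , i′ = contradiction (λ l → π-inj l (begin
        π l (F l (t (inj₂ x , i′ ⊻ 1₂))) ≡⟨ tπ l (inj₂ x , i′ ⊻ 1₂) ⟩
        F l (inj₂ x , i′ ⊻ 1₂) ≡⟨ antipode x i′ l ⟩
        F l (inj₂ x , i′) ⊻ 1₂ ≡⟨ cong (λ y → F l y ⊻ 1₂) (sym eq) ⟩
        F l (s′ (plane c , i)) ⊻ 1₂ ≡⟨ cong (_⊻ 1₂) (trans (sπ l (plane c , i)) (translation l _)) ⟩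
        F l (plane c , i) ⊻ π l 0₂ ⊻ 1₂ ≡⟨ shuffle (F l (plane c , i)) (π l 0₂) ⟩
        F l (plane c , i) ⊻ 1₂ ⊻ π l 0₂ ≡⟨ sym (translation l _) ⟩
        π l (F l (plane c , i) ⊻ 1₂) ∎)) (no-antipode {c} {i} {t (inj₂ x , i′ ⊻ 1₂)})
      where
      open ≡-Reasoning
      shuffle : ∀ x y → x ⊻ y ⊻ 1₂ ≡ x ⊻ 1₂ ⊻ y
      shuffle 0₂ 0₂ = refl
      shuffle 0₂ 1₂ = refl
      shuffle 1₂ 0₂ = refl
      shuffle 1₂ 1₂ = refl

    c₀ = proj₁ (s-plane 0₂ 0₂)
    i₀ = proj₁ (proj₂ (s-plane 0₂ 0₂))

    π₀ : ∀ l → π l 0₂ ≡ F l (plane c₀ , i₀)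
    π₀ l = trans (cong (π l) (F₀ l)) (trans (sym (sπ l (plane 0₂ , 0₂))) (cong (F l) (proj₂ (proj₂ (s-plane 0₂ 0₂)))))
      where
      F₀ : ∀ l → 0₂ ≡ F l (plane 0₂ , 0₂)
      F₀ zero = refl
      F₀ (suc zero) = refl
      F₀ (suc (suc l)) = refl

    s-translation : ∀ l x → F l (s′ x) ≡ F l x ⊻ F l (plane c₀ , i₀)
    s-translation l x = trans (sπ l x) (trans (translation l (F l x)) (cong (F l x ⊻_) (π₀ l)))

    solve₀ : ∀ x p j j′ → x ⊻ j′ ≡ p ⊻ j ⊻ (c₀ ⊻ i₀) → j′ ≡ j ⊻ i₀ → x ≡ p ⊻ c₀
    solve₀ x p j j′ = toWitness {a? = all? λ c → all? λ i → all? λ x → all? λ p → all? λ j → all? λ j′ →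
      (x ⊻ j′ ≟ p ⊻ j ⊻ (c ⊻ i)) →-dec (j′ ≟ j ⊻ i) →-dec (x ≟ p ⊻ c)} tt c₀ i₀ x p j j′

    solve₁ : ∀ x p j j′ → x ⊻ j′ ≡ p ⊻ j ⊻ c₀ → j′ ≡ j ⊻ i₀ → x ≡ p ⊻ (c₀ ⊻ i₀)
    solve₁ x p j j′ = toWitness {a? = all? λ c → all? λ i → all? λ x → all? λ p → all? λ j → all? λ j′ →
      (x ⊻ j′ ≟ p ⊻ j ⊻ c) →-dec (j′ ≟ j ⊻ i) →-dec (x ≟ p ⊻ (c ⊻ i))} tt c₀ i₀ x p j j′

    solve₂ : ∀ x p j j′ → x ⊻ j′ ≡ p ⊻ j ⊻ i₀ → j′ ≡ j ⊻ i₀ → x ≡ p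
    solve₂ x p j j′ = toWitness {a? = all? λ i → all? λ x → all? λ p → all? λ j → all? λ j′ →
      (x ⊻ j′ ≟ p ⊻ j ⊻ i) →-dec (j′ ≟ j ⊻ i) →-dec (x ≟ p)} tt i₀ x p j j′

    -- Adding a plane vector to a special pair and returning to the representative with third
    -- coordinate 0 adds `(c₀ , c₀ ⊻ i₀)` to the first two coordinates and preserves `u`. For the
    -- pair supplied by `S-moved` the result lies outside `S`, so it is no code.
    moved : (c₀ , i₀) ≢ (0₂ , 0₂) → ⊥
    moved ≢ = go (s′ (special m , 0₂)) refl
      where
      m = proj₁ (S-moved c₀ i₀ ≢)
      go : ∀ y → s′ (special m , 0₂) ≡ y → ⊥
      at : ∀ l y → s′ (special m , 0₂) ≡ y → F l y ≡ F l (special m , 0₂) ⊻ F l (plane c₀ , i₀)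
      at l y eq = trans (sym (cong (F l) eq)) (s-translation l (special m , 0₂))
      go (plane c , j) eq = same-end {inj₁ m} {0₂} λ l →
        trans (⊻-identityʳ (digit k 2 u l)) (sym (solve₂ 0₂ (digit k 2 u l) 0₂ j (at (suc (suc (suc l))) (plane c , j) eq) (at (suc (suc zero)) (plane c , j) eq)))
      go (inj₂ x , j) eq = clash x (cong₂ _,_ (cong₂ _,_
          (solve₀ _ _ 0₂ j (at zero (inj₂ x , j) eq) j≡) (solve₁ _ _ 0₂ j (at (suc zero) (inj₂ x , j) eq) j≡))
          (digit-injective k 2 λ l → solve₂ _ _ 0₂ j (at (suc (suc (suc l))) (inj₂ x , j) eq) j≡))
        where
        j≡ : j ≡ 0₂ ⊻ i₀
        j≡ = at (suc (suc zero)) (inj₂ x , j) eq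
        clash : ∀ x → E x ≡ ((proj₁ (S m) ⊻ c₀ , proj₂ (S m) ⊻ (c₀ ⊻ i₀)) , u) → ⊥
        clash (inj₁ m′) p = proj₂ (S-moved c₀ i₀ ≢) m′ (cong proj₁ p)
        clash (inj₂ i) p = proj₂ (proj₂ (proj₂ D)) _ (cong proj₂ p)

    trivial₀ : (c₀ , i₀) ≡ (0₂ , 0₂)
    trivial₀ with c₀ ≟ 0₂ | i₀ ≟ 0₂
    ... | yes c≡ | yes i≡ = cong₂ _,_ c≡ i≡
    ... | no c≢ | _ = ⊥-elim (moved λ eq → c≢ (cong proj₁ eq))
    ... | yes _ | no i≢ = ⊥-elim (moved λ eq → i≢ (cong proj₂ eq))

    trivial : ∀ l j → π l j ≡ j
    trivial l j = trans (translation l j) (trans (cong (j ⊻_) (trans (π₀ l) (zero-code l))) (⊻-identityʳ j))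
      where
      zero-code : ∀ l → F l (plane c₀ , i₀) ≡ 0₂
      zero-code l = trans (cong (λ p → F l (plane (proj₁ p) , proj₂ p)) trivial₀) (at l)
        where
        at : ∀ l → F l (plane 0₂ , 0₂) ≡ 0₂
        at zero = refl
        at (suc zero) = refl
        at (suc (suc l)) = refl

  base : HasBaseOfSize a 2 (3 + k)
  base = base-if-rigid (s≤s z≤n) F-injective (λ π π-inj s t sπ tπ → Symmetry.trivial π π-inj s t sπ tπ)
    where open Construct (×↔* e) F ψ ψ-injective ψ′F

one : Fin 1 → Fin 2 × Fin 2
one _ = 0₂ , 0₂

three : Fin 3 → Fin 2 × Fin 2
three zero = 0₂ , 1₂
three (suc zero) = 1₂ , 0₂
three (suc (suc zero)) = 1₂ , 1₂

one-moved : ∀ c i → (c , i) ≢ (0₂ , 0₂) → ∃ λ m → ∀ m′ → one m′ ≢ (proj₁ (one m) ⊻ c , proj₂ (one m) ⊻ (c ⊻ i))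
one-moved 0₂ 0₂ ≢ = contradiction refl ≢
one-moved 0₂ 1₂ ≢ = zero , λ { zero () }
one-moved 1₂ 0₂ ≢ = zero , λ { zero () }
one-moved 1₂ 1₂ ≢ = zero , λ { zero () }

three-injective : ∀ {i j} → three i ≡ three j → i ≡ j
three-injective {zero} {zero} _ = refl
three-injective {zero} {suc zero} ()
three-injective {zero} {suc (suc zero)} ()
three-injective {suc zero} {zero} ()
three-injective {suc zero} {suc zero} _ = refl
three-injective {suc zero} {suc (suc zero)} ()
three-injective {suc (suc zero)} {zero} ()
three-injective {suc (suc zero)} {suc zero} ()
three-injective {suc (suc zero)} {suc (suc zero)} _ = refl

three-moved : ∀ c i → (c , i) ≢ (0₂ , 0₂) → ∃ λ m → ∀ m′ → three m′ ≢ (proj₁ (three m) ⊻ c , proj₂ (three m) ⊻ (c ⊻ i))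
three-moved 0₂ 0₂ ≢ = contradiction refl ≢
three-moved 0₂ 1₂ ≢ = zero , λ { zero () ; (suc zero) () ; (suc (suc zero)) () }
three-moved 1₂ 0₂ ≢ = suc (suc zero) , λ { zero () ; (suc zero) () ; (suc (suc zero)) () }
three-moved 1₂ 1₂ ≢ = suc zero , λ { zero () ; (suc zero) () ; (suc (suc zero)) () }

-- With 2^k = 2 + N, the two choices of `S` give the sizes 3, ..., 3 + 4N and 5, ..., 5 + 4N, and 5
-- + 4N is 2^(2+k) - 3. The value 4 is left out only when N = 0, that is, for k = 1.
two-blocks : ∀ {a} k → 1 ≤ k → 3 ≤ a → a + 3 ≤ 2 ^ (2 + k) → ¬ (a ≡ 4 × k ≡ 1) → HasBaseOfSize a 2 (3 + k)
two-blocks {a} k 1≤k 3≤a a+3≤ exc = go (proj₁ half) (sym (proj₂ half))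
  where
  half : ∃ λ N → 2 + N ≡ 2 ^ k
  half = ℕ.m≤n⇒∃[o]m+o≡n (ℕ.^-monoʳ-≤ 2 1≤k)
  go : ∀ N → 2 ^ k ≡ 2 + N → HasBaseOfSize a 2 (3 + k)
  go N size with a ℕ.≤? 3 + 4 * N
  ... | yes a≤ = subst (λ a → HasBaseOfSize a 2 (3 + k)) (proj₂ r) (Binary.base k N 1 (proj₁ r) size 1≤k one (λ { {zero} {zero} _ → refl }) one-moved r≤)
    where
    r = ℕ.m≤n⇒∃[o]m+o≡n 3≤a
    r≤ : proj₁ r ≤ 4 * N
    r≤ = ℕ.+-cancelˡ-≤ 3 _ _ (subst (_≤ 3 + 4 * N) (sym (proj₂ r)) a≤)
  ... | no a≰ = subst (λ a → HasBaseOfSize a 2 (3 + k)) (proj₂ r) (Binary.base k N 3 (proj₁ r) size 1≤k three three-injective three-moved r≤)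
    where
    5≤a : 5 ≤ a
    5≤a = ℕ.≤∧≢⇒< (ℕ.≤-trans (ℕ.m≤m+n 4 (4 * N)) (ℕ.≰⇒> a≰)) λ 4≡a → exc (sym 4≡a , k≡1 (N≡0 4≡a))
      where
      N≡0 : 4 ≡ a → N ≡ 0
      N≡0 refl = ℕ.*-cancelˡ-≡ N 0 4 (ℕ.n≤0⇒n≡0 (ℕ.+-cancelˡ-≤ 4 _ _ (ℕ.≰⇒> a≰)))
      k≡1 : N ≡ 0 → k ≡ 1
      k≡1 refl = ℕ.≤-antisym (ℕ.≮⇒≥ λ 2≤k → ℕ.<⇒≱ (s≤s (s≤s (s≤s z≤n))) (ℕ.≤-trans (ℕ.^-monoʳ-≤ 2 2≤k) (ℕ.≤-reflexive size))) 1≤k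
    r = ℕ.m≤n⇒∃[o]m+o≡n 5≤a
    r≤ : proj₁ r ≤ 4 * N
    r≤ = ℕ.+-cancelˡ-≤ 8 _ _ (ℕ.≤-trans (ℕ.≤-reflexive (trans (ring (proj₁ r)) (cong (_+ 3) (proj₂ r)))) (ℕ.≤-trans a+3≤ (ℕ.≤-reflexive (trans (cong (λ n → 2 * (2 * n)) size) (ring′ N)))))
      where
      ring : ∀ r → 8 + r ≡ 5 + r + 3
      ring = solve-∀
      ring′ : ∀ N → 2 * (2 * (2 + N)) ≡ 8 + 4 * N
      ring′ = solve-∀

-- Blocks of size two: partners

other : Fin 2 → Fin 2
other zero = suc zero
other (suc zero) = zero

other≢ : ∀ i → other i ≢ i
other≢ zero ()
other≢ (suc zero) ()

same-or-other : ∀ i j → j ≡ i ⊎ j ≡ other i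
same-or-other zero zero = inj₁ refl
same-or-other zero (suc zero) = inj₂ refl
same-or-other (suc zero) zero = inj₂ refl
same-or-other (suc zero) (suc zero) = inj₁ refl

-- Partitions into pairs are handled as fixed-point-free involutions, so that fixing a partition
-- becomes commuting with an involution.
module Partner {b} (p : RegularPartition 2 b) where

  private
    f = proj₁ p
    regular = proj₂ p

  private
    module _ (x : Fin (2 * b)) where
      block? : ∀ y → Dec (f y ≡ f x)
      block? y = f y ≟ f x

      position : ∀ y → f y ≡ f x → Fin 2
      position y eq = cast (regular (f x)) (rank block? y eq)

      member : Fin 2 → Fin (2 * b)
      member i = enum block? (cast (sym (regular (f x))) i)

      member-position : ∀ y eq → member (position y eq) ≡ y
      member-position y eq = trans (cong (enum block?) (Fin.toℕ-injective (trans (Fin.toℕ-cast (sym (regular (f x))) _) (Fin.toℕ-cast (regular (f x)) _)))) (enum-rank block? y eq)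

      member-injective : ∀ {i j} → member i ≡ member j → i ≡ j
      member-injective eq = cast-injective (sym (regular (f x))) (enum-injective block? eq)

  opaque
    partner : Fin (2 * b) → Fin (2 * b)
    partner x = member x (other (position x x refl))

    partner-label : ∀ x → f (partner x) ≡ f x
    partner-label x = enum-sat (block? x) _

    partner≢ : ∀ x → partner x ≢ x
    partner≢ x eq = other≢ _ (member-injective x (trans eq (sym (member-position x x refl))))

    partner-only : ∀ x y → f y ≡ f x → y ≡ x ⊎ y ≡ partner x
    partner-only x y eq with same-or-other (position x x refl) (position x y eq)
    ... | inj₁ p = inj₁ (trans (sym (member-position x y eq)) (trans (cong (member x) p) (member-position x x refl)))
    ... | inj₂ p = inj₂ (trans (sym (member-position x y eq)) (cong (member x) p))

  partner-involutive : ∀ x → partner (partner x) ≡ x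
  partner-involutive x with partner-only (partner x) x (sym (partner-label x))
  ... | inj₁ eq = contradiction (sym eq) (partner≢ x)
  ... | inj₂ eq = sym eq

  commuting⇒fixes : (σ : Permutation′ (2 * b)) → (∀ x → σ ⟨$⟩ʳ partner x ≡ partner (σ ⟨$⟩ʳ x)) → Fixes 2 b σ p
  commuting⇒fixes σ comm x y = there , back
    where
    there : f x ≡ f y → f (σ ⟨$⟩ʳ x) ≡ f (σ ⟨$⟩ʳ y)
    there eq with partner-only y x eq
    ... | inj₁ refl = refl
    ... | inj₂ refl = trans (cong f (comm y)) (partner-label (σ ⟨$⟩ʳ y))
    back : f (σ ⟨$⟩ʳ x) ≡ f (σ ⟨$⟩ʳ y) → f x ≡ f y
    back eq with partner-only (σ ⟨$⟩ʳ y) (σ ⟨$⟩ʳ x) eq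
    ... | inj₁ eq′ = cong f (⟨$⟩ʳ-injective σ eq′)
    ... | inj₂ eq′ = trans (cong f (⟨$⟩ʳ-injective σ (trans eq′ (sym (comm y))))) (partner-label y)

-- Two fixed-point-free involutions t₁ and t₂ commute with the involution exchanging w x₀ and w (t₁ x₀) for all
-- w in the group generated by r = t₂ t₁, and fixing all other points.
module Dihedral {n} (t₁ t₂ : Fin n → Fin n) (t₁t₁ : ∀ x → t₁ (t₁ x) ≡ x) (t₂t₂ : ∀ x → t₂ (t₂ x) ≡ x)
  (t₁≢ : ∀ x → t₁ x ≢ x) (t₂≢ : ∀ x → t₂ x ≢ x) (x₀ : Fin n) where

  r r⁻ : Fin n → Fin n
  r x = t₂ (t₁ x)
  r⁻ x = t₁ (t₂ x)

  r⁻r : ∀ x → r⁻ (r x) ≡ x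
  r⁻r x = trans (cong t₁ (t₂t₂ (t₁ x))) (t₁t₁ x)

  pow : ℕ → Fin n → Fin n
  pow zero x = x
  pow (suc i) x = r (pow i x)

  pow-r : ∀ i x → pow i (r x) ≡ r (pow i x)
  pow-r zero x = refl
  pow-r (suc i) x = cong r (pow-r i x)

  pow-+ : ∀ i j x → pow (i + j) x ≡ pow i (pow j x)
  pow-+ zero j x = refl
  pow-+ (suc i) j x = cong r (pow-+ i j x)

  pow-injective : ∀ i {x y} → pow i x ≡ pow i y → x ≡ y
  pow-injective zero eq = eq
  pow-injective (suc i) eq = pow-injective i (trans (sym (r⁻r _)) (trans (cong r⁻ eq) (r⁻r _)))

  -- Conjugation by `t₁` inverts `r`, as in every dihedral group.
  pow-t₁ : ∀ i x → pow i (t₁ (pow i x)) ≡ t₁ x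
  pow-t₁ zero x = refl
  pow-t₁ (suc i) x = trans (sym (pow-r i (t₁ (r (pow i x))))) (trans (cong (pow i) rt₁r) (pow-t₁ i x))
    where
    rt₁r : r (t₁ (r (pow i x))) ≡ t₁ (pow i x)
    rt₁r = trans (cong t₂ (t₁t₁ (r (pow i x)))) (t₂t₂ (t₁ (pow i x)))

  -- Words of odd length are conjugate to t₁ or t₂, so they have no fixed point.
  pow-t₁≢ : ∀ i x → pow i (t₁ x) ≢ x
  pow-t₁≢ zero x eq = t₁≢ x eq
  pow-t₁≢ (suc zero) x eq = t₂≢ x (trans (cong t₂ (sym (t₁t₁ x))) eq)
  pow-t₁≢ (suc (suc i)) x eq = pow-t₁≢ i (r⁻ x) (trans (cong (pow i) step) (trans (pow-r i (t₁ x)) (trans (sym (r⁻r _)) (cong r⁻ eq))))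
    where
    step : t₁ (r⁻ x) ≡ r (t₁ x)
    step = trans (t₁t₁ (t₂ x)) (cong t₂ (sym (t₁t₁ x)))

  private
    period : ∃ λ p → pow (suc p) x₀ ≡ x₀
    period with Fin.pigeonhole (ℕ.n<1+n n) (λ i → pow (toℕ i) x₀)
    ... | i , j , i<j , eq with ℕ.m≤n⇒∃[o]m+o≡n i<j
    ... | p , i+p≡j = p , sym (pow-injective (toℕ i) (trans eq (trans (cong (λ j → pow j x₀) (trans (sym i+p≡j) (sym (ℕ.+-suc (toℕ i) p)))) (pow-+ (toℕ i) (suc p) x₀))))

    p = proj₁ period
    y₀ = t₁ x₀

  pow-x₀-y₀ : ∀ i → pow i x₀ ≡ x₀ → pow i y₀ ≡ y₀
  pow-x₀-y₀ i eq = trans (cong (λ x → pow i (t₁ x)) (sym eq)) (pow-t₁ i x₀)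

  -- Powers of `r` suffice for the words `w`, because `t₁` and `t₂` merely exchange the two sides of
  -- pairs. The bound by a period of `x₀` makes the relation decidable.
  Pair : Fin n → Fin n → Set
  Pair x y = ∃ λ i → i < suc p × pow i x₀ ≡ x × pow i y₀ ≡ y

  pair-r : ∀ {x y} → Pair x y → Pair (r x) (r y)
  pair-r (i , i<p , refl , refl) with suc i ℕ.<? suc p
  ... | yes i+1<p = suc i , i+1<p , refl , refl
  ... | no i+1≮p = 0 , s≤s z≤n , sym (trans (cong (λ i → pow i x₀) i+1≡p) (proj₂ period)) , sym (trans (cong (λ i → pow i y₀) i+1≡p) (pow-x₀-y₀ (suc p) (proj₂ period)))
    where
    i+1≡p : suc i ≡ suc p
    i+1≡p = ℕ.≤-antisym i<p (ℕ.≮⇒≥ i+1≮p)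

  pair-r⁻ : ∀ {x y} → Pair x y → Pair (r⁻ x) (r⁻ y)
  pair-r⁻ (zero , _ , refl , refl) = p , ℕ.≤-refl , trans (sym (r⁻r _)) (cong r⁻ (proj₂ period)) , trans (sym (r⁻r _)) (cong r⁻ (pow-x₀-y₀ (suc p) (proj₂ period)))
  pair-r⁻ (suc i , i<p , refl , refl) = i , ℕ.<⇒≤ i<p , sym (r⁻r _) , sym (r⁻r _)

  pair-t₁ : ∀ {x y} → Pair x y → Pair (t₁ y) (t₁ x)
  pair-t₁ (i , _ , refl , refl) = go i
    where
    go : ∀ i → Pair (t₁ (pow i y₀)) (t₁ (pow i x₀))
    go zero = 0 , s≤s z≤n , sym (t₁t₁ x₀) , refl
    go (suc i) = pair-r⁻ (go i)

  pair-t₂ : ∀ {x y} → Pair x y → Pair (t₂ y) (t₂ x)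
  pair-t₂ {x} {y} q with pair-r (pair-t₁ q)
  ... | i , i<p , eq , eq′ = i , i<p , trans eq (cong t₂ (t₁t₁ y)) , trans eq′ (cong t₂ (t₁t₁ x))

  pow-determines : ∀ {i j} → i ≤ j → pow i x₀ ≡ pow j x₀ → pow i y₀ ≡ pow j y₀
  pow-determines {i} i≤j eq with ℕ.m≤n⇒∃[o]m+o≡n i≤j
  ... | d , refl = trans (cong (pow i) (sym (pow-x₀-y₀ d (sym (pow-injective i (trans eq (pow-+ i d x₀))))))) (sym (pow-+ i d y₀))

  pair-functional : ∀ {x y y′} → Pair x y → Pair x y′ → y ≡ y′
  pair-functional (i , _ , eq , refl) (j , _ , eq′ , refl) with ℕ.≤-total i j
  ... | inj₁ i≤j = pow-determines i≤j (trans eq (sym eq′))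
  ... | inj₂ j≤i = sym (pow-determines j≤i (trans eq′ (sym eq)))

  pair-injective : ∀ {x x′ y} → Pair x y → Pair x′ y → x ≡ x′
  pair-injective p q = trans (sym (t₁t₁ _)) (trans (cong t₁ (pair-functional (pair-t₁ p) (pair-t₁ q))) (t₁t₁ _))

  -- A point on both sides would yield a fixed point of a word of odd length.
  pair-disjoint : ∀ {x y z} → Pair x y → Pair y z → ⊥
  pair-disjoint (i , _ , refl , refl) (j , _ , eq , _) with ℕ.≤-total i j
  ... | inj₁ i≤j with ℕ.m≤n⇒∃[o]m+o≡n i≤j
  ...   | d , refl = pow-t₁≢ d y₀ (trans (cong (pow d) (t₁t₁ x₀)) (pow-injective i (trans (sym (pow-+ i d x₀)) eq)))
  pair-disjoint (i , _ , refl , refl) (j , _ , eq , _) | inj₂ j≤i with ℕ.m≤n⇒∃[o]m+o≡n j≤i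
  ...   | d , refl = pow-t₁≢ d x₀ (sym (pow-injective j (trans eq (pow-+ j d y₀))))

  left? : ∀ x → Dec (∃ λ y → Pair x y)
  left? x with any? (λ (i : Fin (suc p)) → pow (toℕ i) x₀ ≟ x)
  ... | yes (i , eq) = yes (pow (toℕ i) y₀ , toℕ i , Fin.toℕ<n i , eq , refl)
  ... | no ∄ = no λ { (y , i , i<p , eq , _) → ∄ (fromℕ< i<p , trans (cong (λ i → pow i x₀) (Fin.toℕ-fromℕ< i<p)) eq) }

  right? : ∀ y → Dec (∃ λ x → Pair x y)
  right? y with any? (λ (i : Fin (suc p)) → pow (toℕ i) y₀ ≟ y)
  ... | yes (i , eq) = yes (pow (toℕ i) x₀ , toℕ i , Fin.toℕ<n i , refl , eq)
  ... | no ∄ = no λ { (x , i , i<p , _ , eq) → ∄ (fromℕ< i<p , trans (cong (λ i → pow i y₀) (Fin.toℕ-fromℕ< i<p)) eq) }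

  exchange : Fin n → Fin n
  exchange x with left? x | right? x
  ... | yes (y , _) | _ = y
  ... | no _ | yes (y , _) = y
  ... | no _ | no _ = x

  exchange-left : ∀ {x y} → Pair x y → exchange x ≡ y
  exchange-left {x} q with left? x | right? x
  ... | yes (_ , q′) | _ = pair-functional q′ q
  ... | no ∄ | _ = contradiction (_ , q) ∄

  exchange-right : ∀ {x y} → Pair x y → exchange y ≡ x
  exchange-right {x} {y} q with left? y | right? y
  ... | yes (_ , q′) | _ = ⊥-elim (pair-disjoint q q′)
  ... | no _ | yes (_ , q′) = pair-injective q′ q
  ... | no _ | no ∄ = contradiction (_ , q) ∄

  exchange-neither : ∀ {x} → (∀ y → ¬ Pair x y) → (∀ y → ¬ Pair y x) → exchange x ≡ x
  exchange-neither {x} ∄ ∄′ with left? x | right? x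
  ... | yes (y , q) | _ = contradiction q (∄ y)
  ... | no _ | yes (y , q) = contradiction q (∄′ y)
  ... | no _ | no _ = refl

  by-cases : (P : Fin n → Set) → (∀ {x y} → Pair x y → P x) → (∀ {x y} → Pair x y → P y) →
    (∀ {x} → (∀ y → ¬ Pair x y) → (∀ y → ¬ Pair y x) → P x) → ∀ x → P x
  by-cases P l r o x with left? x | right? x
  ... | yes (_ , q) | _ = l q
  ... | no _ | yes (_ , q) = r q
  ... | no ∄ | no ∄′ = o (λ y q → ∄ (y , q)) (λ y q → ∄′ (y , q))

  exchange-involutive : ∀ x → exchange (exchange x) ≡ x
  exchange-involutive = by-cases (λ x → exchange (exchange x) ≡ x)
    (λ q → trans (cong exchange (exchange-left q)) (exchange-right q))
    (λ q → trans (cong exchange (exchange-right q)) (exchange-left q))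
    (λ ∄ ∄′ → trans (cong exchange (exchange-neither ∄ ∄′)) (exchange-neither ∄ ∄′))

  commutes : (t : Fin n → Fin n) → (∀ x → t (t x) ≡ x) → (∀ {x y} → Pair x y → Pair (t y) (t x)) → ∀ x → exchange (t x) ≡ t (exchange x)
  commutes t inv pair-t = by-cases (λ x → exchange (t x) ≡ t (exchange x))
    (λ q → trans (exchange-right (pair-t q)) (cong t (sym (exchange-left q))))
    (λ q → trans (exchange-left (pair-t q)) (cong t (sym (exchange-right q))))
    (λ {x} ∄ ∄′ → trans (exchange-neither (λ y q → ∄′ (t y) (subst (Pair (t y)) (inv x) (pair-t q)))
      (λ y q → ∄ (t y) (subst (λ x → Pair x (t y)) (inv x) (pair-t q)))) (cong t (sym (exchange-neither ∄ ∄′))))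

no-two-matchings : ∀ {b} → 1 ≤ b → ¬ HasBaseOfSize 2 b 2
no-two-matchings {b} 1≤b h = P₀.partner≢ x₀ (trans (sym (exchange-left (0 , s≤s z≤n , refl , refl))) (base σ fixes x₀))
  where
  F = proj₁ (toFamily h)
  base = proj₂ (toFamily h)
  module P₀ = Partner (F zero)
  module P₁ = Partner (F (suc zero))
  x₀ : Fin (2 * b)
  x₀ = combine {2} zero (fromℕ< 1≤b)
  open Dihedral P₀.partner P₁.partner P₀.partner-involutive P₁.partner-involutive P₀.partner≢ P₁.partner≢ x₀
  σ : Permutation′ (2 * b)
  σ = permutation exchange exchange exchange-involutive exchange-involutive
  fixes : ∀ l → Fixes 2 b σ (F l)
  fixes zero = P₀.commuting⇒fixes σ (commutes P₀.partner P₀.partner-involutive pair-t₁)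
  fixes (suc zero) = P₁.commuting⇒fixes σ (commutes P₁.partner P₁.partner-involutive pair-t₂)

-- The condition on two pairs of a graph: no point is its own image, and `u` is the image of `x`
-- exactly when `x` is the image of `u`.
fixed-point-free : ∀ {n} → Fin n × Fin n → Fin n × Fin n → Bool
fixed-point-free (x , y) (u , v) = if does (x ≟ y) then false else (if does (u ≟ y) then does (v ≟ x) else not (does (v ≟ x)))

fixed-point-free-ok : ∀ {n} (t : Fin n → Fin n) → (∀ x → t (t x) ≡ x) → (∀ x → t x ≢ x) → ∀ x u → T (fixed-point-free (x , t x) (u , t u))
fixed-point-free-ok t inv t≢ x u with x ≟ t x
... | yes eq = t≢ x (sym eq)
... | no _ with u ≟ t x | t u ≟ x
...   | yes _ | yes _ = tt
...   | yes p | no ¬q = ¬q (trans (cong t p) (inv x))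
...   | no ¬p | yes q = ¬p (trans (sym (inv u)) (cong t q))
...   | no _ | no _ = tt

module _ {n} (σ : Fin n → Fin n) where

  commutesᵇ : List (Fin n × Fin n) → Bool
  commutesᵇ pairs = all (λ (x , y) → anyᵇ (λ (u , v) → does (u ≟ σ x) ∧ does (v ≟ σ y)) pairs) pairs

  commutesᵇ-sound : (t : Fin n → Fin n) → ∀ xs → T (commutesᵇ (graph t xs)) → ∀ {x} → x ∈ xs → t (σ x) ≡ σ (t x)
  commutesᵇ-sound t xs = go xs
    where
    p : Fin n × Fin n → Fin n × Fin n → Bool
    p (x , y) (u , v) = does (u ≟ σ x) ∧ does (v ≟ σ y)
    found : ∀ x ys → T (anyᵇ (p (x , t x)) (graph t ys)) → t (σ x) ≡ σ (t x)
    found x (u ∷ ys) s with T-∨ {p (x , t x) (u , t u)} s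
    ... | inj₂ s′ = found x ys s′
    ... | inj₁ s′ = trans (cong t (sym (T-does (u ≟ σ x) (proj₁ (T-∧ {does (u ≟ σ x)} s′))))) (T-does (t u ≟ σ (t x)) (proj₂ (T-∧ {does (u ≟ σ x)} s′)))
    go : ∀ ys → T (all (λ q → anyᵇ (p q) (graph t xs)) (graph t ys)) → ∀ {x} → x ∈ ys → t (σ x) ≡ σ (t x)
    go (y ∷ ys) s (Any.here refl) = found y xs (proj₁ (T-∧ {anyᵇ (p (y , t y)) (graph t xs)} s))
    go (y ∷ ys) s (Any.there x∈) = go ys (proj₂ (T-∧ {anyᵇ (p (y , t y)) (graph t xs)} s)) x∈

-- Under an outer automorphism of S₆ the fixed-point-free involutions correspond to the transpositions, and any
-- three transpositions of six points commute with a common transposition.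
involutions₆ : List (Vec (Fin 6) 6)
involutions₆ = 
  (#1 Vec.∷ #0 Vec.∷ #3 Vec.∷ #2 Vec.∷ #5 Vec.∷ #4 Vec.∷ Vec.[])
  ∷ (#1 Vec.∷ #0 Vec.∷ #4 Vec.∷ #5 Vec.∷ #2 Vec.∷ #3 Vec.∷ Vec.[])
  ∷ (#1 Vec.∷ #0 Vec.∷ #5 Vec.∷ #4 Vec.∷ #3 Vec.∷ #2 Vec.∷ Vec.[])
  ∷ (#2 Vec.∷ #3 Vec.∷ #0 Vec.∷ #1 Vec.∷ #5 Vec.∷ #4 Vec.∷ Vec.[])
  ∷ (#2 Vec.∷ #4 Vec.∷ #0 Vec.∷ #5 Vec.∷ #1 Vec.∷ #3 Vec.∷ Vec.[])
  ∷ (#2 Vec.∷ #5 Vec.∷ #0 Vec.∷ #4 Vec.∷ #3 Vec.∷ #1 Vec.∷ Vec.[])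
  ∷ (#3 Vec.∷ #2 Vec.∷ #1 Vec.∷ #0 Vec.∷ #5 Vec.∷ #4 Vec.∷ Vec.[])
  ∷ (#3 Vec.∷ #4 Vec.∷ #5 Vec.∷ #0 Vec.∷ #1 Vec.∷ #2 Vec.∷ Vec.[])
  ∷ (#3 Vec.∷ #5 Vec.∷ #4 Vec.∷ #0 Vec.∷ #2 Vec.∷ #1 Vec.∷ Vec.[])
  ∷ (#4 Vec.∷ #2 Vec.∷ #1 Vec.∷ #5 Vec.∷ #0 Vec.∷ #3 Vec.∷ Vec.[])
  ∷ (#4 Vec.∷ #3 Vec.∷ #5 Vec.∷ #1 Vec.∷ #0 Vec.∷ #2 Vec.∷ Vec.[])
  ∷ (#4 Vec.∷ #5 Vec.∷ #3 Vec.∷ #2 Vec.∷ #0 Vec.∷ #1 Vec.∷ Vec.[])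
  ∷ (#5 Vec.∷ #2 Vec.∷ #1 Vec.∷ #4 Vec.∷ #3 Vec.∷ #0 Vec.∷ Vec.[])
  ∷ (#5 Vec.∷ #3 Vec.∷ #4 Vec.∷ #1 Vec.∷ #2 Vec.∷ #0 Vec.∷ Vec.[])
  ∷ (#5 Vec.∷ #4 Vec.∷ #3 Vec.∷ #2 Vec.∷ #1 Vec.∷ #0 Vec.∷ Vec.[])
  ∷ []
  where
  #0 : Fin 6
  #0 = zero
  #1 : Fin 6
  #1 = suc zero
  #2 : Fin 6
  #2 = suc (suc zero)
  #3 : Fin 6
  #3 = suc (suc (suc zero))
  #4 : Fin 6
  #4 = suc (suc (suc (suc zero)))
  #5 : Fin 6
  #5 = suc (suc (suc (suc (suc zero))))

fixed-point-free-search : ∀ n → (List (Fin n × Fin n) → Bool) → Bool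
fixed-point-free-search n leaf = exhaust fixed-point-free leaf [] (allFin n)

agrees : ∀ {n} → List (Fin n × Fin n) → Vec (Fin n) n → Bool
agrees p v = all (λ (x , y) → does (Vec.lookup v x ≟ y)) p

agrees-sound : ∀ {n} (t : Fin n → Fin n) v xs → T (agrees (graph t xs) v) → ∀ {x} → x ∈ xs → Vec.lookup v x ≡ t x
agrees-sound t v (x ∷ xs) s (Any.here refl) = T-does (Vec.lookup v x ≟ t x) (proj₁ (T-∧ {does (Vec.lookup v x ≟ t x)} s))
agrees-sound t v (x ∷ xs) s (Any.there x∈) = agrees-sound t v xs (proj₂ (T-∧ {does (Vec.lookup v x ≟ t x)} s)) x∈

involutions₆-complete : T (fixed-point-free-search 6 λ p → anyᵇ (agrees p) involutions₆)
involutions₆-complete = tt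

commuteᵇ : ∀ {n} → Vec (Fin n) n → Vec (Fin n) n → Bool
commuteᵇ u v = allᵇ λ x → does (Vec.lookup u (Vec.lookup v x) ≟ Vec.lookup v (Vec.lookup u x))

-- The commuting relation is tabulated row by row, so that testing all triples of the 15 involutions
-- only intersects Boolean lists.
row₆ : Vec (Fin 6) 6 → List Bool
row₆ v = List.map (commuteᵇ v) involutions₆

_⊓_ : List Bool → List Bool → List Bool
_⊓_ = List.zipWith _∧_

⊓-map : ∀ {A : Set} (f g : A → Bool) xs → List.map f xs ⊓ List.map g xs ≡ List.map (λ x → f x ∧ g x) xs
⊓-map f g [] = refl
⊓-map f g (x ∷ xs) = cong (f x ∧ g x ∷_) (⊓-map f g xs)

T-any-map : ∀ {A : Set} (f : A → Bool) xs → T (anyᵇ id (List.map f xs)) → ∃ λ x → x ∈ xs × T (f x)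
T-any-map f (x ∷ xs) s with T-∨ {f x} s
... | inj₁ fx = x , Any.here refl , fx
... | inj₂ s′ = let y , y∈ , fy = T-any-map f xs s′ in y , Any.there y∈ , fy

-- Nested loops over the second and third involution. The intersection of the first two rows is
-- formed before the last loop and shared by it.
meet₃ meet₂ : List (List Bool) → List Bool → Bool
meet₃ rows r = all (λ r′ → anyᵇ id (r ⊓ r′)) rows
meet₂ rows r = all (λ r′ → meet₃ rows (r ⊓ r′)) rows

meet₁ : List (List Bool) → Bool
meet₁ rows = all (meet₂ rows) rows

three-involutions : T (meet₁ (List.map row₆ involutions₆))
three-involutions = tt

involutive? : (σs : List (Vec (Fin 6) 6)) → Dec (All (λ σ → (∀ x → Vec.lookup σ (Vec.lookup σ x) ≡ x) × Vec.lookup σ zero ≢ zero) σs)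
involutive? = All.all? λ σ → all? (λ x → Vec.lookup σ (Vec.lookup σ x) ≟ x) ×-dec ¬? (Vec.lookup σ zero ≟ zero)

no-base-2-3 : ¬ HasBaseOfSize 2 3 3
no-base-2-3 h = proj₂ good (base σ fixes zero)
  where
  F = proj₁ (toFamily h)
  base = proj₂ (toFamily h)
  t : Fin 3 → Fin 6 → Fin 6
  t l = Partner.partner (F l)
  ok : ∀ l x u → T (fixed-point-free (x , t l x) (u , t l u))
  ok l = fixed-point-free-ok (t l) (Partner.partner-involutive (F l)) (Partner.partner≢ (F l))
  listed : ∀ l → ∃ λ v → v ∈ involutions₆ × T (agrees (graph (t l) (points 6)) v)
  listed l = T-anyᵇ (agrees (graph (t l) (points 6))) involutions₆
    (exhaust-sound fixed-point-free (t l) (ok l) (λ p → anyᵇ (agrees p) involutions₆) [] (allFin 6) involutions₆-complete)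
  v : Fin 3 → Vec (Fin 6) 6
  v l = proj₁ (listed l)
  v≡t : ∀ l x → Vec.lookup (v l) x ≡ t l x
  v≡t l x = agrees-sound (t l) (v l) (points 6) (proj₂ (proj₂ (listed l))) (∈-points x)
  rows = List.map row₆ involutions₆
  row∈ : ∀ l → row₆ (v l) ∈ rows
  row∈ l = ∈.∈-map⁺ row₆ (proj₁ (proj₂ (listed l)))
  met : T (anyᵇ id ((row₆ (v zero) ⊓ row₆ (v (suc zero))) ⊓ row₆ (v (suc (suc zero)))))
  met = T-all (λ r′ → anyᵇ id ((row₆ (v zero) ⊓ row₆ (v (suc zero))) ⊓ r′)) rows
    (T-all (λ r′ → meet₃ rows (row₆ (v zero) ⊓ r′)) rows (T-all (meet₂ rows) rows three-involutions (row∈ zero)) (row∈ (suc zero))) (row∈ (suc (suc zero)))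
  chosen : ∃ λ u → u ∈ involutions₆ × T ((commuteᵇ (v zero) u ∧ commuteᵇ (v (suc zero)) u) ∧ commuteᵇ (v (suc (suc zero))) u)
  chosen = T-any-map (λ u → (commuteᵇ (v zero) u ∧ commuteᵇ (v (suc zero)) u) ∧ commuteᵇ (v (suc (suc zero))) u) involutions₆ (subst (λ r → T (anyᵇ id r))
    (trans (cong (_⊓ row₆ (v (suc (suc zero)))) (⊓-map (commuteᵇ (v zero)) (commuteᵇ (v (suc zero))) involutions₆))
      (⊓-map (λ u → commuteᵇ (v zero) u ∧ commuteᵇ (v (suc zero)) u) (commuteᵇ (v (suc (suc zero)))) involutions₆)) met)
  s : Fin 6 → Fin 6
  s = Vec.lookup (proj₁ chosen)
  good : (∀ x → s (s x) ≡ x) × s zero ≢ zero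
  good = All.lookup (toWitness {a? = involutive? involutions₆} tt) (proj₁ (proj₂ chosen))
  σ : Permutation′ 6
  σ = permutation s s (proj₁ good) (proj₁ good)
  c = proj₂ (proj₂ chosen)
  c₀₁ = T-∧ {commuteᵇ (v zero) (proj₁ chosen)} (proj₁ (T-∧ {commuteᵇ (v zero) (proj₁ chosen) ∧ commuteᵇ (v (suc zero)) (proj₁ chosen)} c))
  commuting : ∀ l → T (commuteᵇ (v l) (proj₁ chosen))
  commuting zero = proj₁ c₀₁
  commuting (suc zero) = proj₂ c₀₁
  commuting (suc (suc zero)) = proj₂ (T-∧ {commuteᵇ (v zero) (proj₁ chosen) ∧ commuteᵇ (v (suc zero)) (proj₁ chosen)} c)
  fixes : ∀ l → Fixes 2 3 σ (F l)
  fixes l = Partner.commuting⇒fixes (F l) σ λ x → trans (cong s (sym (v≡t l x))) (trans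
    (sym (T-does (Vec.lookup (v l) (s x) ≟ s (Vec.lookup (v l) x)) (T-allᵇ (λ x → does (Vec.lookup (v l) (s x) ≟ s (Vec.lookup (v l) x))) (commuting l) x)))
    (v≡t l (s x)))

-- The double transpositions of four points commute with every fixed-point-free involution.
four-points : T (fixed-point-free-search 4 (commutesᵇ (Vec.lookup (suc zero Vec.∷ zero Vec.∷ suc (suc (suc zero)) Vec.∷ suc (suc zero) Vec.∷ Vec.[]))))
four-points = tt

no-base-2-2 : BaseSizeUndefined 2 2
no-base-2-2 m h = contradiction (base σ fixes zero) λ ()
  where
  F = proj₁ (toFamily h)
  base = proj₂ (toFamily h)
  s : Fin 4 → Fin 4
  s = Vec.lookup (suc zero Vec.∷ zero Vec.∷ suc (suc (suc zero)) Vec.∷ suc (suc zero) Vec.∷ Vec.[])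
  s-involutive : ∀ x → s (s x) ≡ x
  s-involutive = toWitness {a? = all? λ x → s (s x) ≟ x} tt
  σ : Permutation′ 4
  σ = permutation s s s-involutive s-involutive
  fixes : ∀ l → Fixes 2 2 σ (F l)
  fixes l = Partner.commuting⇒fixes (F l) σ λ x → sym (commutesᵇ-sound s t (points 4)
      (exhaust-sound fixed-point-free t (fixed-point-free-ok t (Partner.partner-involutive (F l)) (Partner.partner≢ (F l))) (commutesᵇ s) [] (allFin 4) four-points) (∈-points x))
    where
    t : Fin 4 → Fin 4
    t = Partner.partner (F l)

-- Boolean tables

bit : Bool → ℕ
bit true = 1
bit false = 0

tally : ∀ {n} → (Fin n → Bool) → ℕ
tally {zero} p = 0
tally {suc n} p = bit (p zero) + tally (λ i → p (suc i))

tally-cong : ∀ {n} {p q : Fin n → Bool} → (∀ i → p i ≡ q i) → tally p ≡ tally q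
tally-cong {zero} eq = refl
tally-cong {suc n} eq = cong₂ _+_ (cong bit (eq zero)) (tally-cong (λ i → eq (suc i)))

bit-mono : ∀ {x y} → (T x → T y) → bit x ≤ bit y
bit-mono {false} _ = z≤n
bit-mono {true} {true} _ = ℕ.≤-refl
bit-mono {true} {false} f = ⊥-elim (f tt)

tally-mono : ∀ {n} {p q : Fin n → Bool} → (∀ i → T (p i) → T (q i)) → tally p ≤ tally q
tally-mono {zero} f = z≤n
tally-mono {suc n} f = ℕ.+-mono-≤ (bit-mono (f zero)) (tally-mono (λ i → f (suc i)))

tally-strict : ∀ {n} {p q : Fin n → Bool} → (∀ i → T (p i) → T (q i)) → ∀ i → p i ≡ false → q i ≡ true → tally p < tally q
tally-strict {p = p} {q} f zero p≡ q≡ rewrite p≡ | q≡ = s≤s (tally-mono (λ i → f (suc i)))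
tally-strict {p = p} {q} f (suc i) p≡ q≡ = ℕ.≤-trans (ℕ.≤-reflexive (sym (ℕ.+-suc (bit (p zero)) _)))
  (ℕ.+-mono-≤ (bit-mono (f zero)) (tally-strict (λ i → f (suc i)) i p≡ q≡))

count≡tally : ∀ {n} {P : Fin n → Set} (P? : ∀ x → Dec (P x)) → count P? ≡ tally (λ x → does (P? x))
count≡tally P? = go id
  where
  go : ∀ {m} (g : Fin m → Fin _) → length (filter P? (List.tabulate g)) ≡ tally (λ i → does (P? (g i)))
  go {zero} g = refl
  go {suc m} g with P? (g zero)
  ... | yes _ = cong suc (go (λ i → g (suc i)))
  ... | no _ = go (λ i → g (suc i))

tally-permute : ∀ {n} (p : Fin n → Bool) (σ : Permutation′ n) → tally (λ i → p (σ ⟨$⟩ʳ i)) ≡ tally p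
tally-permute p σ = trans (sym (count≡tally (λ i → T? (p (σ ⟨$⟩ʳ i))))) (trans (ℕ.≤-antisym
    (count-≤ (λ i → T? (p (σ ⟨$⟩ʳ i))) (λ i → T? (p i)) (λ i _ → σ ⟨$⟩ʳ i) (λ _ t → t) (λ _ _ _ _ → ⟨$⟩ʳ-injective σ))
    (count-≤ (λ i → T? (p i)) (λ i → T? (p (σ ⟨$⟩ʳ i))) (λ i _ → σ ⟨$⟩ˡ i) (λ i t → subst (λ i → T (p i)) (sym (inverseʳ σ)) t)
      (λ i j _ _ eq → trans (sym (inverseʳ σ)) (trans (cong (σ ⟨$⟩ʳ_) eq) (inverseʳ σ)))))
  (count≡tally (λ i → T? (p i))))

ofWeight : ∀ n → ℕ → List (Vec Bool n)
ofWeight zero zero = Vec.[] ∷ []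
ofWeight zero (suc k) = []
ofWeight (suc n) zero = List.map (false Vec.∷_) (ofWeight n zero)
ofWeight (suc n) (suc k) = List.map (true Vec.∷_) (ofWeight n k) List.++ List.map (false Vec.∷_) (ofWeight n (suc k))

∈-ofWeight : ∀ {n} (v : Vec Bool n) k → tally (Vec.lookup v) ≡ k → v ∈ ofWeight n k
∈-ofWeight Vec.[] zero eq = Any.here refl
∈-ofWeight (true Vec.∷ v) (suc k) eq = ∈.∈-++⁺ˡ (∈.∈-map⁺ (true Vec.∷_) (∈-ofWeight v k (ℕ.suc-injective eq)))
∈-ofWeight (false Vec.∷ v) zero eq = ∈.∈-map⁺ (false Vec.∷_) (∈-ofWeight v zero eq)
∈-ofWeight {suc n} (false Vec.∷ v) (suc k) eq = ∈.∈-++⁺ʳ (List.map (true Vec.∷_) (ofWeight n k)) (∈.∈-map⁺ (false Vec.∷_) (∈-ofWeight v (suc k) eq))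

-- Row r of a base: the codes in the remaining coordinates of the points with first label r.
module Rows {p b q} (f : Fin p → Fin b) (κ : Fin p → Fin q) (injective : ∀ {x y} → f x ≡ f y → κ x ≡ κ y → x ≡ y) where

  Entry : Fin b → Fin q → Set
  Entry r z = ∃ λ x → f x ≡ r × κ x ≡ z

  entry? : ∀ r z → Dec (Entry r z)
  entry? r z = any? λ x → f x ≟ r ×-dec κ x ≟ z

  matrix : Fin b → Fin q → Bool
  matrix r z = does (entry? r z)

  tally-row : ∀ {P : Fin q → Set} (P? : ∀ z → Dec (P z)) r → tally (λ z → matrix r z ∧ does (P? z)) ≡ count (λ x → f x ≟ r ×-dec P? (κ x))
  tally-row P? r = trans (sym (count≡tally entry×P?)) (ℕ.≤-antisym
    (count-≤ entry×P? point? (λ _ e → proj₁ (proj₁ e)) (λ { z ((x , p , refl) , pz) → p , pz }) (λ { z w ((x , _ , eq) , _) ((_ , _ , eq′) , _) refl → trans (sym eq) eq′ }))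
    (count-≤ point? entry×P? (λ x _ → κ x) (λ x (p , pz) → (x , p , refl) , pz) (λ x y (p , _) (q , _) eq → injective (trans p (sym q)) eq)))
    where
    entry×P? : ∀ z → Dec (Entry r z × _)
    entry×P? z = entry? r z ×-dec P? z
    point? : ∀ x → Dec (f x ≡ r × _)
    point? x = f x ≟ r ×-dec P? (κ x)

-- Eight points and four bisections

meets : ∀ {n} → Vec Bool n → Vec Bool n → ℕ
meets Vec.[] Vec.[] = 0
meets (x Vec.∷ v) (y Vec.∷ w) = bit (x ∧ y) + meets v w

meets≡tally : ∀ {n} (p q : Fin n → Bool) → meets (Vec.tabulate p) (Vec.tabulate q) ≡ tally (λ i → p i ∧ q i)
meets≡tally {zero} p q = refl
meets≡tally {suc n} p q = cong (bit (p zero ∧ q zero) +_) (meets≡tally (λ i → p (suc i)) (λ i → q (suc i)))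

half-cube : Fin 3 → Fin 8 → Bool
half-cube l z = does (digit 3 2 z l ≟ zero)

half-cubes : Vec (Vec Bool 8) 3
half-cubes = Vec.tabulate λ l → Vec.tabulate (half-cube l)

-- Regularity of the last three bisections, where `lo` and `hi` are the sets of codes with first
-- label 0 and 1. Regularity of the first one is the weight 4 of both.
balanced : Vec (Vec Bool 8) 3 → Vec Bool 8 → Vec Bool 8 → Bool
balanced cubes lo hi = allᵇ λ l → does (meets lo (Vec.lookup cubes l) + meets hi (Vec.lookup cubes l) ℕ.≟ 4)

translate : Fin 8 → Fin 8 → Fin 8
translate v z = encode 3 2 λ l → digit 3 2 z l ⊻ digit 3 2 v l

pick : ∀ {A : Set} → Fin 2 → A → A → A
pick zero x y = x
pick (suc zero) x y = y

_⇒ᵇ_ : Bool → Bool → Bool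
x ⇒ᵇ y = not x ∨ y

translations : Vec (Vec (Fin 8) 8) 8
translations = Vec.tabulate λ v → Vec.tabulate (translate v)

lookup-translations : ∀ v z → Vec.lookup (Vec.lookup translations v) z ≡ translate v z
lookup-translations v z = trans (cong (λ w → Vec.lookup w z) (lookup∘tabulate (λ v → Vec.tabulate (translate v)) v)) (lookup∘tabulate (translate v) z)

-- A translation whose first coordinate is `i` keeps the two rows for `i = 0` and exchanges them for
-- `i = 1`; `w` tabulates its action on the other coordinates.
invariant : Fin 2 → Vec (Fin 8) 8 → Vec Bool 8 → Vec Bool 8 → Bool
invariant i w lo hi = allᵇ λ z → (Vec.lookup lo z ⇒ᵇ Vec.lookup (pick i lo hi) (Vec.lookup w z)) ∧ (Vec.lookup hi z ⇒ᵇ Vec.lookup (pick i hi lo) (Vec.lookup w z))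

nonzero : List (Fin 2 × Fin 8)
-- The element dropped is the first one, the zero translation.
nonzero = List.drop 1 (List.cartesianProduct (allFin 2) (allFin 8))

invariant-if-balanced : Vec (Vec Bool 8) 3 → Vec (Vec (Fin 8) 8) 8 → Vec Bool 8 → Vec Bool 8 → Bool
invariant-if-balanced cubes ws lo hi = balanced cubes lo hi ⇒ᵇ anyᵇ (λ (i , v) → invariant i (Vec.lookup ws v) lo hi) nonzero

invariant-all : Vec (Vec Bool 8) 3 → Vec (Vec (Fin 8) 8) 8 → List (Vec Bool 8) → Bool
invariant-all cubes ws us = all (λ lo → all (invariant-if-balanced cubes ws lo) us) us

-- On two labels every permutation is a translation, so the candidate symmetries of a code set are
-- the 15 nonzero vectors of four bits. All pairs of four-element rows are tested.
bisections : T (invariant-all half-cubes translations (ofWeight 8 4))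
bisections = tt

count-cong : ∀ {n} {P Q : Fin n → Set} (P? : ∀ x → Dec (P x)) (Q? : ∀ x → Dec (Q x)) →
  (∀ x → P x → Q x) → (∀ x → Q x → P x) → count P? ≡ count Q?
count-cong P? Q? f g = ℕ.≤-antisym (count-≤ P? Q? (λ x _ → x) f (λ _ _ _ _ eq → eq)) (count-≤ Q? P? (λ x _ → x) g (λ _ _ _ _ eq → eq))

T⇒≡ : ∀ {x} → T x → x ≡ true
T⇒≡ {true} _ = refl

≡⇒T : ∀ {x} → x ≡ true → T x
≡⇒T refl = tt

no-base-4-2 : ¬ HasBaseOfSize 4 2 4
no-base-4-2 h = proj₂ (All.lookup nonzero≢0 (proj₁ (proj₂ found))) (i≡0 , v≡0)
  where
  F = proj₁ (toFamily h)
  isBase = proj₂ (toFamily h)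
  code-inj : CodeInjective F
  code-inj = base⇒code-injective F isBase
  f = label F zero
  κ : Fin 8 → Fin 8
  κ x = encode 3 2 λ l → label F (suc l) x
  digit-κ : ∀ x l → digit 3 2 (κ x) l ≡ label F (suc l) x
  digit-κ x = digit-encode 3 2 (λ l → label F (suc l) x)
  injective : ∀ {x y} → f x ≡ f y → κ x ≡ κ y → x ≡ y
  injective {x} {y} p q = code-inj λ { zero → p ; (suc l) → trans (sym (digit-κ x l)) (trans (cong (λ z → digit 3 2 z l) q) (digit-κ y l)) }
  open Rows f κ injective
  row : Fin 2 → Vec Bool 8
  row r = Vec.tabulate (matrix r)
  lo = row zero
  hi = row (suc zero)
  weight : ∀ r → tally (Vec.lookup (row r)) ≡ 4
  weight r = trans (tally-cong λ z → trans (lookup∘tabulate (matrix r) z) (sym (∧-identityʳ (matrix r z))))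
    (trans (tally-row {λ _ → ⊤} (λ _ → yes tt) r) (trans (count-cong (λ x → f x ≟ r ×-dec yes tt) (λ x → f x ≟ r) (λ _ → proj₁) (λ _ p → p , tt)) (proj₂ (F zero) r)))
  half : ∀ l r → meets (row r) (Vec.lookup half-cubes l) ≡ count (λ x → f x ≟ r ×-dec digit 3 2 (κ x) l ≟ zero)
  half l r = trans (cong (meets (row r)) (lookup∘tabulate (λ l → Vec.tabulate (half-cube l)) l))
    (trans (meets≡tally (matrix r) (half-cube l)) (tally-row (λ z → digit 3 2 z l ≟ zero) r))
  halves : ∀ l → meets lo (Vec.lookup half-cubes l) + meets hi (Vec.lookup half-cubes l) ≡ 4
  halves l = trans (cong₂ _+_ (half l zero) (trans (half l (suc zero)) (count-cong
      (λ x → f x ≟ suc zero ×-dec digit 3 2 (κ x) l ≟ zero) (λ x → ¬? (f x ≟ zero) ×-dec digit 3 2 (κ x) l ≟ zero)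
      (λ x (p , q) → (λ p′ → contradiction (trans (sym p) p′) λ ()) , q) (λ x (p , q) → not-zero (f x) p , q))))
    (trans (count-split (λ x → digit 3 2 (κ x) l ≟ zero) (λ x → f x ≟ zero))
      (trans (count-cong (λ x → digit 3 2 (κ x) l ≟ zero) (λ x → label F (suc l) x ≟ zero) (λ x p → trans (sym (digit-κ x l)) p) (λ x p → trans (digit-κ x l) p))
        (proj₂ (F (suc l)) zero)))
    where
    not-zero : ∀ (i : Fin 2) → i ≢ zero → i ≡ suc zero
    not-zero zero ≢ = contradiction refl ≢
    not-zero (suc zero) _ = refl
  T-balanced : T (balanced half-cubes lo hi)
  T-balanced = T-allᵇ⁻ (λ l → does (meets lo (Vec.lookup half-cubes l) + meets hi (Vec.lookup half-cubes l) ℕ.≟ 4)) λ l →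
    does-T (meets lo (Vec.lookup half-cubes l) + meets hi (Vec.lookup half-cubes l) ℕ.≟ 4) (halves l)
  found : ∃ λ iv → iv ∈ nonzero × T (invariant (proj₁ iv) (Vec.lookup translations (proj₂ iv)) lo hi)
  found = T-anyᵇ (λ (i , v) → invariant i (Vec.lookup translations v) lo hi) nonzero (T-or {balanced half-cubes lo hi}
    (T-all (invariant-if-balanced half-cubes translations lo) (ofWeight 8 4) (T-all (λ lo → all (invariant-if-balanced half-cubes translations lo) (ofWeight 8 4)) (ofWeight 8 4) bisections
      (∈-ofWeight lo 4 (weight zero))) (∈-ofWeight hi 4 (weight (suc zero)))) T-balanced)
  i = proj₁ (proj₁ found)
  v = proj₂ (proj₁ found)
  T-lookup : ∀ r {z} → Entry r z → T (Vec.lookup (row r) z)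
  T-lookup r {z} e = subst T (sym (lookup∘tabulate (matrix r) z)) (does-T (entry? r z) e)
  entry-lookup : ∀ r {z} → T (Vec.lookup (row r) z) → Entry r z
  entry-lookup r {z} t = T-does (entry? r z) (subst T (lookup∘tabulate (matrix r) z) t)
  w = Vec.lookup translations v
  test : Fin 8 → Bool
  test z = (Vec.lookup lo z ⇒ᵇ Vec.lookup (pick i lo hi) (Vec.lookup w z)) ∧ (Vec.lookup hi z ⇒ᵇ Vec.lookup (pick i hi lo) (Vec.lookup w z))
  tested : ∀ z → T (Vec.lookup lo z ⇒ᵇ Vec.lookup (pick i lo hi) (Vec.lookup w z)) × T (Vec.lookup hi z ⇒ᵇ Vec.lookup (pick i hi lo) (Vec.lookup w z))
  tested z = T-∧ (T-allᵇ test (proj₂ (proj₂ found)) z)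
  moved : ∀ r z → Entry r z → Entry (r ⊻ i) (translate v z)
  moved r z e = subst (Entry (r ⊻ i)) (lookup-translations v z) (go r e)
    where
    from-lo : ∀ i {z} → T (Vec.lookup (pick i lo hi) z) → Entry i z
    from-lo zero = entry-lookup zero
    from-lo (suc zero) = entry-lookup (suc zero)
    from-hi : ∀ i {z} → T (Vec.lookup (pick i hi lo) z) → Entry (suc zero ⊻ i) z
    from-hi zero = entry-lookup (suc zero)
    from-hi (suc zero) = entry-lookup zero
    go : ∀ r → Entry r z → Entry (r ⊻ i) (Vec.lookup w z)
    go zero e = from-lo i (T-or (proj₁ (tested z)) (T-lookup zero e))
    go (suc zero) e = from-hi i (T-or (proj₂ (tested z)) (T-lookup (suc zero) e))
  π : Fin 4 → Fin 2 → Fin 2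
  π zero j = j ⊻ i
  π (suc l) j = j ⊻ digit 3 2 v l
  π-inj : ∀ l → Injective _≡_ _≡_ (π l)
  π-inj zero = ⊻-cancelʳ i
  π-inj (suc l) = ⊻-cancelʳ (digit 3 2 v l)
  image : ∀ x → Entry (f x ⊻ i) (translate v (κ x))
  image x = moved (f x) (κ x) (x , refl , refl)
  trivial : ∀ l j → π l j ≡ j
  trivial = base⇒rigid F (s≤s z≤n) isBase π π-inj (λ x → proj₁ (image x)) λ
    { zero x → proj₁ (proj₂ (image x))
    ; (suc l) x → trans (sym (digit-κ (proj₁ (image x)) l)) (trans (cong (λ z → digit 3 2 z l) (proj₂ (proj₂ (image x))))
        (trans (digit-encode 3 2 (λ l → digit 3 2 (κ x) l ⊻ digit 3 2 v l) l) (cong (_⊻ digit 3 2 v l) (digit-κ x l)))) }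
  i≡0 : i ≡ zero
  i≡0 = trivial zero zero
  v≡0 : v ≡ zero
  v≡0 = digit-injective 3 2 λ l → trans (trivial (suc l) zero) (digit-zero l)
    where
    digit-zero : ∀ l → zero ≡ digit 3 2 zero l
    digit-zero zero = refl
    digit-zero (suc zero) = refl
    digit-zero (suc (suc zero)) = refl
  nonzero≢0 : All (λ iv → ⊤ × ¬ (proj₁ iv ≡ zero × proj₂ iv ≡ zero)) nonzero
  nonzero≢0 = toWitness {a? = All.all? (λ iv → yes tt ×-dec ¬? (proj₁ iv ≟ zero ×-dec proj₂ iv ≟ zero)) nonzero} tt

-- Cubic bipartite graphs on 6 + 6 and 7 + 7 vertices

module Cubic (b : ℕ) where

  Row = Vec Bool b
  Partial = Vec (Maybe Row) b

  -- The matrix of a base of two partitions with blocks of size 3. The notion is invariant under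
  -- renaming rows and columns, which lets the search normalize partial matrices.
  record Rigid (M : Fin b → Fin b → Bool) : Set where
    field
      row-sum : ∀ r → tally (M r) ≡ 3
      column-sum : ∀ c → tally (λ r → M r c) ≡ 3
      no-symmetry : (ρ τ : Fin b → Fin b) → Injective _≡_ _≡_ ρ → Injective _≡_ _≡_ τ →
        (∀ r c → M (ρ r) (τ c) ≡ M r c) → (∀ r → ρ r ≡ r) × (∀ c → τ c ≡ c)

  conjugate : Permutation′ b → (Fin b → Fin b) → Fin b → Fin b
  conjugate σ ρ r = σ ⟨$⟩ʳ ρ (σ ⟨$⟩ˡ r)

  conjugate-injective : ∀ σ {ρ} → Injective _≡_ _≡_ ρ → Injective _≡_ _≡_ (conjugate σ ρ)
  conjugate-injective σ ρ-inj eq = trans (sym (inverseʳ σ)) (trans (cong (σ ⟨$⟩ʳ_) (ρ-inj (⟨$⟩ʳ-injective σ eq))) (inverseʳ σ))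

  conjugate-trivial : ∀ σ {ρ} → (∀ r → conjugate σ ρ r ≡ r) → ∀ r → ρ r ≡ r
  conjugate-trivial σ {ρ} triv r = ⟨$⟩ʳ-injective σ (trans (cong (λ r → σ ⟨$⟩ʳ ρ r) (sym (inverseˡ σ))) (triv (σ ⟨$⟩ʳ r)))

  permute-rows : ∀ {M} (σ : Permutation′ b) → Rigid M → Rigid (λ r c → M (σ ⟨$⟩ʳ r) c)
  permute-rows {M} σ R = record
    { row-sum = λ r → R.row-sum (σ ⟨$⟩ʳ r)
    ; column-sum = λ c → trans (tally-permute (λ r → M r c) σ) (R.column-sum c)
    ; no-symmetry = no-symmetry
    }
    where
    module R = Rigid R
    no-symmetry : (ρ τ : Fin b → Fin b) → Injective _≡_ _≡_ ρ → Injective _≡_ _≡_ τ →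
      (∀ r c → M (σ ⟨$⟩ʳ ρ r) (τ c) ≡ M (σ ⟨$⟩ʳ r) c) → (∀ r → ρ r ≡ r) × (∀ c → τ c ≡ c)
    no-symmetry ρ τ ρ-inj τ-inj inv with R.no-symmetry (conjugate σ ρ) τ (conjugate-injective σ ρ-inj) τ-inj
      (λ r c → trans (inv (σ ⟨$⟩ˡ r) c) (cong (λ r → M r c) (inverseʳ σ)))
    ... | ρ-id , τ-id = conjugate-trivial σ ρ-id , τ-id

  permute-columns : ∀ {M} (σ : Permutation′ b) → Rigid M → Rigid (λ r c → M r (σ ⟨$⟩ʳ c))
  permute-columns {M} σ R = record
    { row-sum = λ r → trans (tally-permute (M r) σ) (R.row-sum r)
    ; column-sum = λ c → R.column-sum (σ ⟨$⟩ʳ c)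
    ; no-symmetry = no-symmetry
    }
    where
    module R = Rigid R
    no-symmetry : (ρ τ : Fin b → Fin b) → Injective _≡_ _≡_ ρ → Injective _≡_ _≡_ τ →
      (∀ r c → M (ρ r) (σ ⟨$⟩ʳ τ c) ≡ M r (σ ⟨$⟩ʳ c)) → (∀ r → ρ r ≡ r) × (∀ c → τ c ≡ c)
    no-symmetry ρ τ ρ-inj τ-inj inv with R.no-symmetry ρ (conjugate σ τ) ρ-inj (conjugate-injective σ τ-inj)
      (λ r c → trans (inv r (σ ⟨$⟩ˡ c)) (cong (M r) (inverseʳ σ)))
    ... | ρ-id , τ-id = ρ-id , conjugate-trivial σ τ-id

  entry : Maybe Row → Fin b → Bool
  entry nothing c = false
  entry (just v) c = Vec.lookup v c

  known : Partial → Fin b → Fin b → Bool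
  known K r = entry (Vec.lookup K r)

  Extends : (Fin b → Fin b → Bool) → Partial → Set
  Extends M K = ∀ r v → Vec.lookup K r ≡ just v → ∀ c → M r c ≡ Vec.lookup v c

  infixl 6 _[_]≔′_
  _[_]≔′_ : Partial → Fin b → Row → Partial
  K [ n ]≔′ v = Vec.updateAt K n (λ _ → just v)

  counts : Partial → Vec ℕ b
  counts K = Vec.tabulate λ c → tally λ r → known K r c

  _=ᵇ_ : Bool → Bool → Bool
  true =ᵇ y = y
  false =ᵇ y = not y

  swap : Fin b → Fin b → Row → Row
  swap i j v = Vec.tabulate λ c → Vec.lookup v (transpose i j ⟨$⟩ʳ c)

  agree : Fin b → Fin b → Maybe Row → Bool
  agree i j nothing = true
  agree i j (just v) = Vec.lookup v i =ᵇ Vec.lookup v j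

  exchangeable : Partial → Fin b × Fin b → Bool
  exchangeable K (i , j) = allᵇ λ r → agree i j (Vec.lookup K r)

  pairs : List (Fin b × Fin b)
  pairs = List.filterᵇ (λ (i , j) → does (toℕ i ℕ.<? toℕ j)) (List.cartesianProduct (allFin b) (allFin b))

  same : Row → Row → Bool
  same v w = allᵇ λ c → Vec.lookup v c =ᵇ Vec.lookup w c

  overfull : Vec ℕ b → Row → Bool
  overfull ns v = not (allᵇ λ c → not (Vec.lookup v c) ∨ does (Vec.lookup ns c ℕ.<? 3))

  equivalent : List (Fin b × Fin b) → List Row → Row → Bool
  equivalent ps done v = anyᵇ (λ (i , j) → anyᵇ (same (swap i j v)) done) ps

  Symmetry = Vec (Fin b) b × Vec (Fin b) b

  respects : Partial → Symmetry → Bool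
  respects K (ρ , τ) = allᵇ λ r → allᵇ λ c → known K (Vec.lookup ρ r) (Vec.lookup τ c) =ᵇ known K r c

  first : (Fin b → Bool) → List (Fin b) → Maybe (Fin b)
  first p [] = nothing
  first p (x ∷ xs) = if p x then just x else first p xs

  -- A column already in use is preferred, so that the partial graph grows connectedly and the
  -- branching stays small.
  pick-column : Vec ℕ b → Maybe (Fin b)
  pick-column ns with first (λ c → does (0 ℕ.<? Vec.lookup ns c) ∧ does (Vec.lookup ns c ℕ.<? 3)) (allFin b)
  ... | just c = just c
  ... | nothing = first (λ c → does (Vec.lookup ns c ℕ.<? 3)) (allFin b)

  unknown : Maybe Row → Bool
  unknown nothing = true
  unknown (just _) = false

  branch : (Row → Bool) → Vec ℕ b → List (Fin b × Fin b) → List Row → List Row → Bool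
  branch rec ns ps done [] = true
  branch rec ns ps done (v ∷ vs) = (overfull ns v ∨ (equivalent ps done v ∨ rec v)) ∧ branch rec ns ps (v ∷ done) vs

  -- The rows are filled in the order of the list. By renaming the unknown rows, the next one may be assumed to
  -- contain a given column that is not yet complete; a candidate for it is skipped when exchanging two columns
  -- that agree in all known rows turns it into an earlier candidate.
  search : List Symmetry → List Row → List (Fin b × Fin b) → Partial → List (Fin b) → Bool
  at-column : List Symmetry → List Row → List (Fin b × Fin b) → Partial → Fin b → List (Fin b) → Vec ℕ b → Maybe (Fin b) → Bool
  search syms rows ps K [] = allᵇ (λ r → not (unknown (Vec.lookup K r))) ∧ anyᵇ (respects K) syms
  search syms rows ps K (n ∷ ns) = unknown (Vec.lookup K n) ∧ at-column syms rows ps K n ns (counts K) (pick-column (counts K))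
  at-column syms rows ps K n ns cs nothing = false
  at-column syms rows ps K n ns cs (just c) = does (Vec.lookup cs c ℕ.<? 3) ∧
    branch (λ v → search syms rows ps (K [ n ]≔′ v) ns) cs (List.filterᵇ (exchangeable K) ps) [] (List.filterᵇ (λ v → Vec.lookup v c) rows)

  proper : Symmetry → Bool
  proper (ρ , τ) = (allᵇ λ i → allᵇ λ j → does (Vec.lookup ρ i ≟ Vec.lookup ρ j) ⇒ᵇ does (i ≟ j)) ∧
    ((allᵇ λ i → allᵇ λ j → does (Vec.lookup τ i ≟ Vec.lookup τ j) ⇒ᵇ does (i ≟ j)) ∧
      not (allᵇ λ i → does (Vec.lookup ρ i ≟ i) ∧ does (Vec.lookup τ i ≟ i)))

  =ᵇ-sound : ∀ x y → T (x =ᵇ y) → x ≡ y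
  =ᵇ-sound true true _ = refl
  =ᵇ-sound false false _ = refl

  module _ (syms : List Symmetry) (proper-syms : T (all proper syms)) where

    Refuted : Partial → Set
    Refuted K = ∀ M → Rigid M → Extends M K → ⊥

    known-≤ : ∀ {M K} → Extends M K → ∀ r c → T (known K r c) → M r c ≡ true
    known-≤ {M} {K} ext r c t with Vec.lookup K r in eq
    ... | just v = trans (ext r v eq c) (T⇒≡ t)

    known-≡ : ∀ {M K} → Extends M K → ∀ r → T (not (unknown (Vec.lookup K r))) → ∀ c → known K r c ≡ M r c
    known-≡ {M} {K} ext r t c with Vec.lookup K r in eq
    ... | just v = sym (ext r v eq c)

    -- All rows being known, `M` is the completed matrix, and the listed symmetry is one of `M`. It
    -- is bijective but not the identity by `proper`, against rigidity.
    refute-leaf : ∀ K → T (allᵇ (λ r → not (unknown (Vec.lookup K r))) ∧ anyᵇ (respects K) syms) → Refuted K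
    refute-leaf K t M R ext with T-anyᵇ (respects K) syms (proj₂ (T-∧ {allᵇ (λ r → not (unknown (Vec.lookup K r)))} t))
    ... | (ρ , τ) , s∈ , resp with T-∧ {allᵇ λ i → allᵇ λ j → does (Vec.lookup ρ i ≟ Vec.lookup ρ j) ⇒ᵇ does (i ≟ j)} (T-all proper syms proper-syms s∈)
    ... | ρ-ok , rest with T-∧ {allᵇ λ i → allᵇ λ j → does (Vec.lookup τ i ≟ Vec.lookup τ j) ⇒ᵇ does (i ≟ j)} rest
    ... | τ-ok , moved = contradiction (≡⇒T all-fixed) λ u → subst T (trans (cong not all-fixed) refl) moved
      where
      inj : ∀ (ρ : Vec (Fin b) b) → T (allᵇ λ i → allᵇ λ j → does (Vec.lookup ρ i ≟ Vec.lookup ρ j) ⇒ᵇ does (i ≟ j)) → Injective _≡_ _≡_ (Vec.lookup ρ)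
      inj ρ ok {i} {j} eq = T-does (i ≟ j) (T-or (T-allᵇ (λ j → does (Vec.lookup ρ i ≟ Vec.lookup ρ j) ⇒ᵇ does (i ≟ j))
        (T-allᵇ (λ i → allᵇ λ j → does (Vec.lookup ρ i ≟ Vec.lookup ρ j) ⇒ᵇ does (i ≟ j)) ok i) j) (does-T (Vec.lookup ρ i ≟ Vec.lookup ρ j) eq))
      complete : ∀ r c → known K r c ≡ M r c
      complete r = known-≡ {M} {K} ext r (T-allᵇ (λ r → not (unknown (Vec.lookup K r))) (proj₁ (T-∧ t)) r)
      ids = Rigid.no-symmetry R (Vec.lookup ρ) (Vec.lookup τ) (inj ρ ρ-ok) (inj τ τ-ok) λ r c →
        trans (sym (complete (Vec.lookup ρ r) (Vec.lookup τ c))) (trans (=ᵇ-sound (known K (Vec.lookup ρ r) (Vec.lookup τ c)) (known K r c)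
          (T-allᵇ (λ c → known K (Vec.lookup ρ r) (Vec.lookup τ c) =ᵇ known K r c) (T-allᵇ (λ r → allᵇ λ c → known K (Vec.lookup ρ r) (Vec.lookup τ c) =ᵇ known K r c) resp r) c)) (complete r c))
      all-fixed : (allᵇ λ i → does (Vec.lookup ρ i ≟ i) ∧ does (Vec.lookup τ i ≟ i)) ≡ true
      all-fixed = T⇒≡ (T-allᵇ⁻ (λ i → does (Vec.lookup ρ i ≟ i) ∧ does (Vec.lookup τ i ≟ i)) λ i → both (Vec.lookup ρ i ≟ i) (Vec.lookup τ i ≟ i) (proj₁ ids i) (proj₂ ids i))
        where
        both : ∀ {P Q : Set} (P? : Dec P) (Q? : Dec Q) → P → Q → T (does P? ∧ does Q?)
        both (yes _) (yes _) _ _ = tt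
        both (no ¬p) _ p _ = ¬p p
        both (yes _) (no ¬q) _ q = ¬q q

    extend : ∀ {M K n} v → (∀ c → M n c ≡ Vec.lookup v c) → (∀ r w → r ≢ n → Vec.lookup K r ≡ just w → ∀ c → M r c ≡ Vec.lookup w c) → Extends M (K [ n ]≔′ v)
    extend {M} {K} {n} v new old r w eq c with r ≟ n
    ... | yes refl with trans (sym (lookup∘updateAt n K)) eq
    ...   | refl = new c
    extend {M} {K} {n} v new old r w eq c | no r≢n = old r w r≢n (trans (sym (lookup∘updateAt′ r n r≢n K)) eq) c

    unknown-nothing : ∀ (m : Maybe Row) {v} → T (unknown m) → m ≢ just v
    unknown-nothing nothing _ ()

    entry-unknown : ∀ m → T (unknown m) → ∀ c → entry m c ≡ false
    entry-unknown nothing _ c = refl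

    -- Row `n` is new, so an entry of `v` raises the number of known entries of its column; as `M`
    -- has three there, fewer than three were known before.
    refute-overfull : ∀ K n v → T (unknown (Vec.lookup K n)) → T (overfull (counts K) v) → Refuted (K [ n ]≔′ v)
    refute-overfull K n v unk t M R ext = contradiction (T-allᵇ⁻ (λ c → not (Vec.lookup v c) ∨ does (Vec.lookup (counts K) c ℕ.<? 3)) fits)
        (λ u → subst T (trans (cong not (T⇒≡ u)) refl) t)
      where
      M-n : ∀ c → M n c ≡ Vec.lookup v c
      M-n = ext n v (lookup∘updateAt n K)
      before : Extends M K
      before r w eq = ext r w (trans (lookup∘updateAt′ r n (λ { refl → unknown-nothing (Vec.lookup K r) unk eq }) K) eq)
      n-unknown : ∀ c → known K n c ≡ false
      n-unknown = entry-unknown (Vec.lookup K n) unk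
      fits : ∀ c → T (not (Vec.lookup v c) ∨ does (Vec.lookup (counts K) c ℕ.<? 3))
      fits c with Vec.lookup v c in eq
      ... | false = tt
      ... | true = does-T (Vec.lookup (counts K) c ℕ.<? 3) (ℕ.≤-trans (s≤s (ℕ.≤-reflexive (lookup∘tabulate (λ c → tally λ r → known K r c) c)))
        (ℕ.≤-trans (tally-strict {p = λ r → known K r c} {q = λ r → M r c} (λ r u → ≡⇒T (known-≤ {M} {K} before r c u)) n (n-unknown c) (trans (M-n c) eq)) (ℕ.≤-reflexive (Rigid.column-sum R c))))

    transpose-agree : ∀ (w : Row) i j → Vec.lookup w i ≡ Vec.lookup w j → ∀ c → Vec.lookup w (transpose i j ⟨$⟩ʳ c) ≡ Vec.lookup w c
    transpose-agree w i j eq c with c ≟ i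
    ... | yes refl = sym eq
    ... | no _ with c ≟ j
    ...   | yes refl = eq
    ...   | no _ = refl

    -- Exchanging the columns `i` and `j` of `M` leaves the known rows as they are and turns `v`
    -- into the earlier candidate `w`, which is already refuted.
    refute-equivalent : ∀ K n v done → (∀ {w} → w ∈ done → Refuted (K [ n ]≔′ w)) → T (unknown (Vec.lookup K n)) →
      T (equivalent (List.filterᵇ (exchangeable K) pairs) done v) → Refuted (K [ n ]≔′ v)
    refute-equivalent K n v done refuted unk t M R ext with T-anyᵇ (λ (i , j) → anyᵇ (same (swap i j v)) done) (List.filterᵇ (exchangeable K) pairs) t
    ... | (i , j) , p∈ , t′ with T-anyᵇ (same (swap i j v)) done t′
    ... | w , w∈ , eq = refuted w∈ (λ r c → M r (transpose i j ⟨$⟩ʳ c)) (permute-columns (transpose i j) R) (extend {K = K} {n = n} w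
        (λ c → trans (ext n v (lookup∘updateAt n K) (transpose i j ⟨$⟩ʳ c)) (trans (sym (lookup∘tabulate (λ c → Vec.lookup v (transpose i j ⟨$⟩ʳ c)) c))
          (=ᵇ-sound (Vec.lookup (swap i j v) c) (Vec.lookup w c) (T-allᵇ (λ c → Vec.lookup (swap i j v) c =ᵇ Vec.lookup w c) eq c))))
        (λ r u r≢n K≡ c → trans (ext r u (trans (lookup∘updateAt′ r n r≢n K) K≡) (transpose i j ⟨$⟩ʳ c)) (transpose-agree u i j (agreement r K≡) c)))
      where
      exch : T (exchangeable K (i , j))
      exch = proj₂ (∈.∈-filter⁻ (λ p → T? (exchangeable K p)) {xs = pairs} p∈)
      agreement : ∀ r {u} → Vec.lookup K r ≡ just u → Vec.lookup u i ≡ Vec.lookup u j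
      agreement r {u} eq = =ᵇ-sound (Vec.lookup u i) (Vec.lookup u j) (subst (λ m → T (agree i j m)) eq (T-allᵇ (λ r → agree i j (Vec.lookup K r)) exch r))

    refute-branch : ∀ (rec : Row → Bool) K n → T (unknown (Vec.lookup K n)) → (∀ v → T (rec v) → Refuted (K [ n ]≔′ v)) →
      ∀ done → (∀ {w} → w ∈ done → Refuted (K [ n ]≔′ w)) → ∀ vs → T (branch rec (counts K) (List.filterᵇ (exchangeable K) pairs) done vs) →
      ∀ {v} → v ∈ vs → Refuted (K [ n ]≔′ v)
    refute-branch rec K n unk rec-ok done done-ok (v ∷ vs) t v∈ with T-∧ {overfull (counts K) v ∨ (equivalent (List.filterᵇ (exchangeable K) pairs) done v ∨ rec v)} t
    ... | now , later = go v∈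
      where
      v-ok : Refuted (K [ n ]≔′ v)
      v-ok with T-∨ {overfull (counts K) v} now
      ... | inj₁ over = refute-overfull K n v unk over
      ... | inj₂ now′ with T-∨ {equivalent (List.filterᵇ (exchangeable K) pairs) done v} now′
      ...   | inj₁ equiv = refute-equivalent K n v done done-ok unk equiv
      ...   | inj₂ solved = rec-ok v solved
      go : ∀ {u} → u ∈ (v ∷ vs) → Refuted (K [ n ]≔′ u)
      go (Any.here refl) = v-ok
      go (Any.there u∈) = refute-branch rec K n unk rec-ok (v ∷ done) (λ { (Any.here refl) → v-ok ; (Any.there w∈) → done-ok w∈ }) vs later u∈

    search-sound : ∀ K ns → T (search syms (ofWeight b 3) pairs K ns) → Refuted K
    search-sound K [] t = refute-leaf K t
    search-sound K (n ∷ ns) t M R ext with T-∧ {unknown (Vec.lookup K n)} t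
    ... | unk , t′ with pick-column (counts K)
    ... | just c with T-∧ {does (Vec.lookup (counts K) c ℕ.<? 3)} t′
    ... | c<3 , br = refute-branch (λ v → search syms (ofWeight b 3) pairs (K [ n ]≔′ v) ns) K n unk (λ v → search-sound (K [ n ]≔′ v) ns) [] (λ ())
        (List.filterᵇ (λ v → Vec.lookup v c) (ofWeight b 3)) br
        (∈.∈-filter⁺ (λ v → T? (Vec.lookup v c)) (∈-ofWeight v 3 (trans (tally-cong (lookup∘tabulate (M′ n))) (Rigid.row-sum R′ n)))
          (subst T (sym (lookup∘tabulate (M′ n) c)) M′nc))
        M′ R′ (extend {K = K} {n = n} v (λ c → sym (lookup∘tabulate (M′ n) c)) unchanged)
      where
      few : tally (λ r → known K r c) < 3
      few = subst (_< 3) (lookup∘tabulate (λ c → tally λ r → known K r c) c) (T-does (Vec.lookup (counts K) c ℕ.<? 3) c<3)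
      -- Column `c` has three entries in `M` but fewer known ones, so some unknown row has an entry
      -- there. This row is renamed to `n` in `M′`.
      new-row : ∃ λ r → T (M r c) × known K r c ≡ false
      new-row with any? (λ r → T? (M r c) ×-dec known K r c Bool.≟ false)
      ... | yes found = found
      ... | no ∄ = contradiction few (ℕ.≤⇒≯ (ℕ.≤-trans (ℕ.≤-reflexive (sym (Rigid.column-sum R c))) (tally-mono known-if)))
        where
        known-if : ∀ r → T (M r c) → T (known K r c)
        known-if r t with known K r c in eq
        ... | true = tt
        ... | false = ⊥-elim (∄ (r , t , eq))
      r₀ = proj₁ new-row
      M′ : Fin b → Fin b → Bool
      M′ r c = M (transpose n r₀ ⟨$⟩ʳ r) c
      R′ : Rigid M′
      R′ = permute-rows (transpose n r₀) R
      v : Row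
      v = Vec.tabulate (M′ n)
      M′nc : T (M′ n c)
      M′nc = subst (λ r → T (M r c)) (sym (transpose-left n r₀)) (proj₁ (proj₂ new-row))
      unchanged : ∀ r w → r ≢ n → Vec.lookup K r ≡ just w → ∀ c → M′ r c ≡ Vec.lookup w c
      unchanged r w r≢n eq c′ with r ≟ n
      ... | yes r≡n = contradiction r≡n r≢n
      ... | no _ with r ≟ r₀
      ...   | no _ = ext r w eq c′
      -- The row `r₀` cannot be a known one, since its entry in column `c` is not among the known
      -- entries.
      ...   | yes refl = contradiction (trans (sym (T⇒≡ (subst (λ m → T (entry m c)) (sym eq) (≡⇒T (trans (sym (ext r w eq c)) (T⇒≡ (proj₁ (proj₂ new-row)))))))) (proj₂ (proj₂ new-row))) λ ()

    no-cubic-base : T (search syms (ofWeight b 3) pairs (Vec.replicate b nothing) (allFin b)) → ¬ HasBaseOfSize 3 b 2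
    no-cubic-base t h = search-sound (Vec.replicate b nothing) (allFin b) t matrix rigid (λ r v eq → contradiction (trans (sym (lookup-replicate r nothing)) eq) λ ())
      where
      F = proj₁ (toFamily h)
      isBase = proj₂ (toFamily h)
      code-inj : CodeInjective F
      code-inj = base⇒code-injective F isBase
      f₀ = label F zero
      f₁ = label F (suc zero)
      injective : ∀ {x y} → f₀ x ≡ f₀ y → f₁ x ≡ f₁ y → x ≡ y
      injective p q = code-inj λ { zero → p ; (suc zero) → q }
      open Rows f₀ f₁ injective
      rigid : Rigid matrix
      rigid = record { row-sum = row-sum ; column-sum = column-sum ; no-symmetry = no-symmetry }
        where
        row-sum : ∀ r → tally (matrix r) ≡ 3
        row-sum r = trans (tally-cong λ z → sym (∧-identityʳ (matrix r z)))
          (trans (tally-row {λ _ → ⊤} (λ _ → yes tt) r) (trans (count-cong (λ x → f₀ x ≟ r ×-dec yes tt) (λ x → f₀ x ≟ r) (λ _ → proj₁) (λ _ p → p , tt)) (proj₂ (F zero) r)))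
        column-sum : ∀ c → tally (λ r → matrix r c) ≡ 3
        column-sum c = trans (sym (count≡tally (λ r → entry? r c))) (trans (ℕ.≤-antisym
          (count-≤ (λ r → entry? r c) (λ x → f₁ x ≟ c) (λ _ → proj₁) (λ _ e → proj₂ (proj₂ e)) (λ { r r′ (x , p , _) (_ , p′ , _) refl → trans (sym p) p′ }))
          (count-≤ (λ x → f₁ x ≟ c) (λ r → entry? r c) (λ x _ → f₀ x) (λ x p → x , refl , p) (λ x y p q eq → code-inj λ { zero → eq ; (suc zero) → trans p (sym q) })))
          (proj₂ (F (suc zero)) c))
        no-symmetry : (ρ τ : Fin b → Fin b) → Injective _≡_ _≡_ ρ → Injective _≡_ _≡_ τ → (∀ r c → matrix (ρ r) (τ c) ≡ matrix r c) → (∀ r → ρ r ≡ r) × (∀ c → τ c ≡ c)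
        no-symmetry ρ τ ρ-inj τ-inj inv = trivial zero , trivial (suc zero)
          where
          π : Fin 2 → Fin b → Fin b
          π zero = ρ
          π (suc zero) = τ
          image : ∀ x → Entry (ρ (f₀ x)) (τ (f₁ x))
          image x = T-does (entry? (ρ (f₀ x)) (τ (f₁ x))) (subst T (sym (inv (f₀ x) (f₁ x))) (does-T (entry? (f₀ x) (f₁ x)) (x , refl , refl)))
          trivial : ∀ l j → π l j ≡ j
          trivial = base⇒rigid F (s≤s z≤n) isBase π (λ { zero → ρ-inj ; (suc zero) → τ-inj }) (λ x → proj₁ (image x))
            λ { zero x → proj₁ (proj₂ (image x)) ; (suc zero) x → proj₂ (proj₂ (image x)) }

-- Permutations are encoded by their decimal digits, the last digit being the image of 0.
decode : ∀ {n} m → ℕ → Vec (Fin (suc n)) m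
decode zero k = Vec.[]
decode {n} (suc m) k = clamp n (k % 10) Vec.∷ decode m (k / 10)
  where
  -- Digits above `n` become `n`, which keeps decoding total; a list spoiled in this way so that it
  -- is no permutation would be rejected by `proper`.
  clamp : ∀ n → ℕ → Fin (suc n)
  clamp n zero = zero
  clamp zero (suc k) = zero
  clamp (suc n) (suc k) = suc (clamp n k)

decode₂ : ∀ n → List (ℕ × ℕ) → List (Vec (Fin (suc n)) (suc n) × Vec (Fin (suc n)) (suc n))
decode₂ n = List.map λ (ρ , τ) → decode (suc n) ρ , decode (suc n) τ

-- Chosen so that every matrix completed by search has one of these symmetries (a row and a column permutation).
symmetries₆ : List (ℕ × ℕ)
symmetries₆ =
  (453210 , 543210) ∷ (543120 , 543210) ∷ (453201 , 542310) ∷ (452301 , 452301) ∷ (534210 , 534120)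
  ∷ (345201 , 521430) ∷ (140253 , 43215) ∷ (132405 , 301452) ∷ (543210 , 543201) ∷ (12435 , 21345)
  ∷ (102453 , 32145) ∷ (210345 , 14325) ∷ (14325 , 120354) ∷ (132054 , 104352) ∷ (312045 , 104352)
  ∷ (210534 , 14325) ∷ (24135 , 12543) ∷ (321405 , 310542) ∷ (510243 , 42315) ∷ (301542 , 214305)
  ∷ (130524 , 403125) ∷ (402351 , 152304) ∷ (412305 , 401532) ∷ (23415 , 103254) ∷ (203514 , 203514)
  ∷ (42315 , 103254) ∷ (125403 , 402351) ∷ (25431 , 251034) ∷ (240513 , 203514)
  ∷ []

symmetries₇ : List (ℕ × ℕ)
symmetries₇ =
  (6543210 , 5643210) ∷ (5643210 , 6543210) ∷ (6543210 , 6543120) ∷ (6543210 , 6534210) ∷ (6543210 , 6543201)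
  ∷ (6543120 , 6543210) ∷ (5634120 , 3456210) ∷ (6452310 , 6453201) ∷ (6452301 , 6452301) ∷ (6453210 , 6543210)
  ∷ (234516 , 1203564) ∷ (6453120 , 6453120) ∷ (6543120 , 6453210) ∷ (1234560 , 3456012) ∷ (2134650 , 3456012)
  ∷ (5643120 , 6453210) ∷ (6345120 , 6453120) ∷ (6534210 , 6543210) ∷ (5612340 , 3456201) ∷ (6534120 , 6453210)
  ∷ (5621430 , 3456201) ∷ (3456120 , 3456120) ∷ (4365120 , 3456120) ∷ (6543201 , 6543210) ∷ (213546 , 142356)
  ∷ (123456 , 142356) ∷ (6543210 , 6453210) ∷ (6543012 , 6543210) ∷ (4563201 , 6521430) ∷ (5634201 , 5621430)
  ∷ (2041635 , 315246) ∷ (325416 , 1203564) ∷ (3456012 , 1234560) ∷ (4365012 , 1234560) ∷ (6453201 , 6452310)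
  ∷ (5634120 , 5634120) ∷ (6453210 , 5643210) ∷ (534126 , 2510643) ∷ (345126 , 2510643) ∷ (315246 , 1042365)
  ∷ (142356 , 123456) ∷ (1042365 , 134256) ∷ (521436 , 241536) ∷ (6542310 , 6543201) ∷ (6542310 , 5643201)
  ∷ (6452310 , 5643201) ∷ (4563012 , 6234510) ∷ (6541230 , 4563201) ∷ (6543012 , 6243510) ∷ (2163405 , 3501462)
  ∷ (6453210 , 6543120) ∷ (2516304 , 3502641) ∷ (134256 , 1023465) ∷ (6345210 , 6543120) ∷ (3456201 , 5612340)
  ∷ (4365201 , 5612340) ∷ (2013645 , 142356) ∷ (142356 , 213546) ∷ (6315042 , 6315042) ∷ (3516042 , 6315042)
  ∷ (5634012 , 5621430) ∷ (4365012 , 5621430) ∷ (1042365 , 315246) ∷ (1502364 , 3016245) ∷ (5621430 , 5634012)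
  ∷ (3016245 , 1042365) ∷ (5621430 , 3456012) ∷ (2510643 , 534126) ∷ (6210543 , 534126) ∷ (5620413 , 5620413)
  ∷ (134256 , 1042365) ∷ (4260513 , 5620413) ∷ (241536 , 241536) ∷ (1502364 , 315246) ∷ (2540613 , 2540613)
  ∷ (1406235 , 3051264) ∷ (1360245 , 1403625) ∷ (1403625 , 1360245) ∷ (4013562 , 1263045) ∷ (2403165 , 4015263)
  ∷ (1056234 , 3051264) ∷ (1630254 , 1403625) ∷ (5103462 , 1263045) ∷ (6451032 , 6452301) ∷ (4651203 , 6420531)
  ∷ (4365201 , 5621430) ∷ (2501634 , 3016245) ∷ (5612340 , 4365012) ∷ (6512340 , 5643012) ∷ (2041635 , 512346)
  ∷ (1520463 , 345126) ∷ (6541230 , 6543201) ∷ (4160253 , 4062315) ∷ (5610243 , 4062315) ∷ (2053164 , 1056234)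
  ∷ (3402615 , 1630254) ∷ (3052614 , 1630254) ∷ (2360415 , 1530624) ∷ (5204613 , 2504163) ∷ (2613504 , 3501462)
  ∷ (2403165 , 1056234) ∷ (512346 , 123456) ∷ (2501634 , 451236) ∷ (1540263 , 2043615) ∷ (1246035 , 3041562)
  ∷ (2103654 , 325416) ∷ (1526034 , 3042651) ∷ (2013645 , 315246) ∷ (3042651 , 1526034) ∷ (1023465 , 134256)
  ∷ (1203564 , 234516) ∷ (325416 , 2103654) ∷ (315246 , 2013645) ∷ (142356 , 142356) ∷ (241536 , 512346)
  ∷ (512346 , 241536) ∷ (521436 , 521436) ∷ (452316 , 2103654) ∷ (451236 , 2013645) ∷ (4013562 , 1246035)
  ∷ (2156340 , 5346021) ∷ (1265340 , 5346021) ∷ (1256430 , 4536021) ∷ (4321650 , 3564102) ∷ (213546 , 512346)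
  ∷ (2156340 , 3564021) ∷ (4312560 , 4536102) ∷ (1256430 , 3645021) ∷ (4321650 , 5346102) ∷ (2140653 , 325416)
  ∷ (2561403 , 3502641) ∷ (4321650 , 3645102) ∷ (1256430 , 5346021) ∷ (2165430 , 3564021) ∷ (1256430 , 3564021)
  ∷ (4510362 , 2146305) ∷ (1240563 , 234516) ∷ (512346 , 521436) ∷ (1265340 , 4536021) ∷ (2156340 , 4536021)
  ∷ (4312560 , 5346102) ∷ (2156340 , 3645021) ∷ (2450613 , 5640123) ∷ (3645102 , 3412650) ∷ (4536021 , 1256430)
  ∷ (3564021 , 2156340) ∷ (3645021 , 1256430) ∷ (3546201 , 6521430) ∷ (3564102 , 3412650) ∷ (5463021 , 2165430)
  ∷ (4653021 , 2165430) ∷ (3564021 , 1256430)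
  ∷ []

no-base-3-6 : ¬ HasBaseOfSize 3 6 2
no-base-3-6 = Cubic.no-cubic-base 6 (decode₂ 5 symmetries₆) tt tt

no-base-3-7 : ¬ HasBaseOfSize 3 7 2
no-base-3-7 = Cubic.no-cubic-base 7 (decode₂ 6 symmetries₇) tt tt

-- Assembling the exact base sizes

n≤2^⌈log₂n⌉ : ∀ n → n ≤ 2 ^ ⌈log₂ n ⌉
n≤2^⌈log₂n⌉ = <-rec (λ n → n ≤ 2 ^ ⌈log₂ n ⌉) step
  where
  step : ∀ n → (∀ {m} → m < n → m ≤ 2 ^ ⌈log₂ m ⌉) → n ≤ 2 ^ ⌈log₂ n ⌉
  step zero _ = z≤n
  step (suc zero) _ = s≤s z≤n
  step n@(suc (suc n′)) rec = begin
    n ≡⟨ sym (ℕ.⌊n/2⌋+⌈n/2⌉≡n n) ⟩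
    ⌊ n /2⌋ + h ≤⟨ ℕ.+-monoˡ-≤ h (ℕ.⌊n/2⌋≤⌈n/2⌉ n) ⟩
    h + h ≡⟨ cong (h +_) (sym (ℕ.+-identityʳ h)) ⟩
    2 * h ≤⟨ ℕ.*-monoʳ-≤ 2 (rec (ℕ.⌈n/2⌉<n n′)) ⟩
    2 ^ suc ⌈log₂ h ⌉ ≡⟨ cong (λ k → 2 ^ suc k) (⌈log₂⌈n/2⌉⌉≡⌈log₂n⌉∸1 n) ⟩
    2 ^ suc (⌈log₂ n ⌉ ∸ 1) ≡⟨ cong (2 ^_) (ℕ.m+[n∸m]≡n {1} (⌈log₂⌉-mono-≤ (s≤s (s≤s (z≤n {n′}))))) ⟩
    2 ^ ⌈log₂ n ⌉ ∎
    where
    open ℕ.≤-Reasoning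
    h = ⌈ n /2⌉

-- By `lower-bound`, a smaller base could only have a size `suc m` with `a + 2 ≤ b ^ m`, so nothing
-- else remains to be excluded.
minimal : ∀ {a b k} → 1 ≤ a → 2 ≤ b → HasBaseOfSize a b k →
  (∀ m → a + 2 ≤ b ^ m → suc m < k → ¬ HasBaseOfSize a b (suc m)) → BaseSize a b k
minimal 1≤a 2≤b h none = h , λ m m<k h′ → case lower-bound 1≤a 2≤b h′ of λ { (m′ , refl , bound) → none m′ bound m<k h′ }

two-of-many : ∀ {b} k → 3 ≤ b → ¬ (b ≡ 3 × k ≡ 0) → HasBaseOfSize 2 b (3 + k)
two-of-many {b} k 3≤b exc with ℕ.m≤n⇒m<n∨m≡n 3≤b
... | inj₁ 4≤b = base-mono (ℕ.m≤m+n 3 k) (matchings-base b 4≤b)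
two-of-many zero 3≤b exc | inj₂ refl = contradiction (refl , refl) exc
two-of-many (suc k) 3≤b exc | inj₂ refl = base-mono (ℕ.m≤m+n 4 k) base-2-3

-- Modulo 3 the values 4 and 5 leave the remainders 1 and 2, and they are complements of each other
-- (4 + 5 = 9). Hence one explicit base settles both.
middle-3 : ∀ a → 3 ≤ a → a + 3 ≤ 9 → HasBaseOfSize a 3 3
middle-3 3 3≤a a+3≤9 = middle 0 3 ℕ.≤-refl 3≤a a+3≤9 λ { (inj₁ ()) ; (inj₂ ()) }
middle-3 4 _ _ = base-4-3
middle-3 5 _ _ = complement (s≤s z≤n) (s≤s z≤n) refl base-4-3
middle-3 6 3≤a a+3≤9 = middle 0 3 ℕ.≤-refl 3≤a a+3≤9 λ { (inj₁ ()) ; (inj₂ ()) }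
middle-3 (suc (suc (suc (suc (suc (suc (suc a))))))) _ p = contradiction p (ℕ.<⇒≱ (ℕ.≤-trans (ℕ.m≤m+n 10 a) (ℕ.≤-reflexive (ℕ.+-comm 3 (7 + a)))))
middle-3 1 (s≤s ()) _
middle-3 2 (s≤s (s≤s ())) _

-- Modulo 4 only the remainder 2 fails the test of `middle`. In the range it occurs for 6 and 10,
-- which are complements of each other (6 + 10 = 16).
middle-4 : ∀ a → 3 ≤ a → a + 3 ≤ 16 → HasBaseOfSize a 4 3
middle-4 a 3≤a a+3≤16 with a ℕ.≟ 6 | a ℕ.≟ 10
... | yes refl | _ = base-6-4
... | no _ | yes refl = complement (s≤s z≤n) (s≤s z≤n) refl base-6-4
... | no a≢6 | no a≢10 = middle 0 4 (ℕ.n≤1+n 3) 3≤a a+3≤16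
      (subst (λ a → 3 ≤ a → a ≢ 6 → a ≢ 10 → Small a) (Fin.toℕ-fromℕ< a<14) (small (fromℕ< a<14)) 3≤a a≢6 a≢10)
  where
  Small : ℕ → Set
  Small a = a % 4 ≡ 1 ⊎ a % 4 ≡ 2 → a % 4 + 3 ≤ 4
  a<14 : a < 14
  a<14 = ℕ.+-cancelʳ-≤ 3 (suc a) 14 (s≤s a+3≤16)
  small : ∀ (i : Fin 14) → 3 ≤ toℕ i → toℕ i ≢ 6 → toℕ i ≢ 10 → Small (toℕ i)
  small = toWitness {a? = all? {14} λ i → (3 ℕ.≤? toℕ i) →-dec (¬? (toℕ i ℕ.≟ 6) →-dec (¬? (toℕ i ℕ.≟ 10) →-dec
    ((toℕ i % 4 ℕ.≟ 1 ⊎-dec toℕ i % 4 ℕ.≟ 2) →-dec (toℕ i % 4 + 3 ℕ.≤? 4))))} tt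

-- Once `b ^ suc k` is at least 5, the remainders 1 and 2 pass the test of `middle`. As `b ≥ 3`,
-- only `k = 0` with `b = 3` or `b = 4` is left.
middle-all : ∀ {a b} k → 3 ≤ b → 3 ≤ a → a + 3 ≤ b ^ (2 + k) → HasBaseOfSize a b (3 + k)
middle-all {a} {b} k 3≤b 3≤a a+3≤ with 5 ℕ.≤? b ^ suc k
... | yes 5≤B = middle k b 3≤b 3≤a a+3≤ λ { (inj₁ eq) → ℕ.≤-trans (ℕ.+-monoˡ-≤ 3 (ℕ.≤-trans (ℕ.≤-reflexive eq) (ℕ.n≤1+n 1))) 5≤B ; (inj₂ eq) → ℕ.≤-trans (ℕ.+-monoˡ-≤ 3 (ℕ.≤-reflexive eq)) 5≤B }
... | no 5≰B = small k a+3≤ 5≰B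
  where
  small : ∀ k → a + 3 ≤ b ^ (2 + k) → ¬ 5 ≤ b ^ suc k → HasBaseOfSize a b (3 + k)
  small (suc k) _ 5≰B = contradiction (ℕ.≤-trans (ℕ.m≤m+n 5 4) (ℕ.≤-trans (ℕ.^-monoˡ-≤ 2 3≤b) (ℕ.^-monoʳ-≤ b {{>-nonZero (ℕ.≤-trans (s≤s z≤n) 3≤b)}} (s≤s (s≤s (z≤n {k})))))) 5≰B
  small zero a+3≤ 5≰B with ℕ.m≤n⇒m<n∨m≡n 3≤b
  ... | inj₂ refl = middle-3 a 3≤a a+3≤
  ... | inj₁ 4≤b with ℕ.m≤n⇒m<n∨m≡n 4≤b
  ...   | inj₂ refl = middle-4 a 3≤a a+3≤
  ...   | inj₁ 5≤b = contradiction (ℕ.≤-trans 5≤b (ℕ.≤-reflexive (sym (ℕ.*-identityʳ b)))) 5≰B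

-- The extreme values `a = 2` and `a = b ^ (2 + k) - 2` are complements and come from matchings. The
-- exceptions for `b = 3` are the three matchings of six points and their complement.
three-or-more : ∀ {a b} k → 3 ≤ b → 2 ≤ a → a + 2 ≤ b ^ (2 + k) → ¬ (b ≡ 3 × k ≡ 0 × (a ≡ 2 ⊎ a ≡ 7)) → HasBaseOfSize a b (3 + k)
three-or-more {a} {b} k 3≤b 2≤a a+2≤ exc with ℕ.m≤n⇒m<n∨m≡n 2≤a | ℕ.m≤n⇒m<n∨m≡n a+2≤
... | inj₂ refl | _ = two-of-many k 3≤b λ (p , q) → exc (p , q , inj₁ refl)
... | inj₁ 3≤a | inj₂ eq = complement (s≤s z≤n) (ℕ.<⇒≤ 2≤a) (trans (ℕ.+-comm 2 a) eq)
      (two-of-many k 3≤b λ { (refl , refl) → exc (refl , refl , inj₂ (ℕ.+-cancelʳ-≡ 2 a 7 eq)) })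
... | inj₁ 3≤a | inj₁ lt = middle-all k 3≤b 3≤a (ℕ.≤-trans (ℕ.≤-reflexive (ℕ.+-suc a 2)) lt)

-- The bound `a + 2 ≤ 2 ^ m` is never attained: with equality the complement would be a base for two
-- blocks of two points. This turns `a + 2` into `a + 3` under the logarithm.
binary : ∀ a → 2 ≤ a → a ≢ 2 → a ≢ 4 → BaseSize a 2 (suc ⌈log₂ (a + 3) ⌉)
binary a 2≤a a≢2 a≢4 = minimal (ℕ.<⇒≤ 2≤a) ℕ.≤-refl (has ⌈log₂ (a + 3) ⌉ refl) λ m a+2≤ m<k h → case ℕ.m≤n⇒m<n∨m≡n a+2≤ of λ
  { (inj₁ lt) → ℕ.<⇒≱ (ℕ.≤-pred m<k) (ℕ.≤-trans (⌈log₂⌉-mono-≤ (ℕ.≤-trans (ℕ.≤-reflexive (ℕ.+-suc a 2)) lt)) (ℕ.≤-reflexive (⌈log₂2^n⌉≡n m)))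
  ; (inj₂ eq) → no-base-2-2 (suc m) (complement (ℕ.<⇒≤ 2≤a) (s≤s z≤n) eq h) }
  where
  3≤a : 3 ≤ a
  3≤a = ℕ.≤∧≢⇒< 2≤a λ eq → a≢2 (sym eq)
  6≤ : 6 ≤ a + 3
  6≤ = ℕ.+-monoˡ-≤ 3 3≤a
  bound : ∀ {j} → ⌈log₂ (a + 3) ⌉ ≡ j → a + 3 ≤ 2 ^ j
  bound refl = n≤2^⌈log₂n⌉ (a + 3)
  has : ∀ j → ⌈log₂ (a + 3) ⌉ ≡ j → HasBaseOfSize a 2 (suc j)
  has zero eq = contradiction (ℕ.≤-trans 6≤ (bound eq)) λ { (s≤s ()) }
  has (suc zero) eq = contradiction (ℕ.≤-trans 6≤ (bound eq)) λ { (s≤s (s≤s ())) }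
  has (suc (suc zero)) eq = contradiction (ℕ.≤-trans 6≤ (bound eq)) λ { (s≤s (s≤s (s≤s (s≤s ())))) }
  has (suc (suc (suc k))) eq = two-blocks (suc k) (s≤s z≤n) 3≤a (bound eq) λ (a≡4 , _) → a≢4 a≡4

generic : (a b : ℕ) → 3 ≤ a → 3 ≤ b
  → ¬ (a ≡ 3 × b ≡ 6) → ¬ (a ≡ 3 × b ≡ 7) → ¬ (a ≡ 4 × b ≡ 7) → ¬ (a ≡ 7 × b ≡ 3) → b ≢ a + 2
  → (k : ℕ) → IsCeilLog b (a + 2) k → BaseSize a b (suc k)
generic a b 3≤a 3≤b ≢36 ≢37 ≢47 ≢73 b≢a+2 k (a+2≤b^k , least) =
  minimal (ℕ.≤-trans (s≤s z≤n) 3≤a) (ℕ.<⇒≤ 3≤b) (has k a+2≤b^k) λ m a+2≤ m<k _ → ℕ.<⇒≱ (ℕ.≤-pred m<k) (least m a+2≤)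
  where
  has : ∀ k → a + 2 ≤ b ^ k → HasBaseOfSize a b (suc k)
  has zero p = contradiction (ℕ.≤-trans (ℕ.+-monoˡ-≤ 2 3≤a) p) λ { (s≤s ()) }
  has (suc zero) p = two-partitions a b 3≤a a+3≤b (8≤ b (ℕ.m≤n⇒∃[o]m+o≡n 3≤a) refl)
    where
    a+2≤b : a + 2 ≤ b
    a+2≤b = ℕ.≤-trans p (ℕ.≤-reflexive (ℕ.*-identityʳ b))
    a+3≤b : a + 3 ≤ b
    a+3≤b = ℕ.≤-trans (ℕ.≤-reflexive (ℕ.+-suc a 2)) (ℕ.≤∧≢⇒< a+2≤b λ eq → b≢a+2 (sym eq))
    -- From `a + 3 ≤ b` and the excluded pairs: for a = 3 the values 6 and 7 are removed, for a = 4
    -- the value 7, and from a = 5 on the bound is automatic.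
    8≤ : ∀ b′ → (∃ λ o → 3 + o ≡ a) → b ≡ b′ → 8 ≤ b′
    8≤ b′ (zero , refl) refl = ℕ.≤∧≢⇒< (ℕ.≤∧≢⇒< a+3≤b λ eq → ≢36 (refl , sym eq)) λ eq → ≢37 (refl , sym eq)
    8≤ b′ (suc zero , refl) refl = ℕ.≤∧≢⇒< a+3≤b λ eq → ≢47 (refl , sym eq)
    8≤ b′ (suc (suc o) , refl) refl = ℕ.≤-trans (ℕ.≤-trans (ℕ.m≤m+n 8 o) (ℕ.≤-reflexive (ℕ.+-comm 3 (5 + o)))) a+3≤b
  has (suc (suc k)) p = three-or-more k 3≤b (ℕ.<⇒≤ 3≤a) p λ
    { (_ , _ , inj₁ refl) → contradiction 3≤a λ { (s≤s (s≤s ())) } ; (b≡3 , _ , inj₂ a≡7) → ≢73 (a≡7 , b≡3) }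

three-minimal : ∀ {a b} → 2 ≤ a → 3 ≤ b → a + 2 ≤ b ^ 2 → ¬ (b ≡ 3 × (a ≡ 2 ⊎ a ≡ 7)) → ¬ HasBaseOfSize a b 2 → BaseSize a b 3
three-minimal {a} {b} 2≤a 3≤b a+2≤ exc no-two = minimal (ℕ.<⇒≤ 2≤a) (ℕ.<⇒≤ 3≤b) (three-or-more 0 3≤b 2≤a a+2≤ λ (p , _ , q) → exc (p , q)) none
  where
  none : ∀ m → a + 2 ≤ b ^ m → suc m < 3 → ¬ HasBaseOfSize a b (suc m)
  none zero p _ _ = contradiction (ℕ.≤-trans (ℕ.+-monoˡ-≤ 2 2≤a) p) λ { (s≤s ()) }
  none (suc zero) _ _ h = no-two h
  none (suc (suc m)) _ (s≤s (s≤s (s≤s ()))) _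

small-power : ∀ {n b} m k → n ≤ b ^ m → b ^ k < n → 1 ≤ b → k < m
small-power {b = b} m k n≤ <n 1≤b = ℕ.≰⇒> λ m≤k → ℕ.<⇒≱ <n (ℕ.≤-trans n≤ (ℕ.^-monoʳ-≤ b {{>-nonZero 1≤b}} m≤k))

size-2-3 : BaseSize 2 3 4
size-2-3 = minimal (s≤s z≤n) (s≤s (s≤s z≤n)) base-2-3 λ m 4≤ m<4 h →
  no-base-2-3 (subst (HasBaseOfSize 2 3) (cong suc (ℕ.≤-antisym (ℕ.≤-pred (ℕ.≤-pred m<4)) (small-power m 1 4≤ ℕ.≤-refl (s≤s z≤n)))) h)

size-4-2 : BaseSize 4 2 5
size-4-2 = minimal (s≤s z≤n) ℕ.≤-refl (two-blocks 2 (s≤s z≤n) (s≤s (s≤s (s≤s z≤n))) (ℕ.m≤m+n 7 9) λ { (_ , ()) }) λ m 6≤ m<5 h →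
  no-base-4-2 (subst (HasBaseOfSize 4 2) (cong suc (ℕ.≤-antisym (ℕ.≤-pred (ℕ.≤-pred m<5)) (small-power m 2 6≤ (ℕ.n≤1+n 5) (s≤s z≤n)))) h)

size-7-3 : BaseSize 7 3 4
size-7-3 = minimal (s≤s z≤n) (s≤s (s≤s z≤n)) (three-or-more 1 ℕ.≤-refl (s≤s (s≤s z≤n)) (ℕ.m≤m+n 9 18) λ { (_ , () , _) }) λ m 9≤ m<4 h →
  no-base-2-3 (complement {2} (s≤s z≤n) (s≤s z≤n) refl
    (subst (HasBaseOfSize 7 3) (cong suc (ℕ.≤-antisym (ℕ.≤-pred (ℕ.≤-pred m<4)) (small-power m 1 9≤ (ℕ.m≤m+n 4 5) (s≤s z≤n)))) h))

theorem1p1 : (BaseSizeUndefined 2 2 × BaseSize 2 3 4 × ((b : ℕ) → 4 ≤ b → BaseSize 2 b 3))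
    × (BaseSize 4 2 5 × ((a : ℕ) → 2 ≤ a → a ≢ 2 → a ≢ 4 → BaseSize a 2 (suc ⌈log₂ (a + 3) ⌉)))
    × ((a b : ℕ) → 3 ≤ a → 3 ≤ b
    → ¬ (a ≡ 3 × b ≡ 6) → ¬ (a ≡ 3 × b ≡ 7) → ¬ (a ≡ 4 × b ≡ 7) → ¬ (a ≡ 7 × b ≡ 3)
    → b ≢ a + 2
    → (k : ℕ) → IsCeilLog b (a + 2) k → BaseSize a b (suc k))
    × (BaseSize 3 6 3 × BaseSize 3 7 3 × BaseSize 4 7 3 × BaseSize 7 3 4
    × ((a : ℕ) → 3 ≤ a → BaseSize a (a + 2) 3))
theorem1p1 =
  (no-base-2-2 , size-2-3 , λ b 4≤b → three-minimal ℕ.≤-refl (ℕ.<⇒≤ 4≤b) (ℕ.≤-trans 4≤b (square b 4≤b)) (λ { (refl , _) → contradiction 4≤b λ { (s≤s (s≤s (s≤s ()))) } })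
    (no-two-matchings (ℕ.≤-trans (s≤s z≤n) 4≤b))) ,
  (size-4-2 , binary) ,
  generic ,
  (three-minimal (s≤s (s≤s z≤n)) (s≤s (s≤s (s≤s z≤n))) (ℕ.m≤m+n 5 31) (λ { (() , _) }) no-base-3-6 ,
   three-minimal (s≤s (s≤s z≤n)) (s≤s (s≤s (s≤s z≤n))) (ℕ.m≤m+n 5 44) (λ { (() , _) }) no-base-3-7 ,
   three-minimal (s≤s (s≤s z≤n)) (s≤s (s≤s (s≤s z≤n))) (ℕ.m≤m+n 6 43) (λ { (() , _) }) (λ h → no-base-3-7 (complement (s≤s z≤n) (s≤s z≤n) refl h)) ,
   size-7-3 ,
   λ a 3≤a → three-minimal (ℕ.<⇒≤ 3≤a) (ℕ.≤-trans 3≤a (ℕ.m≤m+n a 2)) (square (a + 2) (ℕ.≤-trans (ℕ.m≤n+m 2 a) (ℕ.≤-refl)) )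
     (λ { (a+2≡3 , _) → ℕ.<⇒≱ (ℕ.+-monoˡ-≤ 2 3≤a) (ℕ.≤-trans (ℕ.≤-reflexive a+2≡3) (ℕ.n≤1+n 3)) })
     λ h → no-two-matchings (ℕ.≤-trans (s≤s z≤n) (ℕ.≤-trans 3≤a (ℕ.m≤m+n a 2))) (complement (ℕ.≤-trans (s≤s z≤n) 3≤a) (s≤s z≤n) (sym (ℕ.*-identityʳ (a + 2))) h))
  where
  square : ∀ b {n} → n ≤ b → b ≤ b ^ 2
  square zero _ = z≤n
  square b@(suc _) _ = ℕ.≤-trans (ℕ.≤-reflexive (sym (ℕ.*-identityʳ b))) (ℕ.*-monoʳ-≤ b (ℕ.m^n>0 b 1))
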